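{- Let $f$ be a quasisymmetric function with coefficients in $\mathbf{k}$, homogeneous of degree $r>0$. For $m\ge 0$ let $f(x_1,\dots,x_m)$ denote the quasisymmetric polynomial obtained from $f$ by setting $x_i=0$ for all $i>m$. Then: (1) As formal power series in $t$, $$\sum_{j\geq 1}f(1,q,\dots,q^{j-1})\,t^j=\frac{\sum_{m=1}^{r+1}\langle f(x_1,\dots,x_m)\rangle_{r+1}^q\,t^m}{(t;q)_{r+1}},$$ where $f(x_1,\dots,x_m)$ is regarded as a polynomial in $x_1,\dots,x_{r+1}$. (2) The element $f(u_1,u_2-u_1,\dots,u_r-u_{r-1},-u_r)$ (i.e. $f(x_1,\dots,x_{r+1})$ evaluated at $x_1=u_1$, $x_i=u_i-u_{i-1}$ for $1<i\le r$, $x_{r+1}=-u_r$) is zero in $\mathcal{K}_{r+1}$. (3) $\langle g\rangle_{r+1}^q=0$ for every homogeneous polynomial $g$ of degree $r$ lying in the ideal $\mathrm{QSym}_{r+1}^+$.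
   Context: $\mathbf{k}$ is a field of characteristic zero and $q\in\mathbf{k}$ is not a nontrivial root of unity; $[n]_q=1+q+\dots+q^{n-1}$, $[n]_q!=\prod_{i=1}^n[i]_q$, and $(t;q)_n=\prod_{i=1}^{n}(1-tq^{i-1})$. A polynomial in $x_1,\dots,x_n$ is quasisymmetric if for every sequence of positive integers $(\alpha_1,\dots,\alpha_k)$ the coefficient of $x_{i_1}^{\alpha_1}\cdots x_{i_k}^{\alpha_k}$ is the same for all $1\le i_1<\dots<i_k\le n$; quasisymmetric functions are the analogous bounded-degree formal power series in $x_1,x_2,\dots$. $\mathrm{QSym}_n^+$ is the ideal of $\mathbf{k}[x_1,\dots,x_n]$ generated by quasisymmetric polynomials in $x_1,\dots,x_n$ with zero constant term. $q$-divided symmetrization: for $f\in\mathbf{k}[x_1,\dots,x_n]$, $\langle f\rangle_n^q:=\partial_{w_0}\big(f\cdot\prod_{1\le i,\ i+2\le j\le n}(qx_i-x_j)\big)$, where $\partial_{w_0}g=\big(\sum_{w\in S_n}\mathrm{sgn}(w)\,g(x_{w(1)},\dots,x_{w(n)})\big)/\prod_{1\le i<j\le n}(x_i-x_j)$. For $\deg f=n-1$ this is an element of $\mathbf{k}$. $\mathcal{K}_n$ is the commutative $\mathbf{k}$-algebra generated by $u_1,\dots,u_{n-1}$ subject to $(q+1)u_i^2=qu_iu_{i-1}+u_iu_{i+1}$ for $1\le i\le n-1$, with the convention $u_0=u_n=0$. -}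

module Defs where

open import Level using (_⊔_) renaming (suc to lsuc)
open import Algebra.Bundles using (CommutativeRing)
open import Data.Nat as ℕ using (ℕ; zero; suc; _∸_; _<ᵇ_; _≡ᵇ_; _<_)
open import Data.Bool using (Bool; true; false; if_then_else_; _∧_; _∨_; not)
open import Data.List as L using (List; []; _∷_; _++_; map; concatMap; foldr; allFin; upTo; cartesianProduct; filterᵇ)
open import Data.List.Relation.Unary.All using (All)
open import Data.Vec as V using (Vec; []; _∷_; toList)
open import Data.Fin as F using (Fin; toℕ)
open import Data.Product using (_×_; _,_; Σ; proj₁; proj₂)
open import Relation.Nullary using (¬_; yes; no)
open import Relation.Nullary.Decidable using (⌊_⌋)
open import Relation.Binary.PropositionalEquality using (_≡_)
open import Data.Vec.Properties using (≡-dec)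
open import Data.Nat.ListAction using () renaming (sum to sumℕ)
open import Data.Bool.ListAction using () renaming (all to allᵇ)

record Field c ℓ : Set (lsuc (c ⊔ ℓ)) where
  field
    cring : CommutativeRing c ℓ
  open CommutativeRing cring public
  field
    1≉0     : ¬ (1# ≈ 0#)
    inverse : ∀ x → ¬ (x ≈ 0#) → Σ Carrier λ y → x * y ≈ 1#

compress : List ℕ → List ℕ
compress []            = []
compress (zero  ∷ xs)  = compress xs
compress (suc k ∷ xs)  = suc k ∷ compress xs

vecsOfSum : (n s : ℕ) → List (Vec ℕ n)
vecsOfSum zero    zero    = [] ∷ []
vecsOfSum zero    (suc s) = []
vecsOfSum (suc n) s       =
  concatMap (λ k → map (k ∷_) (vecsOfSum n (s ∸ k))) (upTo (suc s))

allFuns : (n m : ℕ) → List (Fin n → Fin m)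
allFuns zero    m = (λ ()) ∷ []
allFuns (suc n) m =
  concatMap (λ a → map (λ g → λ { F.zero → a ; (F.suc i) → g i }) (allFuns n m))
            (allFin m)

pairs : (n : ℕ) → List (Fin n × Fin n)
pairs n = cartesianProduct (allFin n) (allFin n)

isPerm : {n : ℕ} → (Fin n → Fin n) → Bool
isPerm {n} w =
  allᵇ (λ ij → ⌊ proj₁ ij F.≟ proj₂ ij ⌋ ∨ not ⌊ w (proj₁ ij) F.≟ w (proj₂ ij) ⌋)
        (pairs n)

perms : (n : ℕ) → List (Fin n → Fin n)
perms n = filterᵇ isPerm (allFuns n n)

inversions : {n : ℕ} → (Fin n → Fin n) → ℕ
inversions {n} w =
  L.length (filterᵇ (λ ij → (toℕ (proj₁ ij) <ᵇ toℕ (proj₂ ij))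
                          ∧ (toℕ (w (proj₂ ij)) <ᵇ toℕ (w (proj₁ ij))))
                    (pairs n))

module Over {c ℓ} (K : Field c ℓ) where
  open Field K

  natK : ℕ → Carrier
  natK zero    = 0#
  natK (suc n) = 1# + natK n

  powK : Carrier → ℕ → Carrier
  powK x zero    = 1#
  powK x (suc n) = x * powK x n

  sumK : List Carrier → Carrier
  sumK = foldr _+_ 0#

  prodK : List Carrier → Carrier
  prodK = foldr _*_ 1#

  signK : ℕ → Carrier
  signK zero    = 1#
  signK (suc n) = - signK n

  sgn : {n : ℕ} → (Fin n → Fin n) → Carrier
  sgn w = signK (inversions w)

  -- Polynomials in n variables x_0,…,x_{n-1} (paper's x_1,…,x_n):
  -- a finite list of terms (coefficient , exponent vector), not normalised;
  -- equality is equality of all coefficients.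

  Poly : ℕ → Set c
  Poly n = List (Carrier × Vec ℕ n)

  coeff : {n : ℕ} → Poly n → Vec ℕ n → Carrier
  coeff p e = sumK (map (λ t → if ⌊ ≡-dec ℕ._≟_ (proj₂ t) e ⌋ then proj₁ t else 0#) p)

  infix 4 _≈ₚ_
  _≈ₚ_ : {n : ℕ} → Poly n → Poly n → Set ℓ
  p ≈ₚ q = ∀ e → coeff p e ≈ coeff q e

  0ₚ : {n : ℕ} → Poly n
  0ₚ = []

  constₚ : {n : ℕ} → Carrier → Poly n
  constₚ {n} a = (a , V.replicate n 0) ∷ []

  1ₚ : {n : ℕ} → Poly n
  1ₚ = constₚ 1#

  var : {n : ℕ} → Fin n → Poly n
  var {n} i = (1# , V.tabulate (λ j → if ⌊ i F.≟ j ⌋ then 1 else 0)) ∷ []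

  infixl 6 _+ₚ_ _-ₚ_
  infixl 7 _*ₚ_

  _+ₚ_ : {n : ℕ} → Poly n → Poly n → Poly n
  p +ₚ q = p ++ q

  scaleₚ : {n : ℕ} → Carrier → Poly n → Poly n
  scaleₚ a p = map (λ t → (a * proj₁ t , proj₂ t)) p

  -ₚ_ : {n : ℕ} → Poly n → Poly n
  -ₚ p = map (λ t → (- proj₁ t , proj₂ t)) p

  _-ₚ_ : {n : ℕ} → Poly n → Poly n → Poly n
  p -ₚ q = p +ₚ (-ₚ q)

  _*ₚ_ : {n : ℕ} → Poly n → Poly n → Poly n
  p *ₚ q = concatMap (λ s → map (λ t → (proj₁ s * proj₁ t , V.zipWith ℕ._+_ (proj₂ s) (proj₂ t))) q) p

  _^ₚ_ : {n : ℕ} → Poly n → ℕ → Poly n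
  p ^ₚ zero  = 1ₚ
  p ^ₚ suc k = p *ₚ (p ^ₚ k)

  sumₚ : {n : ℕ} → List (Poly n) → Poly n
  sumₚ = foldr _+ₚ_ 0ₚ

  prodₚ : {n : ℕ} → List (Poly n) → Poly n
  prodₚ = foldr _*ₚ_ 1ₚ

  substₚ : {n m : ℕ} → (Fin n → Poly m) → Poly n → Poly m
  substₚ {n} σ p =
    sumₚ (map (λ t → constₚ (proj₁ t) *ₚ prodₚ (map (λ i → σ i ^ₚ V.lookup (proj₂ t) i) (allFin n))) p)

  evalₚ : {n : ℕ} → (Fin n → Carrier) → Poly n → Carrier
  evalₚ {n} v p =
    sumK (map (λ t → proj₁ t * prodK (map (λ i → powK (v i) (V.lookup (proj₂ t) i)) (allFin n))) p)

  IsHomogeneousₚ : {n : ℕ} → ℕ → Poly n → Set ℓ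
  IsHomogeneousₚ r p = ∀ e → ¬ (V.sum e ≡ r) → coeff p e ≈ 0#

  IsQuasisymmetricₚ : {n : ℕ} → Poly n → Set ℓ
  IsQuasisymmetricₚ p = ∀ e e′ → compress (toList e) ≡ compress (toList e′) → coeff p e ≈ coeff p e′

  ZeroConstantTermₚ : {n : ℕ} → Poly n → Set ℓ
  ZeroConstantTermₚ {n} p = coeff p (V.replicate n 0) ≈ 0#

  InQSymIdeal : (n : ℕ) → Poly n → Set (c ⊔ ℓ)
  InQSymIdeal n g =
    Σ (List (Poly n × Poly n)) λ gens →
      All (λ hp → IsQuasisymmetricₚ (proj₂ hp) × ZeroConstantTermₚ (proj₂ hp)) gens
      × (g ≈ₚ sumₚ (map (λ hp → proj₁ hp *ₚ proj₂ hp) gens))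

  -- Quasisymmetric functions in x_1,x_2,…  A monomial x_1^{e_1}⋯x_k^{e_k}
  -- is encoded by its exponent list (e_1,…,e_k); quasisymmetry says its
  -- coefficient equals that of x_1^{α_1}⋯x_l^{α_l}, α = nonzero entries of e
  -- (this also makes the coefficient independent of trailing zeros).

  record QSymFun : Set (c ⊔ ℓ) where
    field
      coeffF   : List ℕ → Carrier
      quasisym : ∀ e → coeffF e ≈ coeffF (compress e)
      bounded  : Σ ℕ λ d → ∀ e → d < sumℕ e → coeffF e ≈ 0#
  open QSymFun public

  IsHomogeneousF : ℕ → QSymFun → Set ℓ
  IsHomogeneousF r f = ∀ e → ¬ (sumℕ e ≡ r) → coeffF f e ≈ 0#

  -- for f homogeneous of degree r: f(x_1,…,x_N) (set x_i = 0 for i > N)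
  polyOf : (r : ℕ) → QSymFun → (N : ℕ) → Poly N
  polyOf r f N = map (λ e → (coeffF f (toList e) , e)) (vecsOfSum N r)

  -- f(x_1,…,x_m) regarded as a polynomial in x_1,…,x_N
  -- (= f(x_1,…,x_N) with x_i := 0 for i > m)
  truncPoly : (r : ℕ) → QSymFun → (m N : ℕ) → Poly N
  truncPoly r f m N = substₚ (λ i → if toℕ i <ᵇ m then var i else 0ₚ) (polyOf r f N)

  stairₚ : Carrier → (n : ℕ) → Poly n
  stairₚ q n = prodₚ (map (λ ij → constₚ q *ₚ var (proj₁ ij) -ₚ var (proj₂ ij))
                          (filterᵇ (λ ij → suc (toℕ (proj₁ ij)) <ᵇ toℕ (proj₂ ij)) (pairs n)))

  vandermonde : (n : ℕ) → Poly n
  vandermonde n = prodₚ (map (λ ij → var (proj₁ ij) -ₚ var (proj₂ ij))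
                             (filterᵇ (λ ij → toℕ (proj₁ ij) <ᵇ toℕ (proj₂ ij)) (pairs n)))

  antisym : (n : ℕ) → Poly n → Poly n
  antisym n g = sumₚ (map (λ w → scaleₚ (sgn w) (substₚ (λ i → var (w i)) g)) (perms n))

  -- ⟨f⟩_n^q = a  (for deg f = n−1), i.e.  ∂_{w0}(f·stair) = a, i.e.
  -- Σ_w sgn(w) w(f·stair) = a · ∏_{i<j}(x_i − x_j)
  DivSymEq : Carrier → (n : ℕ) → Poly n → Carrier → Set ℓ
  DivSymEq q n f a = antisym n (f *ₚ stairₚ q n) ≈ₚ (constₚ a *ₚ vandermonde n)

  -- formal power series in t: coefficient sequences ℕ → k

  cauchy : (ℕ → Carrier) → (ℕ → Carrier) → ℕ → Carrier
  cauchy a b n = sumK (map (λ i → a i * b (n ∸ i)) (upTo (suc n)))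

  qPochₚ : Carrier → ℕ → Poly 1
  qPochₚ q N = prodₚ (map (λ i → 1ₚ -ₚ constₚ (powK q (toℕ i)) *ₚ var F.zero) (allFin N))

  qPochSeries : Carrier → ℕ → ℕ → Carrier
  qPochSeries q N j = coeff (qPochₚ q N) (j ∷ [])

  principalSeries : Carrier → (r : ℕ) → QSymFun → ℕ → Carrier
  principalSeries q r f zero    = 0#
  principalSeries q r f (suc j) = evalₚ (λ i → powK q (toℕ i)) (polyOf r f (suc j))

  numeratorSeries : {N : ℕ} → (Fin N → Carrier) → ℕ → Carrier
  numeratorSeries {N} a j = sumK (map (λ i → if suc (toℕ i) ≡ᵇ j then a i else 0#) (allFin N))

  -- the algebra 𝒦_{r+1} = k[u_1,…,u_r] / ( (q+1)u_i² − q u_i u_{i−1} − u_i u_{i+1} )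
  -- with u_0 = u_{r+1} = 0.  Poly r is k[u_1,…,u_r] (variable i ↔ u_{i+1}).

  uK : (r : ℕ) → ℕ → Poly r
  uK r zero = 0ₚ
  uK r (suc k) with k ℕ.<? r
  ... | yes k<r = var (F.fromℕ< k<r)
  ... | no  _   = 0ₚ

  relK : Carrier → (r : ℕ) → ℕ → Poly r
  relK q r i = constₚ (q + 1#) *ₚ (uK r i *ₚ uK r i)
               -ₚ constₚ q *ₚ (uK r i *ₚ uK r (i ∸ 1))
               -ₚ uK r i *ₚ uK r (suc i)

  IsZeroInK : Carrier → (r : ℕ) → Poly r → Set (c ⊔ ℓ)
  IsZeroInK q r P =
    Σ (Fin r → Poly r) λ h →
      P ≈ₚ sumₚ (map (λ i → h i *ₚ relK q r (suc (toℕ i))) (allFin r))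

  -- x_1 = u_1, x_i = u_i − u_{i−1} (1 < i ≤ r), x_{r+1} = −u_r ;
  -- uniformly x_i = u_i − u_{i−1} using u_0 = u_{r+1} = 0
  uSubst : (r : ℕ) → Fin (suc r) → Poly r
  uSubst r i = uK r (suc (toℕ i)) -ₚ uK r (toℕ i)

-- Put u_i = x_1 + ⋯ + x_i. In a ring where u_i x_{i+1} = q u_i x_i for all i, the elements
-- H_b(i) = u_i u_{i+1} ⋯ u_{i+b-1} / [b]_q! satisfy H_{b+1}(i) − H_{b+1}(i−1) = x_i H_b(i) and
-- x_{i+j} H_b(i) = q^j x_i H_b(i) for j ≤ b. Adding one variable at a time, these give
--   ∑_m f(x_1,…,x_m) t^{m+1} = P_f(t) ∑_i H_r(i) t^i
-- for f quasisymmetric of degree r, where P_f is a polynomial of degree at most r which depends only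
-- on f and q. The point x_i = q^{i-1} satisfies the relations and there the last sum is
-- t / (t;q)_{r+1}, so P_f is the numerator in (1). If moreover u_i = 0 for i ≥ n, then H_d(i) = 0 for
-- i + d > n, hence f(x_1,…,x_n) = 0 in every degree d > 0: this is (2) for n = r + 1.
-- For (1) and (3) the relations are applied modulo the radical of the pairing
-- (h , p) ↦ ⟨degree r part of h p⟩. They hold there because u_i (q x_i − x_{i+1}) completes the
-- staircase product to an S_i × S_{n-i}-invariant times polynomials of too low a degree in the two
-- groups of variables to survive antisymmetrization. In this quotient only H_r(1) = (−x_2)⋯(−x_n)
-- is nonzero in degree r, so the coefficients of P_f are the divided symmetrizations.
module Submission where

open import Defs
open import Level using (Level; _⊔_)
open import Algebra.Bundles using (CommutativeMonoid; CommutativeRing)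
open import Algebra.Morphism.Structures using (IsRingHomomorphism)
open import Algebra.Solver.Ring.AlmostCommutativeRing using (fromCommutativeRing; _-Raw-AlmostCommutative⟶_)
open import Data.Bool using (Bool; true; false; if_then_else_; T; not; _∧_; _∨_)
open import Data.Bool.ListAction using () renaming (all to allᵇ)
open import Data.Fin as F using (Fin; toℕ)
import Data.Fin.Properties as Fₚ
open import Data.Integer as ℤ using (ℤ; +_; -[1+_])
import Data.Integer.Properties as ℤₚ
open import Data.List as L using (List; []; _∷_; _++_; map; concatMap; foldr; allFin; upTo; cartesianProduct; filterᵇ; tabulate)
import Data.List.Properties as Lₚ
open import Data.List.Relation.Unary.All as All using (All; []; _∷_)
import Data.List.Relation.Unary.All.Properties as Allₚ
open import Data.Maybe using (Maybe; just; nothing)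
open import Data.Nat as ℕ using (ℕ; zero; suc; _∸_; _≤_; _<_; _≤?_; _<?_; _<ᵇ_; _≡ᵇ_; z≤n; s≤s; s≤s⁻¹)
open import Data.Nat.ListAction using () renaming (sum to sumℕ)
import Data.Nat.Properties as ℕₚ
open import Data.Product as Product using (_×_; _,_; Σ; proj₁; proj₂)
open import Data.Sum using (_⊎_; inj₁; inj₂)
open import Data.Vec as V using (Vec; []; _∷_)
import Data.Vec.Properties as Vₚ
open import Function using (_∘_; id)
open import Relation.Binary.Definitions using (tri<; tri≈; tri>)
open import Relation.Binary.PropositionalEquality as ≡ using (_≡_; cong; subst)
import Relation.Binary.Reasoning.Setoid as SetoidReasoning
open import Relation.Nullary using (¬_; Dec; yes; no; contradiction)
open import Relation.Nullary.Decidable using (⌊_⌋; ¬?; _×-dec_; decidable-stable)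

-- With x_i = u_i - u_{i-1}, the defining relation of the algebra in (2) is exactly u_i x_{i+1} = q
-- u_i x_i. So one computation, over any commutative ring with a homomorphism from the field, is run
-- three times: in the field with u_i = [i]_q, in the algebra of (2), and modulo the radical. P_f
-- comes from sorting monomials by the exponent of the last variable: f(x_1,...,x_{m+1}) =
-- f(x_1,...,x_m) + ∑_{a≥1} x_{m+1}^a f_a(x_1,...,x_m), with f_a quasisymmetric of degree r - a. At
-- x_i = q^{i-1} the power x_{m+1}^a puts q^a t for t in the series of f_a, and clearing
-- denominators gives P_f(t) = t ∑_{a=1}^r (1-qt)⋯(1-q^{a-1}t) P_{f_a}(q^a t). This recursion
-- involves only the field, so the same coefficients appear in all three rings. The degree argument
-- that puts the relations into the radical covers total degree at most r only; hence the pairing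
-- discards all other components. Characteristic zero enters twice: with the condition on q it makes
-- every [b]_q invertible, and it turns s = -s into s = 0 for alternants.

-- Finite sums and products, and a ring solver with integer coefficients

module BigOp {c ℓ : Level} (M : CommutativeMonoid c ℓ) where
  open CommutativeMonoid M
  open SetoidReasoning setoid

  ⨁ : {a : Level} {A : Set a} → List A → (A → Carrier) → Carrier
  ⨁ xs f = foldr _∙_ ε (map f xs)

  interchange : ∀ a b c d → (a ∙ b) ∙ (c ∙ d) ≈ (a ∙ c) ∙ (b ∙ d)
  interchange a b c d = begin
    (a ∙ b) ∙ (c ∙ d) ≈⟨ assoc a b (c ∙ d) ⟩
    a ∙ (b ∙ (c ∙ d)) ≈⟨ ∙-congˡ (assoc b c d) ⟨
    a ∙ ((b ∙ c) ∙ d) ≈⟨ ∙-congˡ (∙-congʳ (comm b c)) ⟩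
    a ∙ ((c ∙ b) ∙ d) ≈⟨ ∙-congˡ (assoc c b d) ⟩
    a ∙ (c ∙ (b ∙ d)) ≈⟨ assoc a c (b ∙ d) ⟨
    (a ∙ c) ∙ (b ∙ d) ∎

  module _ {a : Level} {A : Set a} where

    ⨁-cong : ∀ (xs : List A) {f g : A → Carrier} → (∀ x → f x ≈ g x) → ⨁ xs f ≈ ⨁ xs g
    ⨁-cong []       e = refl
    ⨁-cong (x ∷ xs) e = ∙-cong (e x) (⨁-cong xs e)

    ⨁-++ : ∀ (xs ys : List A) f → ⨁ (xs ++ ys) f ≈ ⨁ xs f ∙ ⨁ ys f
    ⨁-++ []       ys f = sym (identityˡ _)
    ⨁-++ (x ∷ xs) ys f = trans (∙-congˡ (⨁-++ xs ys f)) (sym (assoc _ _ _))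

    ⨁-ε : ∀ (xs : List A) {f : A → Carrier} → (∀ x → f x ≈ ε) → ⨁ xs f ≈ ε
    ⨁-ε []       e = refl
    ⨁-ε (x ∷ xs) e = trans (∙-cong (e x) (⨁-ε xs e)) (identityˡ ε)

    ⨁-∙ : ∀ (xs : List A) f g → ⨁ xs (λ x → f x ∙ g x) ≈ ⨁ xs f ∙ ⨁ xs g
    ⨁-∙ []       f g = sym (identityˡ ε)
    ⨁-∙ (x ∷ xs) f g = trans (∙-congˡ (⨁-∙ xs f g)) (interchange _ _ _ _)

    ⨁-filter : ∀ (p : A → Bool) (xs : List A) f →
               ⨁ (filterᵇ p xs) f ≈ ⨁ xs (λ x → if p x then f x else ε)
    ⨁-filter p []       f = refl
    ⨁-filter p (x ∷ xs) f with p x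
    ... | true  = ∙-congˡ (⨁-filter p xs f)
    ... | false = trans (⨁-filter p xs f) (sym (identityˡ _))

  module _ {a b : Level} {A : Set a} {B : Set b} where

    ⨁-map : ∀ (h : A → B) (xs : List A) f → ⨁ (map h xs) f ≡ ⨁ xs (f ∘ h)
    ⨁-map h xs f = cong (foldr _∙_ ε) (≡.sym (Lₚ.map-∘ xs))

    ⨁-concatMap : ∀ (h : A → List B) (xs : List A) f →
                  ⨁ (concatMap h xs) f ≈ ⨁ xs (λ x → ⨁ (h x) f)
    ⨁-concatMap h []       f = refl
    ⨁-concatMap h (x ∷ xs) f =
      trans (⨁-++ (h x) (concatMap h xs) f) (∙-congˡ (⨁-concatMap h xs f))

    ⨁-swap : ∀ (xs : List A) (ys : List B) (f : A → B → Carrier) →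
             ⨁ xs (λ x → ⨁ ys (f x)) ≈ ⨁ ys (λ y → ⨁ xs (λ x → f x y))
    ⨁-swap []       ys f = sym (⨁-ε ys (λ _ → refl))
    ⨁-swap (x ∷ xs) ys f =
      trans (∙-congˡ (⨁-swap xs ys f)) (sym (⨁-∙ ys (f x) _))

  module _ {a b : Level} {A : Set a} {B : Set b} where

    ⨁-cartesianProduct : ∀ (xs : List A) (ys : List B) f →
      ⨁ (cartesianProduct xs ys) f ≈ ⨁ xs (λ x → ⨁ ys (λ y → f (x , y)))
    ⨁-cartesianProduct []       ys f = refl
    ⨁-cartesianProduct (x ∷ xs) ys f =
      trans (⨁-++ (map (x ,_) ys) _ f)
            (∙-cong (reflexive (⨁-map (x ,_) ys f)) (⨁-cartesianProduct xs ys f))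

  ⨁-allFin : ∀ n (f : Fin (suc n) → Carrier) →
             ⨁ (allFin (suc n)) f ≡ f F.zero ∙ ⨁ (allFin n) (f ∘ F.suc)
  ⨁-allFin n f = cong (λ l → f F.zero ∙ foldr _∙_ ε l)
    (≡.trans (Lₚ.map-tabulate F.suc f) (≡.sym (Lₚ.map-tabulate id (f ∘ F.suc))))

  ⨁-upTo : ∀ n (f : ℕ → Carrier) →
           ⨁ (upTo (suc n)) f ≡ f 0 ∙ ⨁ (upTo n) (f ∘ suc)
  ⨁-upTo n f = cong (λ l → f 0 ∙ foldr _∙_ ε l)
    (≡.trans (Lₚ.map-applyUpTo suc f n) (≡.sym (Lₚ.map-applyUpTo id (f ∘ suc) n)))

module IntegerSolver {c ℓ : Level} (R : CommutativeRing c ℓ) where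
  open CommutativeRing R
  open SetoidReasoning setoid
  open import Algebra.Properties.Ring ring
  open import Algebra.Properties.AbelianGroup +-abelianGroup using (⁻¹-∙-comm)
  open import Algebra.Properties.Semiring.Mult.TCOptimised semiring renaming (_×_ to _·_)
  private module ◦ = BigOp +-commutativeMonoid

  -- Integer coefficients have decidable equality, which an arbitrary carrier does not, so the
  -- solver can cancel terms in every commutative ring.
  fromℤ : ℤ → Carrier
  fromℤ (+ n)    = n · 1#
  fromℤ -[1+ n ] = - (suc n · 1#)

  private
    fromℕ-suc : ∀ n → suc n · 1# ≈ 1# + n · 1#
    fromℕ-suc n = ×-homo-+ 1# 1 n

    1+-cancel : ∀ a b → a - b ≈ (1# + a) - (1# + b)
    1+-cancel a b = begin
      a - b                     ≈⟨ +-identityˡ _ ⟨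
      0# + (a - b)              ≈⟨ +-congʳ (-‿inverseʳ 1#) ⟨
      (1# - 1#) + (a - b)       ≈⟨ ◦.interchange 1# (- 1#) a (- b) ⟩
      (1# + a) + (- 1# + (- b)) ≈⟨ +-congˡ (⁻¹-∙-comm 1# b) ⟩
      (1# + a) - (1# + b)       ∎

    fromℤ-⊖ : ∀ m n → fromℤ (m ℤ.⊖ n) ≈ m · 1# - n · 1#
    fromℤ-⊖ m zero = sym (trans (+-congˡ -0#≈0#) (+-identityʳ _))
    fromℤ-⊖ zero (suc n) = sym (+-identityˡ _)
    fromℤ-⊖ (suc m) (suc n) = begin
      fromℤ (suc m ℤ.⊖ suc n)         ≡⟨ cong fromℤ (ℤₚ.[1+m]⊖[1+n]≡m⊖n m n) ⟩
      fromℤ (m ℤ.⊖ n)                 ≈⟨ fromℤ-⊖ m n ⟩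
      m · 1# - n · 1#                 ≈⟨ 1+-cancel _ _ ⟩
      (1# + m · 1#) - (1# + n · 1#)   ≈⟨ +-cong (fromℕ-suc m) (-‿cong (fromℕ-suc n)) ⟨
      suc m · 1# - suc n · 1#         ∎

    +-homo : ∀ i j → fromℤ (i ℤ.+ j) ≈ fromℤ i + fromℤ j
    +-homo (+ m)    (+ n)    = ×-homo-+ 1# m n
    +-homo (+ m)    -[1+ n ] = fromℤ-⊖ m (suc n)
    +-homo -[1+ m ] (+ n)    = trans (fromℤ-⊖ n (suc m)) (+-comm _ _)
    +-homo -[1+ m ] -[1+ n ] = begin
      - (suc (suc (m ℕ.+ n)) · 1#)      ≡⟨ cong (λ k → - (suc k · 1#)) (≡.sym (ℕₚ.+-suc m n)) ⟩
      - ((suc m ℕ.+ suc n) · 1#)        ≈⟨ -‿cong (×-homo-+ 1# (suc m) (suc n)) ⟩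
      - (suc m · 1# + suc n · 1#)       ≈⟨ ⁻¹-∙-comm _ _ ⟨
      - (suc m · 1#) + - (suc n · 1#)   ∎

    neg-homo : ∀ i → fromℤ (ℤ.- i) ≈ - fromℤ i
    neg-homo (+ zero)  = sym -0#≈0#
    neg-homo (+ suc n) = refl
    neg-homo -[1+ n ]  = sym (-‿involutive _)

    *-homo⁺ : ∀ m n → fromℤ (+ m ℤ.* + n) ≈ m · 1# * n · 1#
    *-homo⁺ m n = trans (reflexive (cong fromℤ (≡.sym (ℤₚ.pos-* m n)))) (×1-homo-* m n)

    *-homo : ∀ i j → fromℤ (i ℤ.* j) ≈ fromℤ i * fromℤ j
    *-homo (+ m) (+ n) = *-homo⁺ m n
    *-homo (+ m) -[1+ n ] = begin
      fromℤ (+ m ℤ.* (ℤ.- (+ suc n)))   ≡⟨ cong fromℤ (≡.sym (ℤₚ.neg-distribʳ-* (+ m) (+ suc n))) ⟩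
      fromℤ (ℤ.- (+ m ℤ.* + suc n))     ≈⟨ neg-homo (+ m ℤ.* + suc n) ⟩
      - fromℤ (+ m ℤ.* + suc n)         ≈⟨ -‿cong (*-homo⁺ m (suc n)) ⟩
      - (m · 1# * suc n · 1#)           ≈⟨ -‿distribʳ-* _ _ ⟩
      m · 1# * - (suc n · 1#)           ∎
    *-homo -[1+ m ] (+ n) = begin
      fromℤ ((ℤ.- (+ suc m)) ℤ.* + n)   ≡⟨ cong fromℤ (≡.sym (ℤₚ.neg-distribˡ-* (+ suc m) (+ n))) ⟩
      fromℤ (ℤ.- (+ suc m ℤ.* + n))     ≈⟨ neg-homo (+ suc m ℤ.* + n) ⟩
      - fromℤ (+ suc m ℤ.* + n)         ≈⟨ -‿cong (*-homo⁺ (suc m) n) ⟩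
      - (suc m · 1# * n · 1#)           ≈⟨ -‿distribˡ-* _ _ ⟩
      - (suc m · 1#) * n · 1#           ∎
    *-homo -[1+ m ] -[1+ n ] = begin
      fromℤ (+ suc m ℤ.* + suc n)         ≈⟨ *-homo⁺ (suc m) (suc n) ⟩
      suc m · 1# * suc n · 1#             ≈⟨ -‿involutive _ ⟨
      - - (suc m · 1# * suc n · 1#)       ≈⟨ -‿cong (-‿distribʳ-* _ _) ⟩
      - (suc m · 1# * - (suc n · 1#))     ≈⟨ -‿distribˡ-* _ _ ⟩
      - (suc m · 1#) * - (suc n · 1#)     ∎

    morphism : ℤ.+-*-rawRing -Raw-AlmostCommutative⟶ fromCommutativeRing R
    morphism = record
      { ⟦_⟧ = fromℤ ; +-homo = +-homo ; *-homo = *-homo ; -‿homo = neg-homo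
      ; 0-homo = refl ; 1-homo = refl }

    coeff≟ : ∀ i j → Maybe (fromℤ i ≈ fromℤ j)
    coeff≟ i j with i ℤ.≟ j
    ... | yes ≡.refl = just refl
    ... | no  _      = nothing

  open import Algebra.Solver.Ring ℤ.+-*-rawRing (fromCommutativeRing R) morphism coeff≟ public
    using (solve; _:=_; _:+_; _:*_; _:-_; :-_; con)

tabulate-0 : ∀ {n} → V.tabulate {n = n} (λ _ → 0) ≡ V.replicate n 0
tabulate-0 {zero}  = ≡.refl
tabulate-0 {suc n} = cong (0 ∷_) tabulate-0

module RingLemmas {c ℓ : Level} (R : CommutativeRing c ℓ) where
  open CommutativeRing R
  open SetoidReasoning setoid
  open import Algebra.Properties.Ring ring using (-0#≈0#)
  open import Algebra.Properties.AbelianGroup +-abelianGroup using (⁻¹-∙-comm)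
  open IntegerSolver R public
  open BigOp +-commutativeMonoid public using () renaming
    ( ⨁ to ∑; ⨁-cong to ∑-cong; ⨁-++ to ∑-++; ⨁-ε to ∑-0; ⨁-∙ to ∑-+; ⨁-filter to ∑-filter
    ; ⨁-map to ∑-map; ⨁-concatMap to ∑-concatMap; ⨁-swap to ∑-swap
    ; ⨁-allFin to ∑-allFin; ⨁-upTo to ∑-upTo
    ; interchange to +-interchange)
  open BigOp *-commutativeMonoid public using () renaming
    ( ⨁ to ∏; ⨁-cong to ∏-cong; ⨁-ε to ∏-1; ⨁-∙ to ∏-*; ⨁-filter to ∏-filter
    ; ⨁-cartesianProduct to ∏-cartesianProduct; ⨁-allFin to ∏-allFin; interchange to *-interchange)

  module _ {a : Level} {A : Set a} where

    ∑-distribˡ : ∀ x (ts : List A) f → x * ∑ ts f ≈ ∑ ts (λ t → x * f t)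
    ∑-distribˡ x []       f = zeroʳ x
    ∑-distribˡ x (t ∷ ts) f = trans (distribˡ x _ _) (+-congˡ (∑-distribˡ x ts f))

    ∑-distribʳ : ∀ x (ts : List A) f → ∑ ts f * x ≈ ∑ ts (λ t → f t * x)
    ∑-distribʳ x []       f = zeroˡ x
    ∑-distribʳ x (t ∷ ts) f = trans (distribʳ x _ _) (+-congˡ (∑-distribʳ x ts f))

    ∑-neg : ∀ (ts : List A) f → - ∑ ts f ≈ ∑ ts (λ t → - f t)
    ∑-neg []       f = -0#≈0#
    ∑-neg (t ∷ ts) f = trans (sym (⁻¹-∙-comm _ _)) (+-congˡ (∑-neg ts f))

  -- Exactly what turns s = -s into s = 0. It passes from the field to polynomials coefficient by
  -- coefficient.
  2-Cancellable : Set (c ⊔ ℓ)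
  2-Cancellable = ∀ x → x + x ≈ 0# → x ≈ 0#

  ≈-from-difference : ∀ x y → x - y ≈ 0# → x ≈ y
  ≈-from-difference x y e = trans (solve 2 (λ x y → x := (x :- y) :+ y) refl x y) (trans (+-congʳ e) (+-identityˡ y))

  difference-zero : ∀ {x y} → x ≈ y → x - y ≈ 0#
  difference-zero {x} {y} e = trans (+-congʳ e) (-‿inverseʳ y)

  distrib-difference : ∀ a x y → a * (x - y) ≈ a * x - a * y
  distrib-difference = solve 3 (λ a x y → a :* (x :- y) := a :* x :- a :* y) refl

  pow : Carrier → ℕ → Carrier
  pow x zero    = 1#
  pow x (suc k) = x * pow x k

  pow-cong : ∀ {x y} k → x ≈ y → pow x k ≈ pow y k
  pow-cong zero    e = refl
  pow-cong (suc k) e = *-cong e (pow-cong k e)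

  pow-+ : ∀ x j k → pow x (j ℕ.+ k) ≈ pow x j * pow x k
  pow-+ x zero    k = sym (*-identityˡ _)
  pow-+ x (suc j) k = trans (*-congˡ (pow-+ x j k)) (sym (*-assoc _ _ _))

  pow-pow : ∀ x j k → pow (pow x j) k ≈ pow x (j ℕ.* k)
  pow-pow x j zero    = reflexive (cong (pow x) (≡.sym (ℕₚ.*-zeroʳ j)))
  pow-pow x j (suc k) = trans (*-congˡ (pow-pow x j k))
    (trans (sym (pow-+ x j (j ℕ.* k))) (reflexive (cong (pow x) (≡.sym (ℕₚ.*-suc j k)))))

  mono : ∀ {n} → Vec Carrier n → Vec ℕ n → Carrier
  mono []       []       = 1#
  mono (z ∷ zs) (e ∷ es) = pow z e * mono zs es

  mono-+ : ∀ {n} (z : Vec Carrier n) d e → mono z (V.zipWith ℕ._+_ d e) ≈ mono z d * mono z e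
  mono-+ []       []       []       = sym (*-identityˡ 1#)
  mono-+ (z ∷ zs) (d ∷ ds) (e ∷ es) =
    trans (*-cong (pow-+ z d e) (mono-+ zs ds es)) (*-interchange _ _ _ _)

  mono-0 : ∀ {n} (z : Vec Carrier n) → mono z (V.replicate n 0) ≈ 1#
  mono-0 []       = refl
  mono-0 (z ∷ zs) = trans (*-identityˡ _) (mono-0 zs)

  unitVec : ∀ {n} → Fin n → Vec ℕ n
  unitVec i = V.tabulate (λ j → if ⌊ i F.≟ j ⌋ then 1 else 0)

  unitVec-suc : ∀ {n} (i : Fin n) → unitVec (F.suc i) ≡ 0 ∷ unitVec i
  unitVec-suc i = cong (0 ∷_) (Vₚ.tabulate-cong same)
    where
    same : ∀ j → (if ⌊ F.suc i F.≟ F.suc j ⌋ then 1 else 0) ≡ (if ⌊ i F.≟ j ⌋ then 1 else 0)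
    same j with i F.≟ j
    ... | yes _ = ≡.refl
    ... | no  _ = ≡.refl

  mono-unitVec : ∀ {n} (z : Vec Carrier n) i → mono z (unitVec i) ≈ V.lookup z i
  mono-unitVec (z ∷ zs) F.zero = trans (*-cong (*-identityʳ z)
    (trans (reflexive (cong (mono zs) tabulate-0)) (mono-0 zs))) (*-identityʳ z)
  mono-unitVec (z ∷ zs) (F.suc i) = trans (reflexive (cong (mono (z ∷ zs)) (unitVec-suc i)))
    (trans (*-identityˡ _) (mono-unitVec zs i))

  mono-tabulate : ∀ {n} (z : Fin n → Carrier) (e : Vec ℕ n) →
    mono (V.tabulate z) e ≈ ∏ (allFin n) (λ i → pow (z i) (V.lookup e i))
  mono-tabulate {zero}  z []       = refl
  mono-tabulate {suc n} z (e ∷ es) = trans (*-congˡ (mono-tabulate (z ∘ F.suc) es))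
    (reflexive (≡.sym (∏-allFin n (λ i → pow (z i) (V.lookup (e ∷ es) i)))))

module Hom {a b c d : Level} (A : CommutativeRing a b) (B : CommutativeRing c d) where
  private
    module A = CommutativeRing A
    module B = CommutativeRing B
  open import Algebra.Properties.Ring B.ring using (x+x≈x⇒x≈0)
  open import Algebra.Properties.Group B.+-group using (inverseʳ-unique)

  IsHom : (A.Carrier → B.Carrier) → Set _
  IsHom = IsRingHomomorphism A.rawRing B.rawRing

  mkHom : (f : A.Carrier → B.Carrier) →
    (∀ {x y} → x A.≈ y → f x B.≈ f y) →
    (∀ x y → f (x A.+ y) B.≈ f x B.+ f y) →
    (∀ x y → f (x A.* y) B.≈ f x B.* f y) →
    f A.1# B.≈ B.1# → IsHom f
  mkHom f f-cong f-+ f-* f-1 = record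
    { isSemiringHomomorphism = record
      { isNearSemiringHomomorphism = record
        { +-isMonoidHomomorphism = record
          { isMagmaHomomorphism = record
            { isRelHomomorphism = record { cong = f-cong } ; homo = f-+ }
          ; ε-homo = f-0 }
        ; *-homo = f-* }
      ; 1#-homo = f-1 }
    ; -‿homo = λ x → inverseʳ-unique (f x) (f (A.- x))
        (B.trans (B.sym (f-+ x (A.- x))) (B.trans (f-cong (A.-‿inverseʳ x)) f-0)) }
    where
    f-0 : f A.0# B.≈ B.0#
    f-0 = x+x≈x⇒x≈0 (f A.0#) (B.trans (B.sym (f-+ A.0# A.0#)) (f-cong (A.+-identityˡ A.0#)))

-- Polynomials as a commutative ring, and linear maps out of it

module Polynomials {c ℓ : Level} (K : Field c ℓ) where
  open Field K
  open Over K public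
  open RingLemmas cring
  open import Algebra.Properties.Ring ring using (-0#≈0#)
  private module S = SetoidReasoning setoid

  Term : ℕ → Set c
  Term n = Carrier × Vec ℕ n

  module _ {n : ℕ} where

    infixl 7 _·_
    _·_ : Term n → Term n → Term n
    s · t = proj₁ s * proj₁ t , V.zipWith ℕ._+_ (proj₂ s) (proj₂ t)

    at : Vec ℕ n → Term n → Carrier
    at e t = if ⌊ Vₚ.≡-dec ℕ._≟_ (proj₂ t) e ⌋ then proj₁ t else 0#

    at-cong : ∀ e {a b d} → a ≈ b → at e (a , d) ≈ at e (b , d)
    at-cong e {d = d} a≈b with ⌊ Vₚ.≡-dec ℕ._≟_ d e ⌋
    ... | true  = a≈b
    ... | false = refl

    at-neg : ∀ e a d → at e (- a , d) ≈ - at e (a , d)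
    at-neg e a d with ⌊ Vₚ.≡-dec ℕ._≟_ d e ⌋
    ... | true  = refl
    ... | false = sym -0#≈0#

    at-+ : ∀ e a b d → at e (a + b , d) ≈ at e (a , d) + at e (b , d)
    at-+ e a b d with ⌊ Vₚ.≡-dec ℕ._≟_ d e ⌋
    ... | true  = refl
    ... | false = sym (+-identityˡ 0#)

    at-*ˡ : ∀ e a b d → at e (a * b , d) ≈ a * at e (b , d)
    at-*ˡ e a b d with ⌊ Vₚ.≡-dec ℕ._≟_ d e ⌋
    ... | true  = refl
    ... | false = sym (zeroʳ a)

    coeff-+ : ∀ (p p′ : Poly n) e → coeff (p +ₚ p′) e ≈ coeff p e + coeff p′ e
    coeff-+ p p′ e = ∑-++ p p′ (at e)

    coeff-neg : ∀ (p : Poly n) e → coeff (-ₚ p) e ≈ - coeff p e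
    coeff-neg p e = S.begin
      ∑ (-ₚ p) (at e)                          S.≡⟨ ∑-map _ p (at e) ⟩
      ∑ p (λ t → at e (- proj₁ t , proj₂ t))   S.≈⟨ ∑-cong p (λ t → at-neg e (proj₁ t) (proj₂ t)) ⟩
      ∑ p (λ t → - at e t)                     S.≈⟨ ∑-neg p (at e) ⟨
      - coeff p e                              S.∎

    -- Term lists are not normalised, so an induction on them has to remove all terms of one
    -- exponent together.
    others : Vec ℕ n → Poly n → Poly n
    others e = filterᵇ (λ t → not ⌊ Vₚ.≡-dec ℕ._≟_ (proj₂ t) e ⌋)

    coeff-others-≡ : ∀ e p → coeff (others e p) e ≈ 0#
    coeff-others-≡ e [] = refl
    coeff-others-≡ e (t ∷ p) with Vₚ.≡-dec ℕ._≟_ (proj₂ t) e in eq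
    ... | yes _ = coeff-others-≡ e p
    ... | no  _ rewrite eq = trans (+-identityˡ _) (coeff-others-≡ e p)

    coeff-others-≢ : ∀ e p d → ¬ (e ≡ d) → coeff (others e p) d ≈ coeff p d
    coeff-others-≢ e [] d e≢d = refl
    coeff-others-≢ e (t ∷ p) d e≢d with Vₚ.≡-dec ℕ._≟_ (proj₂ t) e
    ... | no  _ = +-congˡ (coeff-others-≢ e p d e≢d)
    ... | yes ≡.refl with Vₚ.≡-dec ℕ._≟_ (proj₂ t) d
    ...   | yes e≡d = contradiction e≡d e≢d
    ...   | no  _   = trans (coeff-others-≢ e p d e≢d) (sym (+-identityˡ _))

    length-others : ∀ e p → L.length (others e p) ≤ L.length p
    length-others e p = Lₚ.length-filter _ p

  -- A record around `≈ₚ`: the latter unfolds to a function type, from which the two polynomials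
  -- could not be inferred.
  record _≋_ {n : ℕ} (p p′ : Poly n) : Set ℓ where
    constructor mk
    field un : p ≈ₚ p′
  open _≋_ public
  infix 4 _≋_

  module Linear {c′ ℓ′ : Level} (R : CommutativeRing c′ ℓ′) (ι : Carrier → CommutativeRing.Carrier R)
                (ι-hom : Hom.IsHom cring R ι) where
    private
      module R = CommutativeRing R
      module RL = RingLemmas R
      module SR = SetoidReasoning R.setoid
    open IsRingHomomorphism ι-hom public renaming
      (⟦⟧-cong to ι-cong; +-homo to ι-+; *-homo to ι-*; 0#-homo to ι-0; 1#-homo to ι-1; -‿homo to ι-neg)

    module _ {n : ℕ} where

      linTerm : (Vec ℕ n → R.Carrier) → Term n → R.Carrier
      linTerm ψ t = ι (proj₁ t) R.* ψ (proj₂ t)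

      -- Linear extension of a function on exponents. Evaluation, multiplication by a fixed
      -- polynomial, antisymmetrization and convolution are all instances.
      lin : (Vec ℕ n → R.Carrier) → Poly n → R.Carrier
      lin ψ p = RL.∑ p (linTerm ψ)

      lin-split : ∀ ψ e p → lin ψ p R.≈ ι (coeff p e) R.* ψ e R.+ lin ψ (others e p)
      lin-split ψ e [] = R.sym (R.trans (R.+-identityʳ _) (R.trans (R.*-congʳ ι-0) (R.zeroˡ _)))
      lin-split ψ e (t ∷ p) with Vₚ.≡-dec ℕ._≟_ (proj₂ t) e
      ... | yes ≡.refl = SR.begin
        linTerm ψ t R.+ lin ψ p                  SR.≈⟨ R.+-congˡ (lin-split ψ e p) ⟩
        _                                        SR.≈⟨ R.+-assoc _ _ _ ⟨
        _                                        SR.≈⟨ R.+-congʳ (R.distribʳ _ _ _) ⟨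
        _                                        SR.≈⟨ R.+-congʳ (R.*-congʳ (ι-+ _ _)) ⟨
        _                                        SR.∎
      ... | no _ = SR.begin
        linTerm ψ t R.+ lin ψ p                  SR.≈⟨ R.+-congˡ (lin-split ψ e p) ⟩
        _                                        SR.≈⟨ RL.solve 3 (λ x y z → x RL.:+ (y RL.:+ z) RL.:= y RL.:+ (x RL.:+ z)) R.refl _ _ _ ⟩
        _                                        SR.≈⟨ R.+-congʳ (R.*-congʳ (ι-cong (+-identityˡ _))) ⟨
        _                                        SR.∎

      -- The terms sharing the exponent of the head contribute its coefficient times `ψ`; the
      -- remaining ones form a shorter list with the other coefficients unchanged.
      lin-zero : ∀ ψ p → (∀ e → ι (coeff p e) R.* ψ e R.≈ R.0#) → lin ψ p R.≈ R.0#
      lin-zero ψ p = go (L.length p) p ℕₚ.≤-refl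
        where
        -- The recursion is on a bound for the length, because `others e p` is not a structural part
        -- of `p`.
        go : ∀ k p → L.length p ≤ k → (∀ e → ι (coeff p e) R.* ψ e R.≈ R.0#) → lin ψ p R.≈ R.0#
        go k       []      _           z = R.refl
        go (suc k) (t ∷ p) (s≤s p≤k) z = R.trans (lin-split ψ e (t ∷ p))
          (R.trans (R.+-cong (z e) (go k (others e (t ∷ p)) short z′)) (R.+-identityˡ _))
          where
          e = proj₂ t
          drop : others e (t ∷ p) ≡ others e p
          drop with Vₚ.≡-dec ℕ._≟_ (proj₂ t) e
          ... | yes _   = ≡.refl
          ... | no  e≢e = contradiction ≡.refl e≢e
          short : L.length (others e (t ∷ p)) ≤ k
          short = subst (λ l → L.length l ≤ k) (≡.sym drop) (ℕₚ.≤-trans (length-others e p) p≤k)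
          z′ : ∀ d → ι (coeff (others e (t ∷ p)) d) R.* ψ d R.≈ R.0#
          z′ d with Vₚ.≡-dec ℕ._≟_ e d
          ... | yes ≡.refl = R.trans (R.*-congʳ (R.trans (ι-cong (coeff-others-≡ e (t ∷ p))) ι-0)) (R.zeroˡ _)
          ... | no  e≢d    = R.trans (R.*-congʳ (ι-cong (coeff-others-≢ e (t ∷ p) d e≢d))) (z d)

      lin-+ : ∀ ψ p p′ → lin ψ (p +ₚ p′) R.≈ lin ψ p R.+ lin ψ p′
      lin-+ ψ p p′ = RL.∑-++ p p′ (linTerm ψ)

      lin-neg : ∀ ψ p → lin ψ (-ₚ p) R.≈ R.- lin ψ p
      lin-neg ψ p = SR.begin
        lin ψ (-ₚ p)                                 SR.≡⟨ RL.∑-map _ p (linTerm ψ) ⟩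
        RL.∑ p (λ t → ι (- proj₁ t) R.* ψ (proj₂ t)) SR.≈⟨ RL.∑-cong p (λ t → R.trans (R.*-congʳ (ι-neg _)) (R.sym (-‿distribˡ-* _ _))) ⟩
        RL.∑ p (λ t → R.- linTerm ψ t)               SR.≈⟨ RL.∑-neg p (linTerm ψ) ⟨
        R.- lin ψ p                                  SR.∎
        where open import Algebra.Properties.Ring R.ring using (-‿distribˡ-*)

      -- All coefficients of the difference vanish. This is how operations defined on term lists are
      -- shown to respect equality of coefficients.
      lin-cong : ∀ ψ {p p′} → p ≋ p′ → lin ψ p R.≈ lin ψ p′
      lin-cong ψ {p} {p′} (mk e) = RL.≈-from-difference _ _ (R.trans (R.sym (R.trans (lin-+ ψ p (-ₚ p′)) (R.+-congˡ (lin-neg ψ p′))))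
          (lin-zero ψ (p -ₚ p′) λ d → R.trans (R.*-congʳ (R.trans (ι-cong (diff d)) ι-0)) (R.zeroˡ _)))
        where
        diff : ∀ d → coeff (p -ₚ p′) d ≈ 0#
        diff d = trans (coeff-+ p (-ₚ p′) d) (trans (+-cong (e d) (coeff-neg p′ d)) (-‿inverseʳ _))

      -- The two functions may differ off the support of `p`, for instance in degrees where a
      -- homogeneous polynomial has no coefficients.
      lin-agree : ∀ ψ ψ′ p → (∀ e → ι (coeff p e) R.* ψ e R.≈ ι (coeff p e) R.* ψ′ e) → lin ψ p R.≈ lin ψ′ p
      lin-agree ψ ψ′ p agree = RL.≈-from-difference _ _ (R.trans (R.sym difference)
        (lin-zero (λ e → ψ e R.- ψ′ e) p (λ e → R.trans (RL.distrib-difference _ _ _) (RL.difference-zero (agree e)))))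
        where
        difference : lin (λ e → ψ e R.- ψ′ e) p R.≈ lin ψ p R.- lin ψ′ p
        difference = R.trans (RL.∑-cong p (λ t → RL.distrib-difference _ _ _))
          (R.trans (RL.∑-+ p _ _) (R.+-congˡ (R.sym (RL.∑-neg p _))))

      ∑-product : ∀ (p p′ : Poly n) f → RL.∑ (p *ₚ p′) f R.≈ RL.∑ p (λ s → RL.∑ p′ (λ t → f (s · t)))
      ∑-product p p′ f = R.trans (RL.∑-concatMap _ p f) (RL.∑-cong p (λ s → R.reflexive (RL.∑-map (s ·_) p′ f)))

      ev : Vec R.Carrier n → Poly n → R.Carrier
      ev z = lin (RL.mono z)

      ev-* : ∀ z p p′ → ev z (p *ₚ p′) R.≈ ev z p R.* ev z p′
      ev-* z p p′ = SR.begin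
        ev z (p *ₚ p′) SR.≈⟨ ∑-product p p′ _ ⟩
        RL.∑ p (λ s → RL.∑ p′ (λ t → term (s · t)))
          SR.≈⟨ RL.∑-cong p (λ s → RL.∑-cong p′ (λ t →
                  R.trans (R.*-cong (ι-* _ _) (RL.mono-+ z _ _)) (RL.*-interchange _ _ _ _))) ⟩
        RL.∑ p (λ s → RL.∑ p′ (λ t → term s R.* term t))
          SR.≈⟨ RL.∑-cong p (λ s → R.sym (RL.∑-distribˡ (term s) p′ term)) ⟩
        RL.∑ p (λ s → term s R.* ev z p′) SR.≈⟨ RL.∑-distribʳ (ev z p′) p term ⟨
        ev z p R.* ev z p′ SR.∎
        where term = linTerm (RL.mono z)

      ev-const : ∀ z a → ev z (constₚ a) R.≈ ι a
      ev-const z a = R.trans (R.+-identityʳ _) (R.trans (R.*-congˡ (RL.mono-0 z)) (R.*-identityʳ _))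

      ev-1 : ∀ z → ev z 1ₚ R.≈ R.1#
      ev-1 z = R.trans (ev-const z 1#) ι-1

      ev-var : ∀ z i → ev z (var i) R.≈ V.lookup z i
      ev-var z i = R.trans (R.+-identityʳ _) (R.trans (R.*-cong ι-1 (RL.mono-unitVec z i)) (R.*-identityˡ _))

      ev-minus : ∀ z p p′ → ev z (p -ₚ p′) R.≈ ev z p R.- ev z p′
      ev-minus z p p′ = R.trans (lin-+ _ p (-ₚ p′)) (R.+-congˡ (lin-neg _ p′))

      ev-prod : ∀ {a} {A : Set a} z (xs : List A) (f : A → Poly n) →
                ev z (prodₚ (map f xs)) R.≈ RL.∏ xs (λ x → ev z (f x))
      ev-prod z []       f = ev-1 z
      ev-prod z (x ∷ xs) f = R.trans (ev-* z (f x) _) (R.*-congˡ (ev-prod z xs f))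

  ring-id : Hom.IsHom cring cring id
  ring-id = Hom.mkHom cring cring id id (λ _ _ → refl) (λ _ _ → refl) refl

  private module LK = Linear cring id ring-id

  module _ {n : ℕ} where
    private
      -- The coefficient of `e` in x^d times `p`. A coefficient of a product is the linear extension
      -- of this in the first factor, so congruence of the product is an instance of `lin-cong`.
      prodCoeff : Poly n → Vec ℕ n → Vec ℕ n → Carrier
      prodCoeff p e d = ∑ p (λ t → at e (proj₁ t , V.zipWith ℕ._+_ d (proj₂ t)))

      coeff-* : ∀ (p p′ : Poly n) e → coeff (p *ₚ p′) e ≈ LK.lin (prodCoeff p′ e) p
      coeff-* p p′ e = trans (LK.∑-product p p′ (at e))
        (∑-cong p (λ s → trans (∑-cong p′ (λ t → at-*ˡ e _ _ _)) (sym (∑-distribˡ (proj₁ s) p′ _))))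

      term-≡ : ∀ e {a b} {d d′ : Vec ℕ n} → a ≈ b → d ≡ d′ → at e (a , d) ≈ at e (b , d′)
      term-≡ e a≈b ≡.refl = at-cong e a≈b

      *ₚ-comm : ∀ (p p′ : Poly n) → p *ₚ p′ ≋ p′ *ₚ p
      *ₚ-comm p p′ = mk λ e → trans (LK.∑-product p p′ (at e)) (trans (∑-swap p p′ _)
        (trans (∑-cong p′ (λ t → ∑-cong p (λ s → term-≡ e (*-comm _ _) (Vₚ.zipWith-comm ℕₚ.+-comm _ _))))
          (sym (LK.∑-product p′ p (at e)))))

      *ₚ-congʳ : ∀ {p p′} (r : Poly n) → p ≋ p′ → p *ₚ r ≋ p′ *ₚ r
      *ₚ-congʳ {p} {p′} r eq = mk λ e →
        trans (coeff-* p r e) (trans (LK.lin-cong (prodCoeff r e) eq) (sym (coeff-* p′ r e)))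

      ≋-refl : ∀ {p : Poly n} → p ≋ p
      ≋-refl = mk λ _ → refl

      ≋-sym : ∀ {p p′ : Poly n} → p ≋ p′ → p′ ≋ p
      ≋-sym (mk e) = mk λ d → sym (e d)

      ≋-trans : ∀ {p p′ p″ : Poly n} → p ≋ p′ → p′ ≋ p″ → p ≋ p″
      ≋-trans (mk e) (mk e′) = mk λ d → trans (e d) (e′ d)

      *ₚ-cong : ∀ {p p′ r r′ : Poly n} → p ≋ p′ → r ≋ r′ → p *ₚ r ≋ p′ *ₚ r′
      *ₚ-cong {p} {p′} {r} {r′} e e′ = ≋-trans (*ₚ-congʳ r e)
        (≋-trans (*ₚ-comm p′ r) (≋-trans (*ₚ-congʳ p′ e′) (*ₚ-comm r′ p′)))

      *ₚ-assoc : ∀ (p p′ p″ : Poly n) → (p *ₚ p′) *ₚ p″ ≋ p *ₚ (p′ *ₚ p″)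
      *ₚ-assoc p p′ p″ = mk λ e → trans (LK.∑-product (p *ₚ p′) p″ (at e))
        (trans (LK.∑-product p p′ _) (sym (trans (LK.∑-product p (p′ *ₚ p″) (at e))
          (∑-cong p (λ s → trans (LK.∑-product p′ p″ _) (∑-cong p′ (λ t → ∑-cong p″ (λ u →
            term-≡ e (sym (*-assoc _ _ _)) (≡.sym (Vₚ.zipWith-assoc ℕₚ.+-assoc (proj₂ s) (proj₂ t) (proj₂ u)))))))))))

      *ₚ-identityˡ : ∀ (p : Poly n) → 1ₚ *ₚ p ≋ p
      *ₚ-identityˡ p = mk λ e → trans (LK.∑-product 1ₚ p (at e)) (trans (+-identityʳ _)
        (∑-cong p (λ t → term-≡ e (*-identityˡ _) (Vₚ.zipWith-identityˡ ℕₚ.+-identityˡ (proj₂ t)))))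

      *ₚ-distribʳ : ∀ (r p p′ : Poly n) → (p +ₚ p′) *ₚ r ≋ p *ₚ r +ₚ p′ *ₚ r
      *ₚ-distribʳ r p p′ = mk λ e → trans (LK.∑-product (p +ₚ p′) r (at e)) (trans (∑-++ p p′ _)
        (sym (trans (coeff-+ (p *ₚ r) (p′ *ₚ r) e) (+-cong (LK.∑-product p r (at e)) (LK.∑-product p′ r (at e))))))

      +ₚ-cong : ∀ {p p′ r r′ : Poly n} → p ≋ p′ → r ≋ r′ → p +ₚ r ≋ p′ +ₚ r′
      +ₚ-cong {p} {p′} {r} {r′} (mk e) (mk e′) = mk λ d →
        trans (coeff-+ p r d) (trans (+-cong (e d) (e′ d)) (sym (coeff-+ p′ r′ d)))

      +ₚ-comm : ∀ (p p′ : Poly n) → p +ₚ p′ ≋ p′ +ₚ p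
      +ₚ-comm p p′ = mk λ d → trans (coeff-+ p p′ d) (trans (+-comm _ _) (sym (coeff-+ p′ p d)))

      +ₚ-inverseʳ : ∀ (p : Poly n) → p -ₚ p ≋ 0ₚ
      +ₚ-inverseʳ p = mk λ d → trans (coeff-+ p (-ₚ p) d) (trans (+-congˡ (coeff-neg p d)) (-‿inverseʳ _))

      -ₚ-cong : ∀ {p p′ : Poly n} → p ≋ p′ → (-ₚ p) ≋ (-ₚ p′)
      -ₚ-cong {p} {p′} (mk e) = mk λ d → trans (coeff-neg p d) (trans (-‿cong (e d)) (sym (coeff-neg p′ d)))

    polyRing : CommutativeRing c ℓ
    polyRing = record
      { Carrier = Poly n ; _≈_ = _≋_ ; _+_ = _+ₚ_ ; _*_ = _*ₚ_ ; -_ = -ₚ_ ; 0# = 0ₚ ; 1# = 1ₚ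
      ; isCommutativeRing = record
        { isRing = record
          { +-isAbelianGroup = record
            { isGroup = record
              { isMonoid = record
                { isSemigroup = record
                  { isMagma = record
                    { isEquivalence = record { refl = ≋-refl ; sym = ≋-sym ; trans = ≋-trans }
                    ; ∙-cong = +ₚ-cong }
                  ; assoc = λ p p′ p″ → ≋-reflexive (Lₚ.++-assoc p p′ p″) }
                ; identity = (λ _ → ≋-refl) , λ p → ≋-reflexive (Lₚ.++-identityʳ p) }
              ; inverse = (λ p → ≋-trans (+ₚ-comm (-ₚ p) p) (+ₚ-inverseʳ p)) , +ₚ-inverseʳ
              ; ⁻¹-cong = -ₚ-cong }
            ; comm = +ₚ-comm }
          ; *-cong = *ₚ-cong
          ; *-assoc = *ₚ-assoc
          ; *-identity = *ₚ-identityˡ , λ p → ≋-trans (*ₚ-comm p 1ₚ) (*ₚ-identityˡ p)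
          ; distrib = (λ r p p′ → ≋-trans (*ₚ-comm r (p +ₚ p′)) (≋-trans (*ₚ-distribʳ r p p′)
                        (+ₚ-cong (*ₚ-comm p r) (*ₚ-comm p′ r)))) , *ₚ-distribʳ
          }
        ; *-comm = *ₚ-comm } }
      where
      ≋-reflexive : ∀ {p p′ : Poly n} → p ≡ p′ → p ≋ p′
      ≋-reflexive ≡.refl = ≋-refl

    const-hom : Hom.IsHom cring polyRing constₚ
    const-hom = Hom.mkHom cring polyRing constₚ
      (λ a≈b → mk λ e → +-congʳ (at-cong e a≈b))
      (λ a b → mk λ e → trans (+-identityʳ _) (trans (at-+ e a b zeros) (+-congˡ (sym (+-identityʳ _)))))
      (λ a b → mk λ e → +-congʳ (term-≡ e refl (≡.sym (Vₚ.zipWith-identityˡ ℕₚ.+-identityˡ zeros))))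
      ≋-refl
      where zeros = V.replicate n 0

  ^ₚ≡pow : ∀ {n} (p : Poly n) k → p ^ₚ k ≡ RingLemmas.pow polyRing p k
  ^ₚ≡pow p zero    = ≡.refl
  ^ₚ≡pow p (suc k) = cong (p *ₚ_) (^ₚ≡pow p k)

  powK≡pow : ∀ x k → powK x k ≡ pow x k
  powK≡pow x zero    = ≡.refl
  powK≡pow x (suc k) = cong (x *_) (powK≡pow x k)

  module LP {n : ℕ} = Linear (polyRing {n}) constₚ const-hom

  substₚ≋ev : ∀ {n m} (σ : Fin n → Poly m) p → substₚ σ p ≋ LP.ev (V.tabulate σ) p
  substₚ≋ev {n} σ p = PL.∑-cong p λ t → P.*-congˡ {x = constₚ (proj₁ t)} (P.sym (P.trans (PL.mono-tabulate σ (proj₂ t))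
      (PL.∏-cong (allFin n) (λ i → P.reflexive (≡.sym (^ₚ≡pow (σ i) (V.lookup (proj₂ t) i)))))))
    where
    module P = CommutativeRing polyRing
    module PL = RingLemmas polyRing

  evalₚ≈ev : ∀ {n} (v : Fin n → Carrier) p → evalₚ v p ≈ LK.ev (V.tabulate v) p
  evalₚ≈ev {n} v p = ∑-cong p λ t → *-congˡ (sym (trans (mono-tabulate v (proj₂ t))
      (∏-cong (allFin n) (λ i → reflexive (≡.sym (powK≡pow (v i) (V.lookup (proj₂ t) i)))))))

-- Triangular sums and coefficient sequences

module Triangle {c ℓ : Level} (R : CommutativeRing c ℓ) where
  open CommutativeRing R
  open RingLemmas R

  ∑< : ℕ → (ℕ → Carrier) → Carrier
  ∑< n = ∑ (upTo n)

  ∑<-suc : ∀ n f → ∑< (suc n) f ≈ f 0 + ∑< n (f ∘ suc)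
  ∑<-suc n f = reflexive (∑-upTo n f)

  ∑<-cong : ∀ n {f g} → (∀ a → a < n → f a ≈ g a) → ∑< n f ≈ ∑< n g
  ∑<-cong zero    e = refl
  ∑<-cong (suc n) {f} {g} e = trans (∑<-suc n f) (trans
    (+-cong (e 0 (s≤s z≤n)) (∑<-cong n (λ a a<n → e (suc a) (s≤s a<n)))) (sym (∑<-suc n g)))

  ∑<-0 : ∀ n {f} → (∀ a → a < n → f a ≈ 0#) → ∑< n f ≈ 0#
  ∑<-0 n e = trans (∑<-cong n e) (∑-0 (upTo n) (λ _ → refl))

  triangle : ℕ → (ℕ → ℕ → Carrier) → Carrier
  triangle d f = ∑< (suc d) (λ a → ∑< (suc (d ∸ a)) (f a))

  private
    -- Once the column b = 0 is gone every row is one shorter and the last one is empty.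
    drop-diagonal : ∀ d g → ∑< (suc (suc d)) (λ b → ∑< (suc d ∸ b) (g b)) ≈ triangle d g
    drop-diagonal zero    g = trans (∑<-suc 1 (λ b → ∑< (1 ∸ b) (g b))) (+-congˡ (+-identityˡ 0#))
    drop-diagonal (suc d) g = trans (∑<-suc (suc (suc d)) (λ b → ∑< (suc (suc d) ∸ b) (g b)))
      (trans (+-congˡ (drop-diagonal d (g ∘ suc)))
        (sym (∑<-suc (suc d) (λ a → ∑< (suc (suc d ∸ a)) (g a)))))

    triangle-sucˡ : ∀ d f → triangle (suc d) f ≈ ∑< (suc (suc d)) (f 0) + triangle d (f ∘ suc)
    triangle-sucˡ d f = ∑<-suc (suc d) (λ a → ∑< (suc (suc d ∸ a)) (f a))

    triangle-sucʳ : ∀ d f → triangle (suc d) f ≈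
      ∑< (suc (suc d)) (λ a → f a 0) + triangle d (λ a b → f a (suc b))
    triangle-sucʳ d f = trans
      (∑-cong (upTo (suc (suc d))) (λ a → ∑<-suc (suc d ∸ a) (f a)))
      (trans (∑-+ (upTo (suc (suc d))) _ _) (+-congˡ (drop-diagonal d (λ a b → f a (suc b)))))

  -- Removing the row a = 0 on one side and the column b = 0 on the other leaves triangles of the
  -- next smaller size.
  triangle-swap : ∀ d f → triangle d f ≈ triangle d (λ a b → f b a)
  triangle-swap zero    f = refl
  triangle-swap (suc d) f = trans (triangle-sucˡ d f)
    (trans (+-congˡ (triangle-swap d (f ∘ suc))) (sym (triangle-sucʳ d (λ a b → f b a))))

module Sequences {c ℓ : Level} (R : CommutativeRing c ℓ) where
  open CommutativeRing R

  sh : (ℕ → Carrier) → ℕ → Carrier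
  sh s zero    = 0#
  sh s (suc i) = s i

  -- Multiplication by 1 − θt, a power series being given by its coefficients.
  1-_t : Carrier → (ℕ → Carrier) → ℕ → Carrier
  (1- θ t) s i = s i - θ * sh s i

-- Quasisymmetric functions evaluated at finitely many ring elements

compress-∷ʳ-suc : ∀ e a → compress (e L.∷ʳ suc a) ≡ compress e L.∷ʳ suc a
compress-∷ʳ-suc []          a = ≡.refl
compress-∷ʳ-suc (zero  ∷ e) a = compress-∷ʳ-suc e a
compress-∷ʳ-suc (suc k ∷ e) a = cong (suc k ∷_) (compress-∷ʳ-suc e a)

compress-∷ʳ-0 : ∀ e → compress (e L.∷ʳ 0) ≡ compress e
compress-∷ʳ-0 []          = ≡.refl
compress-∷ʳ-0 (zero  ∷ e) = compress-∷ʳ-0 e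
compress-∷ʳ-0 (suc k ∷ e) = cong (suc k ∷_) (compress-∷ʳ-0 e)

tabulate-∷ʳ : ∀ {a} {A : Set a} m (g : ℕ → A) →
  V.tabulate {n = suc m} (g ∘ F.toℕ) ≡ V.tabulate {n = m} (g ∘ F.toℕ) V.∷ʳ g m
tabulate-∷ʳ zero    g = ≡.refl
tabulate-∷ʳ (suc m) g = cong (g 0 ∷_) (tabulate-∷ʳ m (g ∘ suc))

module QuasiSym {c ℓ : Level} (K : Field c ℓ) where
  open Field K
  open Polynomials K
  open RingLemmas cring

  Quasi : (List ℕ → Carrier) → Set ℓ
  Quasi F = ∀ e → F e ≈ F (compress e)

  -- If `F` gives the coefficients of f, this gives f_a in f(x_1,...,x_m) = ∑_a x_m^a
  -- f_a(x_1,...,x_{m-1}). It is again quasisymmetric for a > 0, and it is f itself for a = 0.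
  snoc : ℕ → (List ℕ → Carrier) → List ℕ → Carrier
  snoc a F e = F (e L.∷ʳ a)

  snoc-quasi : ∀ a {F} → Quasi F → Quasi (snoc (suc a) F)
  snoc-quasi a {F} F-quasi e =
    trans (F-quasi _) (reflexive (cong F (compress-∷ʳ-suc e a)))

  snoc-0 : ∀ {F} → Quasi F → ∀ e → snoc 0 F e ≈ F e
  snoc-0 {F} F-quasi e =
    trans (F-quasi _) (trans (reflexive (cong F (compress-∷ʳ-0 e))) (sym (F-quasi e)))

  polyOf′ : (r : ℕ) → (List ℕ → Carrier) → (N : ℕ) → Poly N
  polyOf′ r F N = map (λ e → F (V.toList e) , e) (vecsOfSum N r)

  module Values {c′ ℓ′ : Level} (R : CommutativeRing c′ ℓ′) (ι : Carrier → CommutativeRing.Carrier R)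
                (ι-hom : Hom.IsHom cring R ι) where
    private
      module R = CommutativeRing R
      module RL = RingLemmas R
      module T = Triangle R
    open Linear R ι ι-hom
    open SetoidReasoning R.setoid
    open import Algebra.Properties.CommutativeSemigroup R.*-commutativeSemigroup using (x∙yz≈y∙xz)

    value : ∀ {m} → (List ℕ → Carrier) → ℕ → Vec R.Carrier m → R.Carrier
    value {m} F d z = RL.∑ (vecsOfSum m d) (λ e → ι (F (V.toList e)) R.* RL.mono z e)

    ev-polyOf′ : ∀ {m} F d (z : Vec R.Carrier m) → ev z (polyOf′ d F m) R.≈ value F d z
    ev-polyOf′ {m} F d z = R.reflexive (RL.∑-map _ (vecsOfSum m d) _)

    value-cong : ∀ {m} {F G} d (z : Vec R.Carrier m) → (∀ e → F e ≈ G e) → value F d z R.≈ value G d z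
    value-cong {m} d z e = RL.∑-cong (vecsOfSum m d) (λ v → R.*-congʳ (ι-cong (e (V.toList v))))

    value-∷ : ∀ {m} F d z (zs : Vec R.Carrier m) →
      value F d (z ∷ zs) R.≈ T.∑< (suc d) (λ a → RL.pow z a R.* value (F ∘ (a ∷_)) (d ∸ a) zs)
    value-∷ {m} F d z zs = R.trans
      (RL.∑-concatMap (λ a → map (a ∷_) (vecsOfSum m (d ∸ a))) (upTo (suc d)) term)
      (RL.∑-cong (upTo (suc d)) λ a → R.trans (R.reflexive (RL.∑-map (a ∷_) (vecsOfSum m (d ∸ a)) term))
        (R.trans (RL.∑-cong (vecsOfSum m (d ∸ a)) (λ e → x∙yz≈y∙xz _ _ _))
          (R.sym (RL.∑-distribˡ (RL.pow z a) (vecsOfSum m (d ∸ a)) _))))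
      where
      term : Vec ℕ (suc m) → R.Carrier
      term e = ι (F (V.toList e)) R.* RL.mono (z ∷ zs) e

    -- Exponent vectors are enumerated from the first entry. To split off the last variable, both
    -- ends are peeled off and the two sums exchanged over the triangle a + b ≤ d.
    value-∷ʳ : ∀ {m} F d (zs : Vec R.Carrier m) z →
      value F d (zs V.∷ʳ z) R.≈ T.∑< (suc d) (λ a → RL.pow z a R.* value (snoc a F) (d ∸ a) zs)
    value-∷ʳ F d [] z = R.trans (value-∷ F d z [])
      (RL.∑-cong (upTo (suc d)) λ a → R.*-congˡ (same a (d ∸ a)))
      where
      same : ∀ a k → value (F ∘ (a ∷_)) k [] R.≈ value (snoc a F) k []
      same a zero    = R.refl
      same a (suc k) = R.refl
    value-∷ʳ F d (y ∷ zs) z = begin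
      value F d (y ∷ (zs V.∷ʳ z))
        ≈⟨ value-∷ F d y (zs V.∷ʳ z) ⟩
      T.∑< (suc d) (λ a → RL.pow y a R.* value (F ∘ (a ∷_)) (d ∸ a) (zs V.∷ʳ z))
        ≈⟨ RL.∑-cong (upTo (suc d)) (λ a → R.trans (R.*-congˡ (value-∷ʳ (F ∘ (a ∷_)) (d ∸ a) zs z))
                (RL.∑-distribˡ (RL.pow y a) (upTo (suc (d ∸ a))) _)) ⟩
      T.triangle d (λ a b → RL.pow y a R.* (RL.pow z b R.* value (snoc b (F ∘ (a ∷_))) (d ∸ a ∸ b) zs))
        ≈⟨ T.triangle-swap d _ ⟩
      T.triangle d (λ b a → RL.pow y a R.* (RL.pow z b R.* value (snoc b (F ∘ (a ∷_))) (d ∸ a ∸ b) zs))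
        ≈⟨ RL.∑-cong (upTo (suc d)) (λ b → RL.∑-cong (upTo (suc (d ∸ b))) (λ a →
                R.trans (x∙yz≈y∙xz _ _ _) (R.reflexive (cong (λ k → RL.pow z b R.* (RL.pow y a R.* value (snoc b (F ∘ (a ∷_))) k zs)) (∸-swap a b))))) ⟩
      T.triangle d (λ b a → RL.pow z b R.* (RL.pow y a R.* value (snoc b F ∘ (a ∷_)) (d ∸ b ∸ a) zs))
        ≈⟨ RL.∑-cong (upTo (suc d)) (λ b → R.trans (R.*-congˡ (value-∷ (snoc b F) (d ∸ b) y zs))
                (RL.∑-distribˡ (RL.pow z b) (upTo (suc (d ∸ b))) _)) ⟨
      T.∑< (suc d) (λ b → RL.pow z b R.* value (snoc b F) (d ∸ b) (y ∷ zs)) ∎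
      where
      ∸-swap : ∀ a b → d ∸ a ∸ b ≡ d ∸ b ∸ a
      ∸-swap a b = ≡.trans (ℕₚ.∸-+-assoc d a b)
        (≡.trans (cong (d ℕ.∸_) (ℕₚ.+-comm a b)) (≡.sym (ℕₚ.∸-+-assoc d b a)))

    value-degree-0 : ∀ {m} {F} → Quasi F → (z : Vec R.Carrier m) → value F 0 z R.≈ ι (F [])
    value-degree-0 F-quasi [] = R.trans (R.+-identityʳ _) (R.*-identityʳ _)
    value-degree-0 {F = F} F-quasi (z ∷ zs) = R.trans (value-∷ F 0 z zs) (R.trans (R.+-identityʳ _)
      (R.trans (R.*-identityˡ _) (R.trans (value-cong 0 zs same) (value-degree-0 F-quasi zs))))
      where
      same : ∀ e → F (0 ∷ e) ≈ F e
      same e = trans (F-quasi (0 ∷ e)) (sym (F-quasi e))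

    initial : (x : ℕ → R.Carrier) (m : ℕ) → Vec R.Carrier m
    initial x m = V.tabulate (λ i → x (suc (F.toℕ i)))

    -- The part with exponent 0 in the new variable is f in the old ones by quasisymmetry; the rest
    -- is the increment behind `values-numerator`.
    value-initial-suc : ∀ x {F} → Quasi F → ∀ d m →
      value F (suc d) (initial x (suc m)) R.≈ value F (suc d) (initial x m) R.+
        T.∑< (suc d) (λ a → RL.pow (x (suc m)) (suc a) R.* value (snoc (suc a) F) (d ∸ a) (initial x m))
    value-initial-suc x {F} F-quasi d m = begin
      value F (suc d) (initial x (suc m))
        ≡⟨ cong (value F (suc d)) (tabulate-∷ʳ m (x ∘ suc)) ⟩
      value F (suc d) (initial x m V.∷ʳ x (suc m))
        ≈⟨ value-∷ʳ F (suc d) (initial x m) (x (suc m)) ⟩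
      _ ≈⟨ T.∑<-suc (suc d) _ ⟩
      _ ≈⟨ R.+-congʳ (R.trans (R.*-identityˡ _) (value-cong (suc d) (initial x m) (snoc-0 F-quasi))) ⟩
      _ ∎

    -- Each increment carries a positive power of a vanishing variable.
    value-truncate : ∀ x {F} → Quasi F → ∀ d m → (∀ j → m < j → x j R.≈ R.0#) → ∀ k →
      value F (suc d) (initial x (k ℕ.+ m)) R.≈ value F (suc d) (initial x m)
    value-truncate x F-quasi d m x0 zero    = R.refl
    value-truncate x F-quasi d m x0 (suc k) = R.trans (value-initial-suc x F-quasi d (k ℕ.+ m))
      (R.trans (R.+-cong (value-truncate x F-quasi d m x0 k) (T.∑<-0 (suc d) (λ a _ →
        R.trans (R.*-congʳ (R.trans (R.*-congʳ (x0 _ (s≤s (ℕₚ.m≤n+m m k)))) (R.zeroˡ _))) (R.zeroˡ _))))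
        (R.+-identityʳ _))

-- The numerator and the consequences of the relations u_i x_{i+1} = q u_i x_i

module Klyachko {c ℓ : Level} (K : Field c ℓ) (q : Field.Carrier K) where
  open Field K hiding (zero)
  open Polynomials K
  open RingLemmas cring hiding (solve; _:=_; _:+_; _:*_; _:-_; con)
  private module KL = RingLemmas cring
  open QuasiSym K
  open Triangle cring using (∑<; ∑<-0; ∑<-cong)
  open Sequences cring

  bracket : ℕ → Carrier
  bracket zero    = 0#
  bracket (suc n) = bracket n + pow q n

  BracketInverse : (ℕ → Carrier) → Set ℓ
  BracketInverse inv = ∀ b → inv b * bracket (suc b) ≈ 1#

  -- Substitution of θt for t in a power series.
  scale : Carrier → (ℕ → Carrier) → ℕ → Carrier
  scale θ c j = pow θ j * c j

  -- Multiplication by (1-qt)⋯(1-q^a t). Besides 1 - t, these are the factors of (t;q)_{d+2} not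
  -- cancelled by the denominator (q^{a+1}t;q)_{d-a+1} of the rescaled series of `snoc (suc a) F`.
  poch : ℕ → (ℕ → Carrier) → ℕ → Carrier
  poch zero    c = c
  poch (suc a) c = (1- pow q (suc a) t) (poch a c)

  -- The numerator (t;q)_{d+1} ∑_m F(1,q,…,q^{m-1}) t^m; the first argument is recursion fuel.
  numerator : ℕ → ℕ → (List ℕ → Carrier) → ℕ → Carrier
  numerator k       zero    F zero    = F []
  numerator k       zero    F (suc _) = 0#
  numerator zero    (suc d) F = λ _ → 0#
  numerator (suc k) (suc d) F = sh λ j → ∑< (suc d) λ a →
    poch a (scale (pow q (suc a)) (numerator k (d ∸ a) (snoc (suc a) F))) j

  poch-degree : ∀ a {b c} → (∀ j → b < j → c j ≈ 0#) → ∀ j → a ℕ.+ b < j → poch a c j ≈ 0#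
  poch-degree zero    c0 j       b<j = c0 j b<j
  poch-degree (suc a) {b} c0 (suc j) (s≤s b<j) = trans
    (+-cong (poch-degree a c0 (suc j) (ℕₚ.m<n⇒m<1+n b<j)) (-‿cong (*-congˡ (poch-degree a c0 j b<j))))
    (KL.solve 1 (λ θ → KL.con (+ 0) KL.:- θ KL.:* KL.con (+ 0) KL.:= KL.con (+ 0)) refl _)

  -- The shift contributes 1, the Pochhammer factors contribute a, and the recursive numerator at
  -- most d - a.
  numerator-degree : ∀ k d F → d ≤ k → ∀ j → d < j → numerator k d F j ≈ 0#
  numerator-degree k       zero    F d≤k (suc j) d<j = refl
  numerator-degree (suc k) (suc d) F (s≤s d≤k) (suc j) (s≤s d<j) = ∑<-0 (suc d) λ a a<1+d →
    poch-degree a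
      (λ i b<i → trans (*-congˡ (numerator-degree k (d ∸ a) _ (ℕₚ.≤-trans (ℕₚ.m∸n≤m d a) d≤k) i b<i)) (zeroʳ _))
      j (subst (_< j) (≡.sym (ℕₚ.m+[n∸m]≡n (s≤s⁻¹ a<1+d))) d<j)

  -- Consequences of the relations u_i x_{i+1} = q u_i x_i, where u_i = x_1 + ⋯ + x_i.
  module Relations {c′ ℓ′ : Level} (R : CommutativeRing c′ ℓ′) (ι : Carrier → CommutativeRing.Carrier R)
    (ι-hom : Hom.IsHom cring R ι)
    (inv : ℕ → Carrier) (inv-bracket : BracketInverse inv)
    (u x : ℕ → CommutativeRing.Carrier R)
    (u-zero : CommutativeRing._≈_ R (u 0) (CommutativeRing.0# R))
    (x-zero : CommutativeRing._≈_ R (x 0) (CommutativeRing.0# R))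
    (u-suc : ∀ i → CommutativeRing._≈_ R (u (suc i)) (CommutativeRing._+_ R (u i) (x (suc i))))
    (relation : ∀ i → CommutativeRing._≈_ R (CommutativeRing._*_ R (u i) (x (suc i)))
                        (CommutativeRing._*_ R (ι q) (CommutativeRing._*_ R (u i) (x i)))) where
    private
      module R = CommutativeRing R
      module RL = RingLemmas R
      module T = Triangle R
      module Q = Sequences R
    open Linear R ι ι-hom
    open Values R ι ι-hom
    open RL using (_:=_; _:+_; _:*_; _:-_; con)
    open SetoidReasoning R.setoid

    ι-pow : ∀ y k → ι (pow y k) R.≈ RL.pow (ι y) k
    ι-pow y zero    = ι-1
    ι-pow y (suc k) = R.trans (ι-* _ _) (R.*-congˡ (ι-pow y k))

    -- H b i is u_i u_{i+1} ⋯ u_{i+b-1} / [b]_q!, set to 0 for i = 0; it equals the complete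
    -- homogeneous polynomial h_b(x_1,…,x_i).
    H : ℕ → ℕ → R.Carrier
    H zero    zero    = R.0#
    H zero    (suc i) = R.1#
    H (suc b) i       = ι (inv b) R.* (H b i R.* u (b ℕ.+ i))

    H-zero : ∀ b → H b 0 R.≈ R.0#
    H-zero zero    = R.refl
    H-zero (suc b) = R.trans (R.*-congˡ (R.trans (R.*-congʳ (H-zero b)) (R.zeroˡ _))) (R.zeroʳ _)

    -- Induction on b. For an index below the top one the last factor u_{b+i} is carried along; for
    -- the top index it turns x_{b+1+i} into q x_{b+i}, and the remaining factors do the rest.
    H-x : ∀ b i j → j ≤ b → H b i R.* x (j ℕ.+ i) R.≈ ι (pow q j) R.* (H b i R.* x i)
    H-x b i zero j≤b = R.sym (R.trans (R.*-congʳ ι-1) (R.*-identityˡ _))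
    H-x (suc b) i (suc j) j≤b with ℕₚ.m≤n⇒m<n∨m≡n j≤b
    ... | inj₁ (s≤s j<b) = begin
      ι (inv b) R.* (H b i R.* u (b ℕ.+ i)) R.* x (suc j ℕ.+ i)
        ≈⟨ RL.solve 4 (λ v h w y → v :* (h :* w) :* y := v :* w :* (h :* y)) R.refl _ _ _ _ ⟩
      ι (inv b) R.* u (b ℕ.+ i) R.* (H b i R.* x (suc j ℕ.+ i))
        ≈⟨ R.*-congˡ (H-x b i (suc j) j<b) ⟩
      ι (inv b) R.* u (b ℕ.+ i) R.* (ι (pow q (suc j)) R.* (H b i R.* x i))
        ≈⟨ RL.solve 5 (λ v h w y r → v :* w :* (r :* (h :* y)) := r :* (v :* (h :* w) :* y)) R.refl _ _ _ _ _ ⟩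
      _ ∎
    ... | inj₂ ≡.refl = begin
      ι (inv b) R.* (H b i R.* u (b ℕ.+ i)) R.* x (suc b ℕ.+ i)
        ≈⟨ RL.solve 4 (λ v h w y → v :* (h :* w) :* y := v :* h :* (w :* y)) R.refl _ _ _ _ ⟩
      ι (inv b) R.* H b i R.* (u (b ℕ.+ i) R.* x (suc b ℕ.+ i))
        ≈⟨ R.*-congˡ (relation (b ℕ.+ i)) ⟩
      ι (inv b) R.* H b i R.* (ι q R.* (u (b ℕ.+ i) R.* x (b ℕ.+ i)))
        ≈⟨ RL.solve 5 (λ v h r w y → v :* h :* (r :* (w :* y)) := v :* r :* w :* (h :* y)) R.refl _ _ _ _ _ ⟩
      ι (inv b) R.* ι q R.* u (b ℕ.+ i) R.* (H b i R.* x (b ℕ.+ i))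
        ≈⟨ R.*-congˡ (H-x b i b ℕₚ.≤-refl) ⟩
      ι (inv b) R.* ι q R.* u (b ℕ.+ i) R.* (ι (pow q b) R.* (H b i R.* x i))
        ≈⟨ RL.solve 6 (λ v r w p h y → v :* r :* w :* (p :* (h :* y)) := (r :* p) :* (v :* (h :* w) :* y)) R.refl _ _ _ _ _ _ ⟩
      (ι q R.* ι (pow q b)) R.* (H (suc b) i R.* x i)
        ≈⟨ R.*-congʳ (ι-* _ _) ⟨
      _ ∎

    H-x-pow : ∀ k b i j → j ≤ b →
      H b i R.* RL.pow (x (j ℕ.+ i)) k R.≈ ι (pow (pow q k) j) R.* (H b i R.* RL.pow (x i) k)
    H-x-pow k b i j j≤b = R.trans (go k) (R.*-congʳ (R.trans (R.sym (ι-pow (pow q j) k)) (ι-cong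
      (trans (pow-pow q j k) (trans (reflexive (cong (pow q) (ℕₚ.*-comm j k))) (sym (pow-pow q k j)))))))
      where
      θ = ι (pow q j)
      go : ∀ k → H b i R.* RL.pow (x (j ℕ.+ i)) k R.≈ RL.pow θ k R.* (H b i R.* RL.pow (x i) k)
      go zero    = R.sym (R.*-identityˡ _)
      go (suc k) = begin
        H b i R.* (x (j ℕ.+ i) R.* RL.pow (x (j ℕ.+ i)) k)
          ≈⟨ R.*-assoc _ _ _ ⟨
        H b i R.* x (j ℕ.+ i) R.* RL.pow (x (j ℕ.+ i)) k
          ≈⟨ R.*-congʳ (H-x b i j j≤b) ⟩
        θ R.* (H b i R.* x i) R.* RL.pow (x (j ℕ.+ i)) k
          ≈⟨ RL.solve 4 (λ r h y p → r :* (h :* y) :* p := r :* y :* (h :* p)) R.refl _ _ _ _ ⟩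
        θ R.* x i R.* (H b i R.* RL.pow (x (j ℕ.+ i)) k)
          ≈⟨ R.*-congˡ (go k) ⟩
        θ R.* x i R.* (RL.pow θ k R.* (H b i R.* RL.pow (x i) k))
          ≈⟨ RL.solve 5 (λ r y p h z → r :* y :* (p :* (h :* z)) := r :* p :* (h :* (y :* z))) R.refl _ _ _ _ _ ⟩
        _ ∎

    -- Both sides are u_i u_{i+1} ⋯ u_{i+b} / [b]_q!; for i = 0 they vanish with u_0.
    H-shift : ∀ b i → H b i R.* u (b ℕ.+ i) R.≈ u i R.* H b (suc i)
    H-shift zero    zero    = R.trans (R.zeroˡ _) (R.sym (R.trans (R.*-identityʳ _) u-zero))
    H-shift zero    (suc i) = R.*-comm _ _
    H-shift (suc b) i = begin
      ι (inv b) R.* (H b i R.* u (b ℕ.+ i)) R.* u (suc b ℕ.+ i)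
        ≈⟨ R.*-cong (R.*-congˡ (H-shift b i)) (R.reflexive (cong u (≡.sym (ℕₚ.+-suc b i)))) ⟩
      ι (inv b) R.* (u i R.* H b (suc i)) R.* u (b ℕ.+ suc i)
        ≈⟨ RL.solve 4 (λ v w h y → v :* (w :* h) :* y := w :* (v :* (h :* y))) R.refl _ _ _ _ ⟩
      _ ∎

    private
      -- The difference is x_{i+1} + ⋯ + x_{i+1+j}, and next to H_b(i+1) its terms become q^0
      -- x_{i+1}, ..., q^j x_{i+1}.
      telescope : ∀ b i j → j ≤ b →
        H b (suc i) R.* (u (j ℕ.+ suc i) R.- u i) R.≈ ι (bracket (suc j)) R.* (H b (suc i) R.* x (suc i))
      telescope b i zero j≤b = R.trans
        (R.*-congˡ (R.trans (R.+-congʳ (u-suc i)) (RL.solve 2 (λ v w → v :+ w :- v := w) R.refl _ _)))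
        (R.sym (R.trans (R.*-congʳ (R.trans (ι-cong (+-identityˡ _)) ι-1)) (R.*-identityˡ _)))
      telescope b i (suc j) j<b = begin
        H b (suc i) R.* (u (suc j ℕ.+ suc i) R.- u i)
          ≈⟨ R.*-congˡ (R.+-congʳ (u-suc (j ℕ.+ suc i))) ⟩
        H b (suc i) R.* (u (j ℕ.+ suc i) R.+ x (suc j ℕ.+ suc i) R.- u i)
          ≈⟨ RL.solve 4 (λ h v y w → h :* (v :+ y :- w) := h :* (v :- w) :+ h :* y) R.refl _ _ _ _ ⟩
        H b (suc i) R.* (u (j ℕ.+ suc i) R.- u i) R.+ H b (suc i) R.* x (suc j ℕ.+ suc i)
          ≈⟨ R.+-cong (telescope b i j (ℕₚ.<⇒≤ j<b)) (H-x b (suc i) (suc j) j<b) ⟩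
        _ ≈⟨ R.distribʳ _ _ _ ⟨
        _ ≈⟨ R.*-congʳ (ι-+ _ _) ⟨
        _ ∎

    -- By `H-shift` both terms contain H_b(i+1), with cofactors u_{b+i+1} and u_i. Their difference
    -- acts as [b+1]_q x_{i+1}, which cancels the denominator.
    H-difference : ∀ b i → H (suc b) i R.- Q.sh (H (suc b)) i R.≈ x i R.* H b i
    H-difference b zero = R.trans
      (R.+-congʳ (H-zero (suc b)))
      (R.trans (R.-‿inverseʳ R.0#) (R.sym (R.trans (R.*-congˡ (H-zero b)) (R.zeroʳ _))))
    H-difference b (suc i) = begin
      ι (inv b) R.* (H b (suc i) R.* u (b ℕ.+ suc i)) R.- ι (inv b) R.* (H b i R.* u (b ℕ.+ i))
        ≈⟨ R.+-congˡ (R.-‿cong (R.*-congˡ (H-shift b i))) ⟩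
      ι (inv b) R.* (H b (suc i) R.* u (b ℕ.+ suc i)) R.- ι (inv b) R.* (u i R.* H b (suc i))
        ≈⟨ RL.solve 4 (λ v h y w → v :* (h :* y) :- v :* (w :* h) := v :* (h :* (y :- w))) R.refl _ _ _ _ ⟩
      ι (inv b) R.* (H b (suc i) R.* (u (b ℕ.+ suc i) R.- u i))
        ≈⟨ R.*-congˡ (telescope b i b ℕₚ.≤-refl) ⟩
      ι (inv b) R.* (ι (bracket (suc b)) R.* (H b (suc i) R.* x (suc i)))
        ≈⟨ R.*-assoc _ _ _ ⟨
      ι (inv b) R.* ι (bracket (suc b)) R.* (H b (suc i) R.* x (suc i))
        ≈⟨ R.*-congʳ (R.trans (R.sym (ι-* _ _)) (R.trans (ι-cong (inv-bracket b)) ι-1)) ⟩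
      R.1# R.* (H b (suc i) R.* x (suc i))
        ≈⟨ R.trans (R.*-identityˡ _) (R.*-comm _ _) ⟩
      _ ∎

    -- The product of the power series with coefficients c and s.
    act : (ℕ → Carrier) → (ℕ → R.Carrier) → ℕ → R.Carrier
    act c s zero    = ι (c 0) R.* s 0
    act c s (suc i) = ι (c 0) R.* s (suc i) R.+ act (c ∘ suc) s i

    act-cong : ∀ {c c′ s s′} → (∀ j → c j ≈ c′ j) → (∀ i → s i R.≈ s′ i) → ∀ i → act c s i R.≈ act c′ s′ i
    act-cong ec es zero    = R.*-cong (ι-cong (ec 0)) (es 0)
    act-cong ec es (suc i) = R.+-cong (R.*-cong (ι-cong (ec 0)) (es (suc i))) (act-cong (ec ∘ suc) es i)

    act-zero : ∀ {c} s → (∀ j → c j ≈ 0#) → ∀ i → act c s i R.≈ R.0#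
    act-zero s c0 zero    = R.trans (R.*-congʳ (R.trans (ι-cong (c0 0)) ι-0)) (R.zeroˡ _)
    act-zero s c0 (suc i) = R.trans (R.+-cong (R.trans (R.*-congʳ (R.trans (ι-cong (c0 0)) ι-0)) (R.zeroˡ _)) (act-zero s (c0 ∘ suc) i)) (R.+-identityˡ _)

    act-linearˡ : ∀ c c′ θ s i →
      act (λ j → c j - θ * c′ j) s i R.≈ act c s i R.- ι θ R.* act c′ s i
    act-linearˡ c c′ θ s zero = R.trans (R.*-congʳ (ι-linear (c 0) θ (c′ 0)))
      (RL.solve 4 (λ a r b y → (a :- r :* b) :* y := a :* y :- r :* (b :* y)) R.refl _ _ _ _)
      where
      ι-linear : ∀ a θ b → ι (a - θ * b) R.≈ ι a R.- ι θ R.* ι b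
      ι-linear a θ b = R.trans (ι-+ _ _) (R.+-congˡ (R.trans (ι-neg _) (R.-‿cong (ι-* _ _))))
    act-linearˡ c c′ θ s (suc i) = R.trans
      (R.+-cong (R.*-congʳ (R.trans (ι-+ _ _) (R.+-congˡ (R.trans (ι-neg _) (R.-‿cong (ι-* _ _))))))
                (act-linearˡ (c ∘ suc) (c′ ∘ suc) θ s i))
      (RL.solve 6 (λ a r b y p p′ → (a :- r :* b) :* y :+ (p :- r :* p′) := (a :* y :+ p) :- r :* (b :* y :+ p′)) R.refl _ _ _ _ _ _)

    act-linearʳ : ∀ c θ s s′ i →
      act c (λ i → s i R.- θ R.* s′ i) i R.≈ act c s i R.- θ R.* act c s′ i
    act-linearʳ c θ s s′ zero =
      RL.solve 4 (λ a r b y → a :* (y :- r :* b) := a :* y :- r :* (a :* b)) R.refl _ _ _ _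
    act-linearʳ c θ s s′ (suc i) = R.trans (R.+-congˡ (act-linearʳ (c ∘ suc) θ s s′ i))
      (RL.solve 6 (λ a r b y p p′ → a :* (y :- r :* b) :+ (p :- r :* p′) := (a :* y :+ p) :- r :* (a :* b :+ p′)) R.refl _ _ _ _ _ _)

    act-+ˡ : ∀ c c′ s i → act (λ j → c j + c′ j) s i R.≈ act c s i R.+ act c′ s i
    act-+ˡ c c′ s zero    = R.trans (R.*-congʳ (ι-+ _ _)) (R.distribʳ _ _ _)
    act-+ˡ c c′ s (suc i) = R.trans
      (R.+-cong (R.trans (R.*-congʳ (ι-+ _ _)) (R.distribʳ _ _ _)) (act-+ˡ (c ∘ suc) (c′ ∘ suc) s i))
      (RL.+-interchange _ _ _ _)

    act-∑ : ∀ n (C : ℕ → ℕ → Carrier) s i →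
      act (λ j → ∑< n (λ a → C a j)) s i R.≈ T.∑< n (λ a → act (C a) s i)
    act-∑ zero    C s i = act-zero s (λ _ → refl) i
    act-∑ (suc n) C s i = R.trans
      (act-cong (λ j → reflexive (∑-upTo n (λ a → C a j))) (λ _ → R.refl) i)
      (R.trans (act-+ˡ (C 0) _ s i) (R.trans (R.+-congˡ (act-∑ n (C ∘ suc) s i)) (R.sym (T.∑<-suc n _))))

    sh-cong : ∀ {s s′} → (∀ i → s i R.≈ s′ i) → ∀ i → Q.sh s i R.≈ Q.sh s′ i
    sh-cong e zero    = R.refl
    sh-cong e (suc i) = e i

    act-shˡ : ∀ c s i → act (sh c) s i R.≈ Q.sh (act c s) i
    act-shˡ c s zero    = R.trans (R.*-congʳ ι-0) (R.zeroˡ _)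
    act-shˡ c s (suc i) = R.trans (R.+-congʳ (R.trans (R.*-congʳ ι-0) (R.zeroˡ _))) (R.+-identityˡ _)

    act-shʳ : ∀ c s i → act c (Q.sh s) i R.≈ Q.sh (act c s) i
    act-shʳ c s zero          = R.zeroʳ _
    act-shʳ c s (suc zero)    = R.trans (R.+-congˡ (R.zeroʳ _)) (R.+-identityʳ _)
    act-shʳ c s (suc (suc i)) = R.+-congˡ (act-shʳ (c ∘ suc) s (suc i))

    pochᴿ : ℕ → (ℕ → R.Carrier) → ℕ → R.Carrier
    pochᴿ zero    s = s
    pochᴿ (suc a) s = Q.1- ι (pow q (suc a)) t (pochᴿ a s)

    act-poch : ∀ a c s i → act (poch a c) s i R.≈ act c (pochᴿ a s) i
    act-poch zero    c s i = R.refl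
    act-poch (suc a) c s i = begin
      act (poch (suc a) c) s i
        ≈⟨ act-linearˡ (poch a c) (sh (poch a c)) _ s i ⟩
      act (poch a c) s i R.- ι θ R.* act (sh (poch a c)) s i
        ≈⟨ R.+-cong (act-poch a c s i) (R.-‿cong (R.*-congˡ (R.trans (act-shˡ (poch a c) s i)
                (R.trans (sh-cong (act-poch a c s) i) (R.sym (act-shʳ c (pochᴿ a s) i)))))) ⟩
      act c (pochᴿ a s) i R.- ι θ R.* act c (Q.sh (pochᴿ a s)) i
        ≈⟨ act-linearʳ c (ι θ) (pochᴿ a s) (Q.sh (pochᴿ a s)) i ⟨
      act c (pochᴿ (suc a) s) i ∎
      where θ = pow q (suc a)

    -- The factor `1#` gives the shape of `act-linearʳ` and of multiplication by 1 - t.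
    ∇H : ℕ → ℕ → R.Carrier
    ∇H b i = H b i R.- R.1# R.* Q.sh (H b) i

    -- One power of x_i turns H_b into a difference of H_{b+1}. In its second term x_i^{a+1}
    -- H_{b+1}(i-1) = q^{a+1} x_{i-1}^{a+1} H_{b+1}(i-1), so each further power contributes a factor
    -- 1 - q^{a+1}t.
    pow-x-H : ∀ a b i → RL.pow (x i) (suc a) R.* H b i R.≈ pochᴿ a (∇H (suc (a ℕ.+ b))) i
    pow-x-H zero b i = begin
      x i R.* R.1# R.* H b i                         ≈⟨ R.*-congʳ (R.*-identityʳ _) ⟩
      x i R.* H b i                                  ≈⟨ H-difference b i ⟨
      H (suc b) i R.- Q.sh (H (suc b)) i             ≈⟨ R.+-congˡ (R.-‿cong (R.*-identityˡ _)) ⟨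
      ∇H (suc b) i                                   ∎
    pow-x-H (suc a) b i = begin
      x i R.* RL.pow (x i) (suc a) R.* H b i
        ≈⟨ RL.solve 3 (λ y p h → y :* p :* h := p :* (y :* h)) R.refl _ _ _ ⟩
      RL.pow (x i) (suc a) R.* (x i R.* H b i)
        ≈⟨ R.*-congˡ (H-difference b i) ⟨
      RL.pow (x i) (suc a) R.* (H (suc b) i R.- Q.sh (H (suc b)) i)
        ≈⟨ shifted i ⟩
      (Q.1- ι θ t) G i
        ≈⟨ R.+-cong (G≈ i) (R.-‿cong (R.*-congˡ (sh-cong G≈ i))) ⟩
      pochᴿ (suc a) (∇H (suc (suc a ℕ.+ b))) i ∎
      where
      θ = pow q (suc a)
      G : ℕ → R.Carrier
      G i = RL.pow (x i) (suc a) R.* H (suc b) i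
      G≈ : ∀ i → G i R.≈ pochᴿ a (∇H (suc (suc a ℕ.+ b))) i
      G≈ i = R.trans (pow-x-H a (suc b) i) (R.reflexive (cong (λ n → pochᴿ a (∇H (suc n)) i) (ℕₚ.+-suc a b)))
      shifted : ∀ i → RL.pow (x i) (suc a) R.* (H (suc b) i R.- Q.sh (H (suc b)) i) R.≈ (Q.1- ι θ t) G i
      shifted zero    = RL.solve 3 (λ p h r → p :* (h :- con (+ 0)) := p :* h :- r :* con (+ 0)) R.refl _ _ _
      shifted (suc i) = begin
        RL.pow (x (suc i)) (suc a) R.* (H (suc b) (suc i) R.- H (suc b) i)
          ≈⟨ RL.solve 3 (λ p h k → p :* (h :- k) := p :* h :- k :* p) R.refl _ _ _ ⟩
        G (suc i) R.- H (suc b) i R.* RL.pow (x (suc i)) (suc a)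
          ≈⟨ R.+-congˡ (R.-‿cong (H-x-pow (suc a) (suc b) i 1 (s≤s z≤n))) ⟩
        G (suc i) R.- ι (pow θ 1) R.* (H (suc b) i R.* RL.pow (x i) (suc a))
          ≈⟨ R.+-congˡ (R.-‿cong (R.*-cong (ι-cong (*-identityʳ θ)) (R.*-comm _ _))) ⟩
        G (suc i) R.- ι θ R.* G i ∎

    -- Next to H_b(i-j) the power x_i^k becomes q^{jk} x_{i-j}^k, which rescales c_j. That exchange
    -- requires j ≤ b, whence the bound on the degree of `c`.
    pow-x-act : ∀ k b c → (∀ j → b < j → c j ≈ 0#) → ∀ i →
      RL.pow (x i) k R.* act c (H b) i R.≈ act (scale (pow q k) c) (λ i → RL.pow (x i) k R.* H b i) i
    pow-x-act k b c c-deg i = R.trans (go 0 c (λ j b<j → c-deg j (subst (b ℕ.<_) (ℕₚ.+-identityʳ j) b<j)) i)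
      (R.trans (R.*-congʳ ι-1) (R.*-identityˡ _))
      where
      θ = pow q k
      G : ℕ → R.Carrier
      G i = RL.pow (x i) k R.* H b i
      head-term : ∀ o c i → (∀ j → b < j ℕ.+ o → c j ≈ 0#) →
        RL.pow (x (o ℕ.+ i)) k R.* (ι (c 0) R.* H b i) R.≈ ι (pow θ o) R.* (ι (scale θ c 0) R.* G i)
      head-term o c i c-deg with o ≤? b
      ... | yes o≤b = begin
        RL.pow (x (o ℕ.+ i)) k R.* (ι (c 0) R.* H b i)
          ≈⟨ RL.solve 3 (λ p a h → p :* (a :* h) := a :* (h :* p)) R.refl _ _ _ ⟩
        ι (c 0) R.* (H b i R.* RL.pow (x (o ℕ.+ i)) k)
          ≈⟨ R.*-congˡ (H-x-pow k b i o o≤b) ⟩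
        ι (c 0) R.* (ι (pow θ o) R.* (H b i R.* RL.pow (x i) k))
          ≈⟨ RL.solve 4 (λ a r h p → a :* (r :* (h :* p)) := r :* (a :* (p :* h))) R.refl _ _ _ _ ⟩
        ι (pow θ o) R.* (ι (c 0) R.* G i)
          ≈⟨ R.*-congˡ (R.*-congʳ (ι-cong (*-identityˡ (c 0)))) ⟨
        _ ∎
      ... | no o≰b = R.trans (R.*-congˡ (R.trans (R.*-congʳ c0) (R.zeroˡ _))) (R.trans (R.zeroʳ _)
        (R.sym (R.trans (R.*-congˡ (R.trans (R.*-congʳ (R.trans (ι-* _ _) (R.trans (R.*-congˡ c0) (R.zeroʳ _)))) (R.zeroˡ _))) (R.zeroʳ _))))
        where
        c0 : ι (c 0) R.≈ R.0#
        c0 = R.trans (ι-cong (c-deg 0 (ℕₚ.≰⇒> o≰b))) ι-0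
      -- Here `o` counts the coefficients already consumed: the power of x stays at the original
      -- index while the argument of H moves down.
      go : ∀ o c → (∀ j → b < j ℕ.+ o → c j ≈ 0#) → ∀ i →
        RL.pow (x (o ℕ.+ i)) k R.* act c (H b) i R.≈ ι (pow θ o) R.* act (scale θ c) G i
      go o c c-deg zero    = head-term o c zero c-deg
      go o c c-deg (suc i) = begin
        RL.pow (x (o ℕ.+ suc i)) k R.* (ι (c 0) R.* H b (suc i) R.+ act (c ∘ suc) (H b) i)
          ≈⟨ R.distribˡ _ _ _ ⟩
        _ ≈⟨ R.+-cong (head-term o c (suc i) c-deg) (R.*-congʳ (R.reflexive (cong (λ n → RL.pow (x n) k) (ℕₚ.+-suc o i)))) ⟩
        ι (pow θ o) R.* (ι (scale θ c 0) R.* G (suc i)) R.+ RL.pow (x (suc o ℕ.+ i)) k R.* act (c ∘ suc) (H b) i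
          ≈⟨ R.+-congˡ (go (suc o) (c ∘ suc) (λ j b<j → c-deg (suc j) (subst (b ℕ.<_) (ℕₚ.+-suc j o) b<j)) i) ⟩
        ι (pow θ o) R.* (ι (scale θ c 0) R.* G (suc i)) R.+ ι (θ * pow θ o) R.* act (scale θ (c ∘ suc)) G i
          ≈⟨ R.+-congˡ (R.trans (R.*-congʳ (R.trans (ι-cong (*-comm θ (pow θ o))) (ι-* (pow θ o) θ))) (R.*-assoc _ _ _)) ⟩
        ι (pow θ o) R.* (ι (scale θ c 0) R.* G (suc i)) R.+ ι (pow θ o) R.* (ι θ R.* act (scale θ (c ∘ suc)) G i)
          ≈⟨ R.distribˡ _ _ _ ⟨
        ι (pow θ o) R.* (ι (scale θ c 0) R.* G (suc i) R.+ ι θ R.* act (scale θ (c ∘ suc)) G i)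
          ≈⟨ R.*-congˡ (R.+-congˡ (act-scaleˡ θ (scale θ (c ∘ suc)) i)) ⟨
        ι (pow θ o) R.* (ι (scale θ c 0) R.* G (suc i) R.+ act (λ j → θ * scale θ (c ∘ suc) j) G i)
          ≈⟨ R.*-congˡ (R.+-congˡ (act-cong (λ j → sym (*-assoc θ (pow θ j) (c (suc j)))) (λ _ → R.refl) i)) ⟩
        _ ∎
        where
        act-scaleˡ : ∀ θ c i → act (λ j → θ * c j) G i R.≈ ι θ R.* act c G i
        act-scaleˡ θ c zero    = R.trans (R.*-congʳ (ι-* _ _)) (R.*-assoc _ _ _)
        act-scaleˡ θ c (suc i) = R.trans
          (R.+-cong (R.trans (R.*-congʳ (ι-* _ _)) (R.*-assoc _ _ _)) (act-scaleˡ θ (c ∘ suc) i))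
          (R.sym (R.distribˡ _ _ _))

    values : (List ℕ → Carrier) → ℕ → ℕ → R.Carrier
    values F d m = value F d (initial x m)

    -- The shift puts f(x_1,...,x_{i-1}) at index i, beside the variable x_i that multiplies it in
    -- the next increment.
    values-numerator : ∀ k d F → d ≤ k → Quasi F → ∀ i →
      Q.sh (values F d) i R.≈ act (numerator k d F) (H d) i
    values-numerator k zero F d≤k F-quasi zero    = R.sym (R.zeroʳ _)
    values-numerator k zero F d≤k F-quasi (suc i) = R.trans (value-degree-0 F-quasi (initial x i))
      (R.sym (R.trans (R.+-cong (R.*-identityʳ _) (act-zero (H 0) (λ _ → refl) i)) (R.+-identityʳ _)))
    values-numerator (suc k) (suc d) F (s≤s d≤k) F-quasi = go
      where
      Fₐ : ℕ → List ℕ → Carrier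
      Fₐ a = snoc (suc a) F
      C : ℕ → ℕ → Carrier
      C a = scale (pow q (suc a)) (numerator k (d ∸ a) (Fₐ a))
      P : ℕ → Carrier
      P j = ∑< (suc d) (λ a → poch a (C a) j)

      increment : ∀ i → values F (suc d) i R.≈ Q.sh (values F (suc d)) i R.+
        T.∑< (suc d) (λ a → RL.pow (x i) (suc a) R.* Q.sh (values (Fₐ a) (d ∸ a)) i)
      increment zero    = R.sym (R.trans (R.+-identityˡ _) (T.∑<-0 (suc d) (λ a _ → R.zeroʳ _)))
      increment (suc m) = value-initial-suc x F-quasi d m

      summand : ∀ i a → a < suc d →
        RL.pow (x i) (suc a) R.* Q.sh (values (Fₐ a) (d ∸ a)) i R.≈ act (poch a (C a)) (∇H (suc d)) i
      summand i a (s≤s a≤d) = begin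
        RL.pow (x i) (suc a) R.* Q.sh (values (Fₐ a) (d ∸ a)) i
          ≈⟨ R.*-congˡ (values-numerator k (d ∸ a) (Fₐ a) (ℕₚ.≤-trans (ℕₚ.m∸n≤m d a) d≤k) (snoc-quasi a F-quasi) i) ⟩
        RL.pow (x i) (suc a) R.* act (numerator k (d ∸ a) (Fₐ a)) (H (d ∸ a)) i
          ≈⟨ pow-x-act (suc a) (d ∸ a) _ (numerator-degree k (d ∸ a) (Fₐ a) (ℕₚ.≤-trans (ℕₚ.m∸n≤m d a) d≤k)) i ⟩
        act (C a) (λ i → RL.pow (x i) (suc a) R.* H (d ∸ a) i) i
          ≈⟨ act-cong (λ _ → refl) (λ i → R.trans (pow-x-H a (d ∸ a) i)
                  (R.reflexive (cong (λ n → pochᴿ a (∇H (suc n)) i) (ℕₚ.m+[n∸m]≡n a≤d)))) i ⟩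
        act (C a) (pochᴿ a (∇H (suc d))) i
          ≈⟨ act-poch a (C a) (∇H (suc d)) i ⟨
        act (poch a (C a)) (∇H (suc d)) i ∎

      go : ∀ i → Q.sh (values F (suc d)) i R.≈ act (sh P) (H (suc d)) i
      go zero    = R.sym (act-shˡ P (H (suc d)) zero)
      -- With A the product of P and the series of H_{d+1}, the earlier value is A(i-1) and the
      -- increments sum to A(i) - A(i-1).
      go (suc i) = begin
        values F (suc d) i
          ≈⟨ increment i ⟩
        _ ≈⟨ R.+-cong (R.trans (go i) (act-shˡ P (H (suc d)) i)) (T.∑<-cong (suc d) (summand i)) ⟩
        Q.sh (act P (H (suc d))) i R.+ T.∑< (suc d) (λ a → act (poch a (C a)) (∇H (suc d)) i)
          ≈⟨ R.+-congˡ (act-∑ (suc d) (λ a → poch a (C a)) (∇H (suc d)) i) ⟨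
        Q.sh (act P (H (suc d))) i R.+ act P (∇H (suc d)) i
          ≈⟨ R.+-congˡ (act-linearʳ P R.1# (H (suc d)) (Q.sh (H (suc d))) i) ⟩
        Q.sh (act P (H (suc d))) i R.+ (act P (H (suc d)) i R.- R.1# R.* act P (Q.sh (H (suc d))) i)
          ≈⟨ R.+-congˡ (R.+-congˡ (R.-‿cong (R.*-congˡ (act-shʳ P (H (suc d)) i)))) ⟩
        Q.sh (act P (H (suc d))) i R.+ (act P (H (suc d)) i R.- R.1# R.* Q.sh (act P (H (suc d))) i)
          ≈⟨ RL.solve 2 (λ a b → a :+ (b :- con (+ 1) :* a) := b) R.refl _ _ ⟩
        act P (H (suc d)) i
          ≈⟨ act-shˡ P (H (suc d)) (suc i) ⟨
        act (sh P) (H (suc d)) (suc i) ∎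

    act-zero′ : ∀ c s i → (∀ j k → j ℕ.+ k ≡ i → ι (c j) R.* s k R.≈ R.0#) → act c s i R.≈ R.0#
    act-zero′ c s zero    z = z 0 0 ≡.refl
    act-zero′ c s (suc i) z = R.trans
      (R.+-cong (z 0 (suc i) ≡.refl) (act-zero′ (c ∘ suc) s i (λ j k e → z (suc j) k (cong suc e))))
      (R.+-identityˡ _)

    -- The second series is a multiple of t, so the product merely shifts and scales the first.
    act-single : ∀ c s → (∀ i → ¬ (i ≡ 1) → s i R.≈ R.0#) → ∀ i → act c s i R.≈ Q.sh (λ m → ι (c m) R.* s 1) i
    act-single c s z zero          = R.trans (R.*-congˡ (z 0 λ ())) (R.zeroʳ _)
    act-single c s z (suc zero)    = R.trans (R.+-congˡ (act-single (c ∘ suc) s z zero)) (R.+-identityʳ _)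
    act-single c s z (suc (suc i)) = R.trans
      (R.+-cong (R.trans (R.*-congˡ (z _ λ ())) (R.zeroʳ _)) (act-single (c ∘ suc) s z (suc i)))
      (R.+-identityˡ _)

    module Finite (n : ℕ) (u-large : ∀ i → n ≤ i → u i R.≈ R.0#) where

      H-large : ∀ b i → n ≤ b ℕ.+ i → H (suc b) i R.≈ R.0#
      H-large b i n≤b+i = R.trans (R.*-congˡ (R.trans (R.*-congˡ (u-large _ n≤b+i)) (R.zeroʳ _))) (R.zeroʳ _)

      values-vanish : ∀ {F} → Quasi F → ∀ d → values F (suc d) n R.≈ R.0#
      values-vanish {F} F-quasi d = R.trans (values-numerator (suc d) (suc d) F ℕₚ.≤-refl F-quasi (suc n))
        (act-zero′ _ _ (suc n) term)
        where
        term : ∀ j k → j ℕ.+ k ≡ suc n → ι (numerator (suc d) (suc d) F j) R.* H (suc d) k R.≈ R.0#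
        term j k eq with j ≤? suc d
        -- From j + k = n + 1 and j ≤ d + 1 follows n ≤ d + k, and u_{d+k} is the last factor of
        -- H_{d+1}(k).
        ... | yes j≤ = R.trans (R.*-congˡ (H-large d k (s≤s⁻¹ (subst (_≤ suc d ℕ.+ k) eq (ℕₚ.+-monoˡ-≤ k j≤))))) (R.zeroʳ _)
        ... | no  j≰ = R.trans (R.*-congʳ (R.trans (ι-cong (numerator-degree (suc d) (suc d) F ℕₚ.≤-refl j (ℕₚ.≰⇒> j≰))) ι-0)) (R.zeroˡ _)

      tail-product : ℕ → ℕ → R.Carrier
      tail-product zero    i = R.1#
      tail-product (suc k) i = (R.0# R.- x (suc i)) R.* tail-product k (suc i)

      -- H_{k+1}(i+2) is already zero, so `H-difference` reads -x_{i+2} H_k(i+2) = H_{k+1}(i+1). The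
      -- product of variables so obtained has a computable antisymmetrization.
      tail-product-H : ∀ k i → k ℕ.+ suc i ≡ n → tail-product k (suc i) R.≈ H k (suc i)
      tail-product-H zero    i eq = R.refl
      tail-product-H (suc k) i eq = begin
        (R.0# R.- x (suc (suc i))) R.* tail-product k (suc (suc i))
          ≈⟨ R.*-congˡ (tail-product-H k (suc i) (≡.trans (ℕₚ.+-suc k (suc i)) eq)) ⟩
        (R.0# R.- x (suc (suc i))) R.* H k (suc (suc i))
          ≈⟨ RL.solve 2 (λ a b → (con (+ 0) :- a) :* b := con (+ 0) :- a :* b) R.refl _ _ ⟩
        R.0# R.- x (suc (suc i)) R.* H k (suc (suc i))
          ≈⟨ R.+-congˡ (R.-‿cong (H-difference k (suc (suc i)))) ⟨
        R.0# R.- (H (suc k) (suc (suc i)) R.- H (suc k) (suc i))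
          ≈⟨ R.+-congˡ (R.-‿cong (R.+-congʳ (H-large k (suc (suc i))
                  (ℕₚ.≤-reflexive (≡.sym (≡.trans (ℕₚ.+-suc k (suc i)) eq)))))) ⟩
        R.0# R.- (R.0# R.- H (suc k) (suc i))
          ≈⟨ RL.solve 1 (λ a → con (+ 0) :- (con (+ 0) :- a) := a) R.refl _ ⟩
        H (suc k) (suc i) ∎

    -- The last factor u_{d+i} of H_{d+1}(i) vanishes for i ≥ 2, and H_{d+1}(0) = 0, so one index
    -- survives.
    values-top : ∀ d → (∀ i → suc (suc d) ≤ i → u i R.≈ R.0#) → ∀ {F} → Quasi F → ∀ m →
      values F (suc d) m R.≈ ι (numerator (suc d) (suc d) F m) R.* H (suc d) 1
    values-top d u-large {F} F-quasi m = R.trans (values-numerator (suc d) (suc d) F ℕₚ.≤-refl F-quasi (suc m))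
      (act-single (numerator (suc d) (suc d) F) (H (suc d)) off (suc m))
      where
      open Finite (suc (suc d)) u-large
      off : ∀ i → ¬ (i ≡ 1) → H (suc d) i R.≈ R.0#
      off zero          i≢1 = H-zero (suc d)
      off (suc zero)    i≢1 = contradiction ≡.refl i≢1
      off (suc (suc i)) i≢1 = H-large d (suc (suc i)) (subst (suc (suc d) ℕ.≤_)
        (≡.sym (≡.trans (ℕₚ.+-suc d (suc i)) (cong suc (ℕₚ.+-suc d i)))) (s≤s (s≤s (ℕₚ.m≤m+n d i))))

-- Adjacent exchanges and repeated exponents

sw : ∀ {a} {A : Set a} {n} → ℕ → Vec A n → Vec A n
sw p       []          = []
sw zero    (x ∷ [])    = x ∷ []
sw zero    (x ∷ y ∷ v) = y ∷ x ∷ v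
sw (suc p) (x ∷ v)     = x ∷ sw p v

map-sw : ∀ {a b} {A : Set a} {B : Set b} {n} (f : A → B) p (v : Vec A n) →
         V.map f (sw p v) ≡ sw p (V.map f v)
map-sw f zero    []          = ≡.refl
map-sw f (suc p) []          = ≡.refl
map-sw f zero    (x ∷ [])    = ≡.refl
map-sw f zero    (x ∷ y ∷ v) = ≡.refl
map-sw f (suc p) (x ∷ v)     = cong (f x ∷_) (map-sw f p v)

sw-++ˡ : ∀ {a} {A : Set a} {i k} p (u : Vec A i) (v : Vec A k) → suc p < i →
         sw p (u V.++ v) ≡ sw p u V.++ v
sw-++ˡ zero    (x ∷ y ∷ u) v p<i         = ≡.refl
sw-++ˡ (suc p) (x ∷ u)     v (s≤s p<i) = cong (x ∷_) (sw-++ˡ p u v p<i)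
sw-++ˡ zero    (x ∷ [])    v (s≤s ())

sw-++ʳ : ∀ {a} {A : Set a} {i k} p (u : Vec A i) (v : Vec A k) →
         sw (i ℕ.+ p) (u V.++ v) ≡ u V.++ sw p v
sw-++ʳ p []      v = ≡.refl
sw-++ʳ p (x ∷ u) v = cong (x ∷_) (sw-++ʳ p u v)

entry : ∀ {n} → Vec ℕ n → ℕ → ℕ
entry []      p       = 0
entry (x ∷ e) zero    = x
entry (x ∷ e) (suc p) = entry e p

entry-lookup : ∀ {n} (e : Vec ℕ n) i → entry e (F.toℕ i) ≡ V.lookup e i
entry-lookup (x ∷ e) F.zero    = ≡.refl
entry-lookup (x ∷ e) (F.suc i) = entry-lookup e i

entry-sw-< : ∀ {n} p (e : Vec ℕ n) a → a < p → entry (sw p e) a ≡ entry e a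
entry-sw-< (suc p) []      a       a<p         = ≡.refl
entry-sw-< (suc p) (x ∷ e) zero    a<p         = ≡.refl
entry-sw-< (suc p) (x ∷ e) (suc a) (s≤s a<p) = entry-sw-< p e a a<p

entry-sw : ∀ {n} p (e : Vec ℕ n) → suc p < n → entry (sw p e) p ≡ entry e (suc p)
entry-sw zero    (x ∷ [])    (s≤s ())
entry-sw zero    (x ∷ y ∷ e) p<n         = ≡.refl
entry-sw (suc p) (x ∷ e)     (s≤s p<n) = entry-sw p e p<n

sw-fixed : ∀ {n} p (e : Vec ℕ n) → suc p < n → entry e p ≡ entry e (suc p) → sw p e ≡ e
sw-fixed zero    (x ∷ [])    (s≤s ()) eq
sw-fixed zero    (x ∷ y ∷ e) p<n         ≡.refl = ≡.refl
sw-fixed (suc p) (x ∷ e)     (s≤s p<n) eq     = cong (x ∷_) (sw-fixed p e p<n eq)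

sum-zipWith : ∀ {n} (d e : Vec ℕ n) → V.sum (V.zipWith ℕ._+_ d e) ≡ V.sum d ℕ.+ V.sum e
sum-zipWith []      []      = ≡.refl
sum-zipWith (x ∷ d) (y ∷ e) = ≡.trans (cong (x ℕ.+ y ℕ.+_) (sum-zipWith d e))
  (interchange x y (V.sum d) (V.sum e))
  where open import Algebra.Properties.CommutativeSemigroup ℕₚ.+-commutativeSemigroup using (interchange)

sum-replicate-0 : ∀ n → V.sum (V.replicate n 0) ≡ 0
sum-replicate-0 zero    = ≡.refl
sum-replicate-0 (suc n) = sum-replicate-0 n

sum-removeAt : ∀ {n} (e : Vec ℕ (suc n)) j → V.sum e ≡ V.lookup e j ℕ.+ V.sum (V.removeAt e j)
sum-removeAt (x ∷ e)     F.zero    = ≡.refl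
sum-removeAt (x ∷ y ∷ e) (F.suc j) = ≡.trans (cong (x ℕ.+_) (sum-removeAt (y ∷ e) j))
  (x∙yz≈y∙xz x (V.lookup (y ∷ e) j) _)
  where open import Algebra.Properties.CommutativeSemigroup ℕₚ.+-commutativeSemigroup using (x∙yz≈y∙xz)

lookup-removeAt : ∀ {n} (e : Vec ℕ (suc n)) j i → V.lookup (V.removeAt e j) i ≡ V.lookup e (F.punchIn j i)
lookup-removeAt (x ∷ e)     F.zero    i         = ≡.refl
lookup-removeAt (x ∷ y ∷ e) (F.suc j) F.zero    = ≡.refl
lookup-removeAt (x ∷ y ∷ e) (F.suc j) (F.suc i) = lookup-removeAt (y ∷ e) j i

binom₂ : ℕ → ℕ
binom₂ zero    = 0
binom₂ (suc n) = n ℕ.+ binom₂ n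

Repeats : ∀ {a} {A : Set a} {n} → Vec A n → Set a
Repeats {n = n} v = Σ (Fin n) λ i → Σ (Fin n) λ j → ¬ (i ≡ j) × V.lookup v i ≡ V.lookup v j

-- Distinct entries would sum to at least 0 + 1 + ⋯ + (n-1). In length n + 1, an entry that is at
-- least n is removed and the bound drops by n; if there is none, n + 1 entries lie below n and the
-- pigeonhole principle applies.
small-sum-repeats : ∀ {n} (e : Vec ℕ n) → V.sum e < binom₂ n → Repeats e
small-sum-repeats {suc n} e sum< with Fₚ.any? (λ j → n ≤? V.lookup e j)
... | yes (j , n≤) = lift (small-sum-repeats (V.removeAt e j) sum′<)
  where
  sum′< : V.sum (V.removeAt e j) < binom₂ n
  sum′< = ℕₚ.+-cancelˡ-< n _ _ (ℕₚ.≤-<-trans (ℕₚ.+-monoˡ-≤ _ n≤) (subst (_< n ℕ.+ binom₂ n) (sum-removeAt e j) sum<))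
  lift : Repeats (V.removeAt e j) → Repeats e
  lift (i , i′ , i≢i′ , eq) = F.punchIn j i , F.punchIn j i′ , i≢i′ ∘ Fₚ.punchIn-injective j i i′ ,
    ≡.trans (≡.sym (lookup-removeAt e j i)) (≡.trans eq (lookup-removeAt e j i′))
... | no  none = repeat (Fₚ.pigeonhole (ℕₚ.n<1+n n) (λ j → F.fromℕ< (below j)))
  where
  below : ∀ j → V.lookup e j < n
  below j = ℕₚ.≰⇒> (λ n≤ → none (j , n≤))
  repeat : _ → Repeats e
  repeat (i , j , i<j , eq) = i , j , Fₚ.<⇒≢ i<j ,
    ≡.trans (≡.sym (Fₚ.toℕ-fromℕ< (below i))) (≡.trans (cong F.toℕ eq) (Fₚ.toℕ-fromℕ< (below j)))

repeats? : ∀ {m n} (v : Vec (Fin m) n) → Repeats v ⊎ (∀ {i j} → V.lookup v i ≡ V.lookup v j → i ≡ j)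
repeats? v with Fₚ.any? (λ i → Fₚ.any? (λ j → ¬? (i F.≟ j) ×-dec (V.lookup v i F.≟ V.lookup v j)))
... | yes (i , j , i≢j , eq) = inj₁ (i , j , i≢j , eq)
... | no  none = inj₂ λ {i} {j} eq → decidable-stable (i F.≟ j) (λ i≢j → none (i , j , i≢j , eq))

-- Alternating sums: vanishing in low degree and normalization of the staircase

module Alternants {c ℓ : Level} (R : CommutativeRing c ℓ) (q : CommutativeRing.Carrier R)
  (2-cancel : RingLemmas.2-Cancellable R) where
  open CommutativeRing R hiding (zero)
  open RingLemmas R
  open SetoidReasoning setoid
  open import Algebra.Properties.Ring ring using (-‿distribˡ-*; -0#≈0#; -‿involutive)

  L : ∀ {n} → Carrier → Vec Carrier n → Carrier
  L α []      = 1#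
  L α (b ∷ v) = (α - b) * L α v

  -- St z is the staircase product ∏_{i+2≤j} (q z_i − z_j).
  St : ∀ {n} → Vec Carrier n → Carrier
  St []          = 1#
  St (a ∷ [])    = 1#
  St (a ∷ b ∷ v) = L (q * a) v * St (b ∷ v)

  Δ : ∀ {n} → Vec Carrier n → Carrier
  Δ []      = 1#
  Δ (a ∷ v) = L a v * Δ v

  total : ∀ {n} → Vec Carrier n → Carrier
  total []      = 0#
  total (a ∷ v) = a + total v

  cross : ∀ {i k} → Vec Carrier i → Vec Carrier k → Carrier
  cross []      v = 1#
  cross (a ∷ u) v = L (q * a) v * cross u v

  L-sw : ∀ {n} α p (v : Vec Carrier n) → L α (sw p v) ≈ L α v
  L-sw α zero    []          = refl
  L-sw α (suc p) []          = refl
  L-sw α zero    (x ∷ [])    = refl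
  L-sw α zero    (x ∷ y ∷ v) = solve 3 (λ x y l → y :* (x :* l) := x :* (y :* l)) refl _ _ _
  L-sw α (suc p) (x ∷ v)     = *-congˡ (L-sw α p v)

  total-sw : ∀ {n} p (v : Vec Carrier n) → total (sw p v) ≈ total v
  total-sw zero    []          = refl
  total-sw (suc p) []          = refl
  total-sw zero    (x ∷ [])    = refl
  total-sw zero    (x ∷ y ∷ v) = solve 3 (λ x y l → y :+ (x :+ l) := x :+ (y :+ l)) refl _ _ _
  total-sw (suc p) (x ∷ v)     = +-congˡ (total-sw p v)

  mono-sw : ∀ {n} p (v : Vec Carrier n) e → mono (sw p v) e ≈ mono v (sw p e)
  mono-sw zero    []          []          = refl
  mono-sw (suc p) []          []          = refl
  mono-sw zero    (x ∷ [])    (d ∷ [])    = refl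
  mono-sw zero    (x ∷ y ∷ v) (d ∷ e ∷ f) = solve 3 (λ x y l → y :* (x :* l) := x :* (y :* l)) refl _ _ _
  mono-sw (suc p) (x ∷ v)     (d ∷ e)     = *-congˡ (mono-sw p v e)

  cross-swˡ : ∀ {i k} p (u : Vec Carrier i) (v : Vec Carrier k) → cross (sw p u) v ≈ cross u v
  cross-swˡ zero    []          v = refl
  cross-swˡ (suc p) []          v = refl
  cross-swˡ zero    (x ∷ [])    v = refl
  cross-swˡ zero    (x ∷ y ∷ u) v = solve 3 (λ x y l → y :* (x :* l) := x :* (y :* l)) refl _ _ _
  cross-swˡ (suc p) (x ∷ u)     v = *-congˡ (cross-swˡ p u v)

  cross-swʳ : ∀ {i k} p (u : Vec Carrier i) (v : Vec Carrier k) → cross u (sw p v) ≈ cross u v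
  cross-swʳ p []      v = refl
  cross-swʳ p (a ∷ u) v = *-cong (L-sw (q * a) p v) (cross-swʳ p u v)

  L-++ : ∀ {i k} α (u : Vec Carrier i) (v : Vec Carrier k) → L α (u V.++ v) ≈ L α u * L α v
  L-++ α []      v = sym (*-identityˡ _)
  L-++ α (a ∷ u) v = trans (*-congˡ (L-++ α u v)) (sym (*-assoc _ _ _))

  mono-++ : ∀ {i k} (u : Vec Carrier i) (v : Vec Carrier k) e f → mono (u V.++ v) (e V.++ f) ≈ mono u e * mono v f
  mono-++ []      v []      f = sym (*-identityˡ _)
  mono-++ (a ∷ u) v (d ∷ e) f = trans (*-congˡ (mono-++ u v e f)) (sym (*-assoc _ _ _))

  -- The factor q x_i − x_{i+1} missing between the last entry of u and the first of v
  -- completes the staircase product across the cut to the symmetric product cross u v.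
  St-cut : ∀ {i k} (u : Vec Carrier (suc i)) (v : Vec Carrier (suc k)) →
    St (u V.++ v) * (q * V.last u - V.head v) ≈ cross u v * (St u * St v)
  St-cut (a ∷ []) (b ∷ v) =
    solve 3 (λ l s d → l :* s :* d := d :* l :* con (+ 1) :* (con (+ 1) :* s)) refl _ _ _
  St-cut (a ∷ a′ ∷ u) v = begin
    L (q * a) (u V.++ v) * St (a′ ∷ u V.++ v) * (q * V.last (a′ ∷ u) - V.head v)
      ≈⟨ *-assoc _ _ _ ⟩
    L (q * a) (u V.++ v) * (St (a′ ∷ u V.++ v) * (q * V.last (a′ ∷ u) - V.head v))
      ≈⟨ *-cong (L-++ (q * a) u v) (St-cut (a′ ∷ u) v) ⟩
    L (q * a) u * L (q * a) v * (cross (a′ ∷ u) v * (St (a′ ∷ u) * St v))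
      ≈⟨ solve 5 (λ lu lv c s t → lu :* lv :* (c :* (s :* t)) := lv :* c :* (lu :* s :* t)) refl _ _ _ _ _ ⟩
    cross (a ∷ a′ ∷ u) v * (St (a ∷ a′ ∷ u) * St v) ∎

  -- The sign of b - a.
  sg : ∀ {m} → Fin m → Fin m → Carrier
  sg F.zero    F.zero    = 0#
  sg F.zero    (F.suc b) = 1#
  sg (F.suc a) F.zero    = - 1#
  sg (F.suc a) (F.suc b) = sg a b

  row : ∀ {m n} → Fin m → Vec (Fin m) n → Carrier
  row a []      = 1#
  row a (b ∷ v) = sg a b * row a v

  -- The sign of the map j ↦ v_j if it is injective, and 0 otherwise.
  E : ∀ {m n} → Vec (Fin m) n → Carrier
  E []      = 1#
  E (a ∷ v) = row a v * E v

  sg-antisym : ∀ {m} (a b : Fin m) → sg b a ≈ - sg a b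
  sg-antisym F.zero    F.zero    = sym -0#≈0#
  sg-antisym F.zero    (F.suc b) = refl
  sg-antisym (F.suc a) F.zero    = sym (-‿involutive 1#)
  sg-antisym (F.suc a) (F.suc b) = sg-antisym a b

  sg-refl : ∀ {m} (a : Fin m) → sg a a ≈ 0#
  sg-refl F.zero    = refl
  sg-refl (F.suc a) = sg-refl a

  row-sw : ∀ {m n} (a : Fin m) p (v : Vec (Fin m) n) → row a (sw p v) ≈ row a v
  row-sw a zero    []          = refl
  row-sw a (suc p) []          = refl
  row-sw a zero    (x ∷ [])    = refl
  row-sw a zero    (x ∷ y ∷ v) = solve 3 (λ x y l → y :* (x :* l) := x :* (y :* l)) refl _ _ _
  row-sw a (suc p) (x ∷ v)     = *-congˡ (row-sw a p v)

  Alternating : ∀ {m n} → (Vec (Fin m) n → Carrier) → Set ℓ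
  Alternating {n = n} ε = ∀ p v → suc p < n → ε (sw p v) ≈ - ε v

  E-alternating : ∀ {m n} → Alternating (E {m} {n})
  E-alternating zero (a ∷ []) (s≤s ())
  E-alternating zero (a ∷ b ∷ v) p<n = trans (*-congʳ (*-congʳ (sg-antisym a b)))
    (solve 4 (λ s x y l → :- s :* x :* (y :* l) := :- (s :* y :* (x :* l))) refl _ _ _ _)
  E-alternating (suc p) (a ∷ v) (s≤s p<n) = trans (*-cong (row-sw a p v) (E-alternating p v p<n))
    (solve 2 (λ r e → r :* :- e := :- (r :* e)) refl _ _)

  row-repeat : ∀ {m n} (a : Fin m) (v : Vec (Fin m) n) j → a ≡ V.lookup v j → row a v ≈ 0#
  row-repeat a (b ∷ v) F.zero    ≡.refl = trans (*-congʳ (sg-refl a)) (zeroˡ _)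
  row-repeat a (b ∷ v) (F.suc j) eq     = trans (*-congˡ (row-repeat a v j eq)) (zeroʳ _)

  E-repeats : ∀ {m n} (v : Vec (Fin m) n) → Repeats v → E v ≈ 0#
  E-repeats (a ∷ v) (F.zero  , F.zero  , i≢j , eq) = contradiction ≡.refl i≢j
  E-repeats (a ∷ v) (F.zero  , F.suc j , i≢j , eq) = trans (*-congʳ (row-repeat a v j eq)) (zeroˡ _)
  E-repeats (a ∷ v) (F.suc i , F.zero  , i≢j , eq) = trans (*-congʳ (row-repeat a v i (≡.sym eq))) (zeroˡ _)
  E-repeats (a ∷ v) (F.suc i , F.suc j , i≢j , eq) =
    trans (*-congˡ (E-repeats v (i , j , i≢j ∘ cong F.suc , eq))) (zeroʳ _)

  E-long : ∀ {m n} (v : Vec (Fin m) n) → m < n → E v ≈ 0#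
  E-long v m<n with Fₚ.pigeonhole m<n (V.lookup v)
  ... | i , j , i<j , eq = E-repeats v (i , j , Fₚ.<⇒≢ i<j , eq)

  row-map-suc : ∀ {m n} (a : Fin m) (v : Vec (Fin m) n) → row (F.suc a) (V.map F.suc v) ≈ row a v
  row-map-suc a []      = refl
  row-map-suc a (b ∷ v) = *-congˡ (row-map-suc a v)

  row-zero-map-suc : ∀ {m n} (v : Vec (Fin m) n) → row F.zero (V.map F.suc v) ≈ 1#
  row-zero-map-suc []      = refl
  row-zero-map-suc (b ∷ v) = trans (*-identityˡ _) (row-zero-map-suc v)

  E-map-suc : ∀ {m n} (v : Vec (Fin m) n) → E (V.map F.suc v) ≈ E v
  E-map-suc []      = refl
  E-map-suc (a ∷ v) = *-cong (row-map-suc a v) (E-map-suc v)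

  -- A sum over all maps, not only permutations: such a sum splits at any cut of the positions and
  -- is stable under exchanges, while `E` removes the non-injective maps.
  SumV : ∀ {m} n → (Vec (Fin m) n → Carrier) → Carrier
  SumV         zero    φ = φ []
  SumV {m = m} (suc n) φ = ∑ (allFin m) (λ a → SumV n (λ v → φ (a ∷ v)))

  module _ {m : ℕ} where

    SumV-cong : ∀ n {φ ψ : Vec (Fin m) n → Carrier} → (∀ v → φ v ≈ ψ v) → SumV n φ ≈ SumV n ψ
    SumV-cong zero    e = e []
    SumV-cong (suc n) e = ∑-cong (allFin m) (λ a → SumV-cong n (λ v → e (a ∷ v)))

    SumV-0 : ∀ n {φ : Vec (Fin m) n → Carrier} → (∀ v → φ v ≈ 0#) → SumV n φ ≈ 0#
    SumV-0 zero    e = e []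
    SumV-0 (suc n) e = ∑-0 (allFin m) (λ a → SumV-0 n (λ v → e (a ∷ v)))

    SumV-+ : ∀ n (φ ψ : Vec (Fin m) n → Carrier) → SumV n (λ v → φ v + ψ v) ≈ SumV n φ + SumV n ψ
    SumV-+ zero    φ ψ = refl
    SumV-+ (suc n) φ ψ = trans (∑-cong (allFin m) (λ a → SumV-+ n _ _)) (∑-+ (allFin m) _ _)

    SumV-* : ∀ n x (φ : Vec (Fin m) n → Carrier) → SumV n (λ v → x * φ v) ≈ x * SumV n φ
    SumV-* zero    x φ = refl
    SumV-* (suc n) x φ = trans (∑-cong (allFin m) (λ a → SumV-* n x _)) (sym (∑-distribˡ x (allFin m) _))

    SumV-∑ : ∀ {a} {A : Set a} n (xs : List A) (φ : Vec (Fin m) n → A → Carrier) →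
             SumV n (λ v → ∑ xs (φ v)) ≈ ∑ xs (λ x → SumV n (λ v → φ v x))
    SumV-∑ zero    xs φ = refl
    SumV-∑ (suc n) xs φ = trans (∑-cong (allFin m) (λ a → SumV-∑ n xs _)) (∑-swap (allFin m) xs _)

    SumV-swap : ∀ i k (φ : Vec (Fin m) i → Vec (Fin m) k → Carrier) →
      SumV i (λ u → SumV k (φ u)) ≈ SumV k (λ v → SumV i (λ u → φ u v))
    SumV-swap i zero    φ = refl
    SumV-swap i (suc k) φ = trans (SumV-∑ i (allFin m) _)
      (∑-cong (allFin m) (λ a → SumV-swap i k (λ u v → φ u (a ∷ v))))

    SumV-++ : ∀ i k (φ : Vec (Fin m) (i ℕ.+ k) → Carrier) →
      SumV (i ℕ.+ k) φ ≈ SumV i (λ u → SumV k (λ v → φ (u V.++ v)))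
    SumV-++ zero    k φ = refl
    SumV-++ (suc i) k φ = ∑-cong (allFin m) (λ a → SumV-++ i k (λ w → φ (a ∷ w)))

    SumV-sw : ∀ n p (φ : Vec (Fin m) n → Carrier) → SumV n (φ ∘ sw p) ≈ SumV n φ
    SumV-sw zero          zero    φ = refl
    SumV-sw zero          (suc p) φ = refl
    SumV-sw (suc zero)    zero    φ = refl
    SumV-sw (suc (suc n)) zero    φ = ∑-swap (allFin m) (allFin m) _
    SumV-sw (suc n)       (suc p) φ = ∑-cong (allFin m) (λ a → SumV-sw n p (λ v → φ (a ∷ v)))

  -- Deg d holds of polynomial functions of degree strictly less than d.
  data Deg {n} (d : ℕ) : (Vec Carrier n → Carrier) → Set (c ⊔ ℓ) where
    mon : ∀ e → V.sum e < d → Deg d (λ z → mono z e)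
    zer : Deg d (λ _ → 0#)
    add : ∀ {F G} → Deg d F → Deg d G → Deg d (λ z → F z + G z)
    scl : ∀ {F} x → Deg d F → Deg d (λ z → x * F z)
    rsp : ∀ {F G} → (∀ z → F z ≈ G z) → Deg d F → Deg d G

  module _ {n : ℕ} where

    weaken : ∀ {d d′ F} → d ≤ d′ → Deg {n} d F → Deg d′ F
    weaken d≤ (mon e e<) = mon e (ℕₚ.≤-trans e< d≤)
    weaken d≤ zer        = zer
    weaken d≤ (add F G)  = add (weaken d≤ F) (weaken d≤ G)
    weaken d≤ (scl x F)  = scl x (weaken d≤ F)
    weaken d≤ (rsp e F)  = rsp e (weaken d≤ F)

    mul : ∀ {a b F G} → Deg {n} (suc a) F → Deg b G → Deg (a ℕ.+ b) (λ z → F z * G z)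
    mul {a} {b} (mon e (s≤s e≤)) G = go G
      where
      go : ∀ {G} → Deg b G → Deg (a ℕ.+ b) (λ z → mono z e * G z)
      go (mon f f<) = rsp (λ z → mono-+ z e f)
        (mon (V.zipWith ℕ._+_ e f) (subst (_< a ℕ.+ b) (≡.sym (sum-zipWith e f)) (ℕₚ.+-mono-≤-< e≤ f<)))
      go zer        = rsp (λ z → sym (zeroʳ _)) zer
      go (add G H)  = rsp (λ z → sym (distribˡ _ _ _)) (add (go G) (go H))
      go (scl x G)  = rsp (λ z → solve 3 (λ x y w → x :* (y :* w) := y :* (x :* w)) refl _ _ _) (scl x (go G))
      go (rsp e G)  = rsp (λ z → *-congˡ (e z)) (go G)
    mul zer       H = rsp (λ z → sym (zeroˡ _)) zer
    mul (add F G) H = rsp (λ z → sym (distribʳ _ _ _)) (add (mul F H) (mul G H))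
    mul (scl x F) H = rsp (λ z → sym (*-assoc _ _ _)) (scl x (mul F H))
    mul (rsp e F) H = rsp (λ z → *-congʳ (e z)) (mul F H)

    deg-const : ∀ x → Deg {n} 1 (λ _ → x)
    deg-const x = rsp (λ z → trans (*-congˡ (mono-0 z)) (*-identityʳ x))
      (scl x (mon (V.replicate n 0) (s≤s (ℕₚ.≤-reflexive (sum-replicate-0 n)))))

    deg-minus : ∀ {d F G} → Deg {n} d F → Deg d G → Deg d (λ z → F z - G z)
    deg-minus F G = rsp (λ z → +-congˡ (trans (sym (-‿distribˡ-* _ _)) (-‿cong (*-identityˡ _)))) (add F (scl (- 1#) G))

  deg-tail : ∀ {n d F} → Deg {n} d F → Deg {suc n} d (λ z → F (V.tail z))
  deg-tail (mon e e<) = rsp (λ { (a ∷ z) → *-identityˡ _ }) (mon (0 ∷ e) e<)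
  deg-tail zer        = zer
  deg-tail (add F G)  = add (deg-tail F) (deg-tail G)
  deg-tail (scl x F)  = scl x (deg-tail F)
  deg-tail (rsp e F)  = rsp (λ z → e (V.tail z)) (deg-tail F)

  deg-lookup : ∀ {n} (j : Fin n) → Deg 2 (λ z → V.lookup z j)
  deg-lookup {suc n} F.zero = rsp (λ { (a ∷ z) → trans (*-cong (*-identityʳ a) (mono-0 z)) (*-identityʳ a) })
    (mon (1 ∷ V.replicate n 0) (s≤s (s≤s (ℕₚ.≤-reflexive (sum-replicate-0 n)))))
  deg-lookup (F.suc j) = rsp (λ { (a ∷ z) → refl }) (deg-tail (deg-lookup j))

  module _ {n : ℕ} where

    Coordinates : ∀ {k} → (Vec Carrier n → Vec Carrier k) → Set (c ⊔ ℓ)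
    Coordinates h = ∀ j → Deg 2 (λ z → V.lookup (h z) j)

    private
      -- The clauses of `L` and `St` do not reduce on `h z`; this and the next lemmas supply them as
      -- equations.
      L-unfold : ∀ {k} α (v : Vec Carrier (suc k)) → L α v ≡ (α - V.lookup v F.zero) * L α (V.tail v)
      L-unfold α (b ∷ v) = ≡.refl

      lookup-tail : ∀ {k} (v : Vec Carrier (suc k)) j → V.lookup (V.tail v) j ≡ V.lookup v (F.suc j)
      lookup-tail (b ∷ v) j = ≡.refl

      St-unfold : ∀ {k} (v : Vec Carrier (suc (suc k))) →
        St v ≡ L (q * V.lookup v F.zero) (V.tail (V.tail v)) * St (V.tail v)
      St-unfold (a ∷ b ∷ v) = ≡.refl

      St-single : (v : Vec Carrier 1) → St v ≡ 1#
      St-single (a ∷ []) = ≡.refl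

      L-empty : ∀ α (v : Vec Carrier 0) → L α v ≡ 1#
      L-empty α [] = ≡.refl

      St-empty : (v : Vec Carrier 0) → St v ≡ 1#
      St-empty [] = ≡.refl

    coordinates-tail : ∀ {k} (h : Vec Carrier n → Vec Carrier (suc k)) → Coordinates h → Coordinates (V.tail ∘ h)
    coordinates-tail h H j = rsp (λ z → reflexive (≡.sym (lookup-tail (h z) j))) (H (F.suc j))

    deg-L : ∀ {k} (h : Vec Carrier n → Vec Carrier k) {α} → Deg 2 α → Coordinates h →
            Deg (suc k) (λ z → L (α z) (h z))
    deg-L {zero}  h A H = rsp (λ z → reflexive (≡.sym (L-empty _ (h z)))) (deg-const 1#)
    deg-L {suc k} h A H = rsp (λ z → reflexive (≡.sym (L-unfold _ (h z))))
      (mul (deg-minus A (H F.zero)) (deg-L (V.tail ∘ h) A (coordinates-tail h H)))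

    -- The terms of top degree do not depend on α and cancel, so the bound is one lower than for
    -- `L`.
    deg-L-difference : ∀ {k} (h : Vec Carrier n → Vec Carrier k) α → Coordinates h →
            Deg k (λ z → L α (h z) - L 0# (h z))
    deg-L-difference {zero} h α H = rsp (λ z → sym (trans (+-cong (reflexive (L-empty α (h z)))
      (-‿cong (reflexive (L-empty 0# (h z))))) (-‿inverseʳ 1#))) zer
    deg-L-difference {suc k} h α H = rsp (λ z → sym (trans (+-cong (reflexive (L-unfold α (h z)))
        (-‿cong (reflexive (L-unfold 0# (h z)))))
        (solve 4 (λ a b l l₀ → (a :- b) :* l :- (con (+ 0) :- b) :* l₀ := (con (+ 0) :- b) :* (l :- l₀) :+ a :* l) refl _ _ _ _)))
      (add (mul (deg-minus zer (H F.zero)) (deg-L-difference (V.tail ∘ h) α (coordinates-tail h H)))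
           (scl α (deg-L (V.tail ∘ h) (weaken (s≤s z≤n) (deg-const α)) (coordinates-tail h H))))

    -- Among k + 1 variables there are binom(k+1, 2) - k = binom(k, 2) pairs at distance at least 2.
    degSt : ℕ → ℕ
    degSt zero    = 0
    degSt (suc k) = binom₂ k

    deg-St : ∀ {k} (h : Vec Carrier n → Vec Carrier k) → Coordinates h → Deg (suc (degSt k)) (λ z → St (h z))
    deg-St {zero}        h H = rsp (λ z → reflexive (≡.sym (St-empty (h z)))) (deg-const 1#)
    deg-St {suc zero}    h H = rsp (λ z → reflexive (≡.sym (St-single (h z)))) (deg-const 1#)
    deg-St {suc (suc k)} h H = rsp (λ z → reflexive (≡.sym (St-unfold (h z))))
      (subst (λ d → Deg d (λ z → L (q * V.lookup (h z) F.zero) (V.tail (V.tail (h z))) * St (V.tail (h z))))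
        (ℕₚ.+-suc k (binom₂ k))
        (mul (deg-L (V.tail ∘ V.tail ∘ h) (scl q (H F.zero)) (coordinates-tail (V.tail ∘ h) (coordinates-tail h H)))
             (deg-St (V.tail ∘ h) (coordinates-tail h H))))

  module _ {m : ℕ} (y : Fin m → Carrier) where

    private
      monoSum : ∀ {n} → (Vec (Fin m) n → Carrier) → Vec ℕ n → Carrier
      monoSum {n} ε e = SumV n (λ v → ε v * mono (V.map y v) e)

      monoSum-sw : ∀ {n} {ε} → Alternating {m} {n} ε → ∀ p e → suc p < n →
                   monoSum ε e ≈ - monoSum ε (sw p e)
      monoSum-sw {n} {ε} alt p e p<n = begin
        monoSum ε e
          ≈⟨ SumV-sw n p _ ⟨
        SumV n (λ v → ε (sw p v) * mono (V.map y (sw p v)) e)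
          ≈⟨ SumV-cong n (λ v → *-cong (alt p v p<n)
               (trans (reflexive (cong (λ z → mono z e) (map-sw y p v))) (mono-sw p (V.map y v) e))) ⟩
        SumV n (λ v → - ε v * mono (V.map y v) (sw p e))
          ≈⟨ SumV-cong n (λ v → solve 2 (λ a b → :- a :* b := :- con (+ 1) :* (a :* b)) refl _ _) ⟩
        SumV n (λ v → - 1# * (ε v * mono (V.map y v) (sw p e)))
          ≈⟨ SumV-* n (- 1#) _ ⟩
        - 1# * monoSum ε (sw p e)
          ≈⟨ solve 1 (λ a → :- con (+ 1) :* a := :- a) refl _ ⟩
        - monoSum ε (sw p e) ∎

      -- Equal exponents in neighbouring positions make the sum its own negative. Otherwise an
      -- exchange moves the second one a step closer, at the cost of a sign.
      monoSum-entries : ∀ {n} {ε} → Alternating {m} {n} ε → ∀ d a e → suc (a ℕ.+ d) < n →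
        entry e a ≡ entry e (suc (a ℕ.+ d)) → monoSum ε e ≈ 0#
      monoSum-entries {n} {ε} alt zero a e a<n eq = 2-cancel _ (trans (+-congˡ self) (-‿inverseʳ _))
        where
        a<n′ = subst (λ b → suc b < n) (ℕₚ.+-identityʳ a) a<n
        self : monoSum ε e ≈ - monoSum ε e
        self = trans (monoSum-sw alt a e a<n′) (-‿cong (reflexive (cong (monoSum ε)
          (sw-fixed a e a<n′ (≡.trans eq (cong (λ b → entry e (suc b)) (ℕₚ.+-identityʳ a)))))))
      monoSum-entries {n} {ε} alt (suc d) a e a<n eq = trans (monoSum-sw alt p e p<n)
        (trans (-‿cong (monoSum-entries alt d a (sw p e) (ℕₚ.<⇒≤ p<n) eq′)) -0#≈0#)
        where
        p = suc (a ℕ.+ d)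
        p<n = subst (λ b → suc b < n) (ℕₚ.+-suc a d) a<n
        eq′ : entry (sw p e) a ≡ entry (sw p e) (suc (a ℕ.+ d))
        eq′ = ≡.trans (entry-sw-< p e a (s≤s (ℕₚ.m≤m+n a d)))
          (≡.trans eq (≡.trans (cong (λ b → entry e (suc b)) (ℕₚ.+-suc a d)) (≡.sym (entry-sw p e p<n))))

      monoSum-ordered : ∀ {n} {ε} → Alternating {m} {n} ε → ∀ e i j → i F.< j →
                        V.lookup e i ≡ V.lookup e j → monoSum ε e ≈ 0#
      monoSum-ordered {n} alt e i j i<j eq = monoSum-entries alt (F.toℕ j ∸ suc (F.toℕ i)) (F.toℕ i) e
        (subst (_< n) (≡.sym position) (Fₚ.toℕ<n j))
        (≡.trans (entry-lookup e i) (≡.trans eq (≡.trans (≡.sym (entry-lookup e j)) (cong (entry e) (≡.sym position)))))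
        where
        position : suc (F.toℕ i ℕ.+ (F.toℕ j ∸ suc (F.toℕ i))) ≡ F.toℕ j
        position = ℕₚ.m+[n∸m]≡n i<j

      monoSum-repeats : ∀ {n} {ε} → Alternating {m} {n} ε → ∀ e → Repeats e → monoSum ε e ≈ 0#
      monoSum-repeats {n} {ε} alt e (i , j , i≢j , eq) with Fₚ.<-cmp i j
      ... | tri< i<j _ _ = monoSum-ordered alt e i j i<j eq
      ... | tri≈ _ i≡j _ = contradiction i≡j i≢j
      ... | tri> _ _ j<i = monoSum-ordered alt e j i j<i (≡.sym eq)

    -- A monomial of degree below binom(n, 2) repeats an exponent, and then its alternating sum is
    -- zero.
    low-degree-vanishes : ∀ {n} {ε} → Alternating {m} {n} ε → ∀ {F} → Deg (binom₂ n) F →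
      SumV n (λ v → ε v * F (V.map y v)) ≈ 0#
    low-degree-vanishes alt (mon e e<) = monoSum-repeats alt e (small-sum-repeats e e<)
    low-degree-vanishes {n} alt zer = SumV-0 n (λ v → zeroʳ _)
    low-degree-vanishes {n} alt (add F G) = trans (SumV-cong n (λ v → distribˡ _ _ _))
      (trans (SumV-+ n _ _) (trans (+-cong (low-degree-vanishes alt F) (low-degree-vanishes alt G)) (+-identityˡ _)))
    low-degree-vanishes {n} alt (scl x F) =
      trans (SumV-cong n (λ v → solve 3 (λ a b c → a :* (b :* c) := b :* (a :* c)) refl _ _ _))
      (trans (SumV-* n x _) (trans (*-congˡ (low-degree-vanishes alt F)) (zeroʳ x)))
    low-degree-vanishes {n} alt (rsp e F) =
      trans (SumV-cong n (λ v → *-congˡ (sym (e _)))) (low-degree-vanishes alt F)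

    private
      alternating-* : ∀ {n} {ε δ : Vec (Fin m) n → Carrier} → Alternating {m} {n} ε → (∀ p v → δ (sw p v) ≈ δ v) →
                      Alternating {m} {n} (λ v → ε v * δ v)
      alternating-* alt inv p v p<n = trans (*-cong (alt p v p<n) (inv p v)) (sym (-‿distribˡ-* _ _))

      -- The degree is at most n - 1 + binom(n, 2), which is less than binom(n+1, 2).
      deg-mono-St : ∀ {n} (e : Vec ℕ (suc n)) → V.sum e < n →
                    Deg (binom₂ (suc n)) (λ z → mono z e * St z)
      deg-mono-St {n} e e<n = weaken
        (subst (_≤ n ℕ.+ binom₂ n) (≡.sym (ℕₚ.+-suc (V.sum e) (binom₂ n))) (ℕₚ.+-monoˡ-≤ (binom₂ n) e<n))
        (mul (mon e ℕₚ.≤-refl) (deg-St (λ z → z) deg-lookup))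

    -- The sum of all variables is symmetric and can be absorbed into the alternating weight; what
    -- remains has too low a degree.
    total-vanishes : ∀ {n} (e : Vec ℕ (suc n)) → V.sum e < n →
      SumV {m} (suc n) (λ v → E v * (mono (V.map y v) e * total (V.map y v) * St (V.map y v))) ≈ 0#
    total-vanishes {n} e e<n = trans
      (SumV-cong {m} (suc n) (λ v → solve 4 (λ a b c d → a :* (b :* c :* d) := a :* c :* (b :* d)) refl
        (E v) (mono (V.map y v) e) (total (V.map y v)) (St (V.map y v))))
      (low-degree-vanishes (alternating-* {δ = λ v → total (V.map y v)} E-alternating
        (λ p v → trans (reflexive (cong total (map-sw y p v))) (total-sw p (V.map y v)))) (deg-mono-St e e<n))

    -- After `St-cut`, the sum over the left block and the cross product are symmetric in each block
    -- and go into the weight; the rest is a function of one block times a function of the other.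
    relation-vanishes : ∀ {i k} (e : Vec ℕ (suc i)) (f : Vec ℕ (suc k)) → V.sum e ℕ.+ V.sum f < i ℕ.+ k →
      SumV {m} (suc i) (λ u → SumV (suc k) (λ v → E (u V.++ v) *
        (mono (V.map y u) e * mono (V.map y v) f
          * (total (V.map y u) * (q * V.last (V.map y u) - V.head (V.map y v)))
          * St (V.map y u V.++ V.map y v)))) ≈ 0#
    relation-vanishes {i} {k} e f ef< = trans (SumV-cong {m} (suc i) (λ u → SumV-cong {m} (suc k) (rearrange u))) main
      where
      ε : Vec (Fin m) (suc i) → Vec (Fin m) (suc k) → Carrier
      ε u v = E (u V.++ v) * (total (V.map y u) * cross (V.map y u) (V.map y v))
      F : Vec (Fin m) (suc i) → Carrier
      F u = mono (V.map y u) e * St (V.map y u)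
      G : Vec (Fin m) (suc k) → Carrier
      G v = mono (V.map y v) f * St (V.map y v)
      rearrange : ∀ u v → E (u V.++ v) * (mono (V.map y u) e * mono (V.map y v) f
          * (total (V.map y u) * (q * V.last (V.map y u) - V.head (V.map y v)))
          * St (V.map y u V.++ V.map y v)) ≈ ε u v * (F u * G v)
      rearrange u v = trans
        (solve 6 (λ a b b′ t x s → a :* (b :* b′ :* (t :* x) :* s) := a :* t :* b :* b′ :* (s :* x)) refl _ _ _ _ _ _)
        (trans (*-congˡ (St-cut (V.map y u) (V.map y v)))
        (solve 7 (λ a t b b′ x s s′ → a :* t :* b :* b′ :* (x :* (s :* s′)) := a :* (t :* x) :* (b :* s :* (b′ :* s′))) refl _ _ _ _ _ _ _))
      altˡ : ∀ v → Alternating (λ u → ε u v)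
      altˡ v p u p<i = trans (*-cong
        (trans (reflexive (cong E (≡.sym (sw-++ˡ p u v p<i))))
               (E-alternating p (u V.++ v) (ℕₚ.≤-trans p<i (ℕₚ.m≤m+n (suc i) (suc k)))))
        (trans (reflexive (cong (λ z → total z * cross z (V.map y v)) (map-sw y p u)))
          (*-cong (total-sw p (V.map y u)) (cross-swˡ p (V.map y u) (V.map y v)))))
        (sym (-‿distribˡ-* _ _))
      altʳ : ∀ u → Alternating (ε u)
      altʳ u p v p<k = trans (*-cong
        (trans (reflexive (cong E (≡.sym (sw-++ʳ p u v))))
               (E-alternating (suc i ℕ.+ p) (u V.++ v) (subst (_< suc i ℕ.+ suc k) (ℕₚ.+-suc (suc i) p) (ℕₚ.+-monoʳ-< (suc i) p<k))))
        (*-congˡ (trans (reflexive (cong (cross (V.map y u)) (map-sw y p v))) (cross-swʳ p (V.map y u) (V.map y v)))))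
        (sym (-‿distribˡ-* _ _))
      main : SumV (suc i) (λ u → SumV (suc k) (λ v → ε u v * (F u * G v))) ≈ 0#
      -- The blocks have i + 1 and k + 1 variables. Since the two degrees sum to less than i + k,
      -- either the first is below i or the second is below k, and that block alone kills the sum.
      main with V.sum e <? i
      ... | yes e<i = trans (SumV-swap {m} (suc i) (suc k) (λ u v → ε u v * (F u * G v))) (SumV-0 {m} (suc k) (λ v → trans
        (trans (SumV-cong {m} (suc i) (λ u → solve 3 (λ a b c → a :* (b :* c) := c :* (a :* b)) refl (ε u v) (F u) (G v)))
          (SumV-* {m} (suc i) (G v) (λ u → ε u v * F u)))
        (trans (*-congˡ (low-degree-vanishes (altˡ v) (deg-mono-St e e<i))) (zeroʳ _))))
      ... | no  e≮i = SumV-0 {m} (suc i) (λ u → trans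
        (trans (SumV-cong {m} (suc k) (λ v → solve 3 (λ a b c → a :* (b :* c) := b :* (a :* c)) refl (ε u v) (F u) (G v)))
          (SumV-* {m} (suc k) (F u) (λ v → ε u v * G v)))
        (trans (*-congˡ (low-degree-vanishes (altʳ u) (deg-mono-St f f<k))) (zeroʳ _)))
        where
        f<k : V.sum f < k
        f<k = ℕₚ.+-cancelˡ-< i _ _ (ℕₚ.≤-<-trans (ℕₚ.+-monoˡ-≤ (V.sum f) (ℕₚ.≮⇒≥ e≮i)) ef<)

    -- The two products differ by a function of degree less than n; times the staircase, of degree
    -- binom(n, 2), this is still below binom(n+1, 2).
    replace-constant : ∀ n α →
      SumV {m} (suc n) (λ w → E w * (L α (V.tail (V.map y w)) * St (V.map y w))) ≈
      SumV {m} (suc n) (λ w → E w * (L 0# (V.tail (V.map y w)) * St (V.map y w)))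
    replace-constant n α = begin
      SumV (suc n) (λ w → E w * (L α (V.tail (V.map y w)) * St (V.map y w)))
        ≈⟨ SumV-cong {m} (suc n) (λ w → solve 4 (λ e l l₀ s → e :* (l :* s) := e :* (l₀ :* s) :+ e :* ((l :- l₀) :* s)) refl
             (E w) (L α (V.tail (V.map y w))) (L 0# (V.tail (V.map y w))) (St (V.map y w))) ⟩
      SumV (suc n) (λ w → E w * (L 0# (V.tail (V.map y w)) * St (V.map y w)) + E w * difference (V.map y w))
        ≈⟨ SumV-+ {m} (suc n) (λ w → E w * (L 0# (V.tail (V.map y w)) * St (V.map y w)))
             (λ w → E w * difference (V.map y w)) ⟩
      _ ≈⟨ +-congˡ (low-degree-vanishes E-alternating deg-difference) ⟩
      _ ≈⟨ +-identityʳ _ ⟩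
      _ ∎
      where
      difference : Vec Carrier (suc n) → Carrier
      difference z = (L α (V.tail z) - L 0# (V.tail z)) * St z
      deg-difference : Deg (binom₂ (suc n)) difference
      deg-difference = rsp (λ z → *-comm _ _) (weaken (ℕₚ.≤-reflexive (ℕₚ.+-comm (binom₂ n) n))
        (mul (deg-St (λ z → z) deg-lookup)
             (deg-L-difference V.tail α (coordinates-tail (λ z → z) deg-lookup))))

  -- The factor vanishes as soon as some entry is `F.zero`, so only vectors avoiding that index
  -- remain.
  restrict : ∀ {m} (y : Fin (suc m) → Carrier) n (ψ : Vec (Fin (suc m)) n → Carrier) →
    SumV n (λ v → L (y F.zero) (V.map y v) * ψ v) ≈
    SumV n (λ v → L (y F.zero) (V.map (y ∘ F.suc) v) * ψ (V.map F.suc v))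
  restrict y zero    ψ = refl
  restrict {m} y (suc n) ψ = trans (reflexive (∑-allFin m _)) (trans
    (+-cong (SumV-0 n (λ v → solve 3 (λ a l p → (a :- a) :* l :* p := con (+ 0)) refl _ _ _))
      (∑-cong (allFin m) (λ a → trans (SumV-cong n (λ v → solve 3 (λ d l p → d :* l :* p := l :* (d :* p)) refl _ _ _))
        (trans (restrict y n (λ v → (y F.zero - y (F.suc a)) * ψ (F.suc a ∷ v)))
          (SumV-cong n (λ v → solve 3 (λ d l p → l :* (d :* p) := d :* l :* p) refl _ _ _))))))
    (+-identityˡ _))

  private
    open import Algebra.Properties.CommutativeMonoid.Sum *-commutativeMonoid as Prod using (sum; sum-remove)

    -- The monoid is multiplicative, so `sum` denotes a product.
    L-tabulate : ∀ {n} α (y : Fin n → Carrier) → L α (V.tabulate y) ≈ sum (λ i → α - y i)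
    L-tabulate {zero}  α y = refl
    L-tabulate {suc n} α y = *-congˡ (L-tabulate α (y ∘ F.suc))

    L-map-lookup : ∀ {m n} α (y : Fin m → Carrier) (v : Vec (Fin m) n) →
      L α (V.map y v) ≈ sum (λ i → α - y (V.lookup v i))
    L-map-lookup α y []      = refl
    L-map-lookup α y (a ∷ v) = *-congˡ (L-map-lookup α y v)

    -- An injective self-map of a finite set is a bijection: the factor at `w F.zero` is split off
    -- and the other indices are renumbered around it.
    sum-injective : ∀ {n} (g : Fin n → Carrier) (w : Fin n → Fin n) → (∀ {i j} → w i ≡ w j → i ≡ j) →
      sum (g ∘ w) ≈ sum g
    sum-injective {zero}  g w inj = refl
    sum-injective {suc n} g w inj = begin
      g (w F.zero) * sum (g ∘ w ∘ F.suc)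
        ≈⟨ *-congˡ (reflexive (Prod.sum-cong-≗ (λ j → cong g (≡.sym (Fₚ.punchIn-punchOut (w0≢ j)))))) ⟩
      g (w F.zero) * sum (g′ ∘ w′)
        ≈⟨ *-congˡ (sum-injective g′ w′ (λ eq → Fₚ.suc-injective (inj (Fₚ.punchOut-injective (w0≢ _) (w0≢ _) eq)))) ⟩
      g (w F.zero) * sum g′
        ≈⟨ sum-remove {i = w F.zero} g ⟨
      sum g ∎
      where
      w0≢ : ∀ j → ¬ (w F.zero ≡ w (F.suc j))
      w0≢ j eq with () ← inj eq
      g′ = g ∘ F.punchIn (w F.zero)
      w′ : Fin n → Fin n
      w′ j = F.punchOut (w0≢ j)

  -- If E v is nonzero then v is a permutation, so it does not affect a symmetric product.
  L-E : ∀ {n} α (y : Fin n → Carrier) (v : Vec (Fin n) n) → L α (V.map y v) * E v ≈ L α (V.tabulate y) * E v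
  L-E α y v with repeats? v
  ... | inj₁ rep = trans (*-congˡ (E-repeats v rep)) (trans (zeroʳ _) (sym (trans (*-congˡ (E-repeats v rep)) (zeroʳ _))))
  ... | inj₂ inj = *-congʳ (trans (L-map-lookup α y v)
    (trans (sum-injective (λ i → α - y i) (V.lookup v) inj) (sym (L-tabulate α y))))

  -- Since lower degree terms die, ∏ (0 − z_j) may be traded for ∏ (y₀ − z_j), which kills every
  -- permutation not sending the first position to y₀.
  staircase-normalization : ∀ n (y : Fin (suc n) → Carrier) →
    SumV (suc n) (λ w → E w * (L 0# (V.tail (V.map y w)) * St (V.map y w))) ≈ Δ (V.tabulate y)
  staircase-normalization n y = begin
    SumV (suc n) (λ w → E w * (L 0# (V.tail (V.map y w)) * St (V.map y w)))
      ≈⟨ replace-constant y n y₀ ⟨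
    ∑ (allFin (suc n)) (λ a → SumV n (λ v → E (a ∷ v) * (L y₀ (V.map y v) * St (y a ∷ V.map y v))))
      ≈⟨ ∑-cong (allFin (suc n)) (λ a → trans
           (SumV-cong n (λ v → solve 3 (λ e l s → e :* (l :* s) := l :* (e :* s)) refl _ _ _))
           (restrict y n (λ v → E (a ∷ v) * St (y a ∷ V.map y v)))) ⟩
    ∑ (allFin (suc n)) summand
      ≡⟨ ∑-allFin n summand ⟩
    summand F.zero + ∑ (allFin n) (summand ∘ F.suc)
      ≈⟨ +-cong first (∑-0 (allFin n) others-vanish) ⟩
    L y₀ (V.tabulate y′) * SumV n (λ v → E v * St (y₀ ∷ V.map y′ v)) + 0#
      ≈⟨ +-identityʳ _ ⟩
    L y₀ (V.tabulate y′) * SumV n (λ v → E v * St (y₀ ∷ V.map y′ v))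
      ≈⟨ *-congˡ (recurse n y′) ⟩
    L y₀ (V.tabulate y′) * Δ (V.tabulate y′) ∎
    where
    y₀ = y F.zero
    y′ = y ∘ F.suc
    summand : Fin (suc n) → Carrier
    summand a = SumV n (λ v → L y₀ (V.map y′ v) * (E (a ∷ V.map F.suc v) * St (y a ∷ V.map y (V.map F.suc v))))
    map-∘ : ∀ {k} (v : Vec (Fin n) k) → V.map y (V.map F.suc v) ≡ V.map y′ v
    map-∘ v = ≡.sym (Vₚ.map-∘ y F.suc v)
    first : summand F.zero ≈ L y₀ (V.tabulate y′) * SumV n (λ v → E v * St (y₀ ∷ V.map y′ v))
    first = trans (SumV-cong n (λ v → begin
      L y₀ (V.map y′ v) * (row F.zero (V.map F.suc v) * E (V.map F.suc v) * St (y₀ ∷ V.map y (V.map F.suc v)))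
        ≈⟨ *-congˡ (*-cong (trans (*-cong (row-zero-map-suc v) (E-map-suc v)) (*-identityˡ _))
             (reflexive (cong (λ z → St (y₀ ∷ z)) (map-∘ v)))) ⟩
      L y₀ (V.map y′ v) * (E v * St (y₀ ∷ V.map y′ v))
        ≈⟨ *-assoc _ _ _ ⟨
      L y₀ (V.map y′ v) * E v * St (y₀ ∷ V.map y′ v)
        ≈⟨ *-congʳ (L-E y₀ y′ v) ⟩
      L y₀ (V.tabulate y′) * E v * St (y₀ ∷ V.map y′ v)
        ≈⟨ *-assoc _ _ _ ⟩
      L y₀ (V.tabulate y′) * (E v * St (y₀ ∷ V.map y′ v)) ∎)) (SumV-* n _ _)
    -- Once index 0 is excluded, n + 1 positions share n indices, so no injective map is left.
    others-vanish : ∀ a → summand (F.suc a) ≈ 0#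
    others-vanish a = SumV-0 n (λ v → trans (*-congˡ (trans
      (*-congʳ (trans (E-map-suc (a ∷ v)) (E-long (a ∷ v) (ℕₚ.n<1+n n)))) (zeroˡ _))) (zeroʳ _))
    -- With y₀ in front, the next factor of the staircase is a product of q y₀ - z_j. Trading the
    -- constant q y₀ for 0 reproduces the original sum with one variable fewer.
    recurse : ∀ n (y′ : Fin n → Carrier) → SumV n (λ v → E v * St (y₀ ∷ V.map y′ v)) ≈ Δ (V.tabulate y′)
    recurse zero    y′ = *-identityˡ 1#
    recurse (suc n) y′ = trans
      (∑-cong (allFin (suc n)) (λ b → SumV-cong n (λ v → refl)))
      (trans (replace-constant y′ n (q * y₀)) (staircase-normalization n y′))

  nth : ∀ {n} → Vec Carrier n → ℕ → Carrier
  nth []      j       = 0#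
  nth (a ∷ z) zero    = a
  nth (a ∷ z) (suc j) = nth z j

  -- The image of u_i under evaluation at `z`. As `nth` is 0 out of range, it stays at the total sum
  -- once all variables are included.
  prefix : ∀ {n} → Vec Carrier n → ℕ → Carrier
  prefix z zero    = 0#
  prefix z (suc i) = prefix z i + nth z i

  -- The image of `tail-product` under evaluation at `z`.
  window : ∀ {n} → Vec Carrier n → ℕ → ℕ → Carrier
  window z i zero    = 1#
  window z i (suc k) = (0# - nth z i) * window z (suc i) k

  prefix-∷ : ∀ {n} a (z : Vec Carrier n) i → prefix (a ∷ z) (suc i) ≈ a + prefix z i
  prefix-∷ a z zero    = +-comm 0# a
  prefix-∷ a z (suc i) = trans (+-congʳ (prefix-∷ a z i)) (+-assoc _ _ _)

  prefix-large : ∀ {n} (z : Vec Carrier n) i → n ≤ i → prefix z i ≈ total z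
  prefix-large []      zero    n≤i         = refl
  prefix-large []      (suc i) n≤i         = trans (+-identityʳ _) (prefix-large [] i z≤n)
  prefix-large (a ∷ z) (suc i) (s≤s n≤i) = trans (prefix-∷ a z i) (+-congˡ (prefix-large z i n≤i))

  prefix-++ : ∀ {i k} (u : Vec Carrier i) (v : Vec Carrier k) → prefix (u V.++ v) i ≈ total u
  prefix-++ []      v = refl
  prefix-++ {suc i} (a ∷ u) v = trans (prefix-∷ a (u V.++ v) i) (+-congˡ (prefix-++ u v))

  nth-head : ∀ {i k} (u : Vec Carrier i) (v : Vec Carrier (suc k)) → nth (u V.++ v) i ≡ V.head v
  nth-head []      (b ∷ v) = ≡.refl
  nth-head (a ∷ u) v       = nth-head u v

  nth-last : ∀ {i k} (u : Vec Carrier (suc i)) (v : Vec Carrier k) → nth (u V.++ v) i ≡ V.last u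
  nth-last (a ∷ [])     v = ≡.refl
  nth-last (a ∷ a′ ∷ u) v = nth-last (a′ ∷ u) v

  window-∷ : ∀ {n} a (z : Vec Carrier n) i k → window (a ∷ z) (suc i) k ≡ window z i k
  window-∷ a z i zero    = ≡.refl
  window-∷ a z i (suc k) = cong ((0# - nth z i) *_) (window-∷ a z (suc i) k)

  window-all : ∀ {n} (z : Vec Carrier n) → window z 0 n ≡ L 0# z
  window-all []      = ≡.refl
  window-all {suc n} (a ∷ z) = cong ((0# - a) *_) (≡.trans (window-∷ a z 0 n) (window-all z))

  module _ {m : ℕ} (y : Fin m → Carrier) where

    prefix-vanishes : ∀ {n} i (e : Vec ℕ n) → n ≤ i → suc (V.sum e) < n →
      SumV {m} n (λ v → E v * (mono (V.map y v) e * prefix (V.map y v) i * St (V.map y v))) ≈ 0#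
    prefix-vanishes {suc n} i e n≤i (s≤s e<n) = trans
      (SumV-cong {m} (suc n) (λ v → *-congˡ {x = E v} (*-congʳ {x = St (V.map y v)} (*-congˡ {x = mono (V.map y v) e} (prefix-large (V.map y v) i n≤i)))))
      (total-vanishes y e e<n)

    -- Cut after i + 1 positions, so that the prefix is the total of the left block. The relation
    -- here is the negative of the factor q x_i - x_{i+1} used in `relation-vanishes`, whence -1.
    cut-vanishes : ∀ {n} i k → n ≡ suc i ℕ.+ suc k → (e : Vec ℕ n) → suc (suc (V.sum e)) < n →
      SumV {m} n (λ w → E w * (mono (V.map y w) e
        * (prefix (V.map y w) (suc i) * nth (V.map y w) (suc i) - q * (prefix (V.map y w) (suc i) * nth (V.map y w) i))
        * St (V.map y w))) ≈ 0#
    cut-vanishes i k ≡.refl e e< with V.splitAt (suc i) e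
    ... | e₁ , e₂ , ≡.refl = trans (SumV-++ {m} (suc i) (suc k) (λ w → E w * body (V.map y w))) (trans
      (SumV-cong {m} (suc i) (λ u → trans (SumV-cong {m} (suc k) (term u)) (SumV-* {m} (suc k) (- 1#) (negated u))))
      (trans (SumV-* {m} (suc i) (- 1#) (λ u → SumV (suc k) (negated u)))
        (trans (*-congˡ (relation-vanishes y e₁ e₂ small)) (zeroʳ _))))
      where
      small : V.sum e₁ ℕ.+ V.sum e₂ < i ℕ.+ k
      small = ℕₚ.+-cancelˡ-< 2 _ _ (≡.subst₂ (λ a b → suc (suc a) < suc b) (Vₚ.sum-++ e₁) (ℕₚ.+-suc i k) e<)
      negated : Vec (Fin m) (suc i) → Vec (Fin m) (suc k) → Carrier
      negated u v = E (u V.++ v) * (mono (V.map y u) e₁ * mono (V.map y v) e₂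
        * (total (V.map y u) * (q * V.last (V.map y u) - V.head (V.map y v))) * St (V.map y u V.++ V.map y v))
      body : Vec Carrier (suc i ℕ.+ suc k) → Carrier
      body z = mono z (e₁ V.++ e₂) * (prefix z (suc i) * nth z (suc i) - q * (prefix z (suc i) * nth z i)) * St z
      term : ∀ u v → E (u V.++ v) * body (V.map y (u V.++ v)) ≈ - 1# * negated u v
      term u v = trans (*-congˡ (trans (reflexive (cong body (Vₚ.map-++ y u v)))
        (*-congʳ (*-cong (mono-++ z₁ z₂ e₁ e₂) (+-cong (*-cong (prefix-++ z₁ z₂) (reflexive (nth-head z₁ z₂)))
          (-‿cong (*-congˡ (*-cong (prefix-++ z₁ z₂) (reflexive (nth-last z₁ z₂))))))))))
        (solve 7 (λ a b t h q l s → a :* (b :* (t :* h :- q :* (t :* l)) :* s) := :- con (+ 1) :* (a :* (b :* (t :* (q :* l :- h)) :* s)))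
          refl _ _ _ _ _ _ _)
        where
        z₁ = V.map y u
        z₂ = V.map y v

    SumV-linear : ∀ n {a} {A : Set a} (ts : List A) (b : A → Carrier) (φ : A → Vec (Fin m) n → Carrier) (s : Vec (Fin m) n → Carrier) →
      SumV n (λ v → E v * (∑ ts (λ t → b t * φ t v) * s v)) ≈ ∑ ts (λ t → b t * SumV n (λ v → E v * (φ t v * s v)))
    SumV-linear n ts b φ s = trans
      (SumV-cong n (λ v → trans (*-congˡ (∑-distribʳ (s v) ts _)) (∑-distribˡ (E v) ts _)))
      (trans (SumV-∑ n ts _) (∑-cong ts (λ t → trans
        (SumV-cong n (λ v → solve 4 (λ e b p s → e :* (b :* p :* s) := b :* (e :* (p :* s))) refl (E v) (b t) (φ t v) (s v)))
        (SumV-* n (b t) _))))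

  window-normalization : ∀ {n} r → n ≡ suc r → (y : Fin n → Carrier) →
    SumV n (λ w → E w * (window (V.map y w) 1 r * St (V.map y w))) ≈ Δ (V.tabulate y)
  window-normalization r ≡.refl y = trans
    (SumV-cong (suc r) {λ w → E w * (window (V.map y w) 1 r * St (V.map y w))}
      {λ w → E w * (L 0# (V.tail (V.map y w)) * St (V.map y w))} (λ { (a ∷ w) → *-congˡ {x = E (a ∷ w)} (*-congʳ (reflexive
      (≡.trans (window-∷ (y a) (V.map y w) 0 r) (window-all (V.map y w))))) }))
    (staircase-normalization r y)

-- Products over pairs of indices, signs, and the antisymmetrization operator

module PairProducts {c ℓ : Level} (R : CommutativeRing c ℓ) (q : CommutativeRing.Carrier R)
  (2-cancel : RingLemmas.2-Cancellable R) where
  open CommutativeRing R hiding (zero)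
  open RingLemmas R
  open Alternants R q 2-cancel
  open SetoidReasoning setoid

  ∏∏ : ∀ n → (Fin n → Fin n → Carrier) → Carrier
  ∏∏ n F = ∏ (allFin n) (λ i → ∏ (allFin n) (F i))

  ∏∏-cong : ∀ n {F G} → (∀ i j → F i j ≈ G i j) → ∏∏ n F ≈ ∏∏ n G
  ∏∏-cong n e = ∏-cong (allFin n) (λ i → ∏-cong (allFin n) (e i))

  ∏∏-suc : ∀ n F → ∏∏ (suc n) F ≈
    (F F.zero F.zero * ∏ (allFin n) (λ j → F F.zero (F.suc j))) *
    (∏ (allFin n) (λ i → F (F.suc i) F.zero) * ∏∏ n (λ i j → F (F.suc i) (F.suc j)))
  ∏∏-suc n F = trans (reflexive (∏-allFin n _)) (*-cong (reflexive (∏-allFin n (F F.zero)))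
    (trans (∏-cong (allFin n) (λ i → reflexive (∏-allFin n (F (F.suc i))))) (∏-* (allFin n) _ _)))

  ∏-pairs : ∀ n (P : Fin n × Fin n → Bool) (F : Fin n × Fin n → Carrier) →
    ∏ (filterᵇ P (pairs n)) F ≈ ∏∏ n (λ i j → if P (i , j) then F (i , j) else 1#)
  ∏-pairs n P F = trans (∏-filter P (pairs n) F) (∏-cartesianProduct (allFin n) (allFin n) _)

  ∏-lookup : ∀ {n} α (z : Vec Carrier n) → ∏ (allFin n) (λ j → α - V.lookup z j) ≈ L α z
  ∏-lookup α []      = refl
  ∏-lookup {suc n} α (b ∷ z) = trans (reflexive (∏-allFin n _)) (*-congˡ (∏-lookup α z))

  Δ-pairs : ∀ {n} (z : Vec Carrier n) →
    ∏∏ n (λ i j → if F.toℕ i <ᵇ F.toℕ j then V.lookup z i - V.lookup z j else 1#) ≈ Δ z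
  Δ-pairs [] = refl
  Δ-pairs {suc n} (a ∷ z) = trans (∏∏-suc n _) (*-cong
    (trans (*-identityˡ _) (∏-lookup a z))
    (trans (*-cong (∏-1 (allFin n) (λ _ → refl)) (Δ-pairs z)) (*-identityˡ _)))

  St-pairs : ∀ {n} (z : Vec Carrier n) →
    ∏∏ n (λ i j → if suc (F.toℕ i) <ᵇ F.toℕ j then q * V.lookup z i - V.lookup z j else 1#) ≈ St z
  St-pairs [] = refl
  St-pairs {suc n} (a ∷ z) = trans (∏∏-suc n _) (trans
    (*-cong (*-identityˡ _) (trans (*-cong (∏-1 (allFin n) (λ _ → refl)) (St-pairs z)) (*-identityˡ _)))
    (first-row z))
    where
    first-row : ∀ {n} (z : Vec Carrier n) →
      ∏ (allFin n) (λ j → if 0 <ᵇ F.toℕ j then q * a - V.lookup z j else 1#) * St z ≈ St (a ∷ z)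
    first-row [] = *-identityˡ 1#
    first-row {suc n} (b ∷ z) = *-congʳ (trans (reflexive (∏-allFin n _)) (trans (*-identityˡ _) (∏-lookup (q * a) z)))

  sign : ℕ → Carrier
  sign zero    = 1#
  sign (suc k) = - sign k

  module _ {a} {A : Set a} where

    sign-filter : ∀ (P : A → Bool) xs →
      sign (L.length (filterᵇ P xs)) ≈ ∏ xs (λ x → if P x then - 1# else 1#)
    sign-filter P [] = refl
    sign-filter P (x ∷ xs) with P x
    ... | true  = trans (-‿cong (sign-filter P xs)) (solve 1 (λ p → :- p := :- con (+ 1) :* p) refl _)
    ... | false = trans (sign-filter P xs) (sym (*-identityˡ _))

    all-∏ : ∀ (P : A → Bool) xs x →
      (if allᵇ P xs then x else 0#) ≈ ∏ xs (λ y → if P y then 1# else 0#) * x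
    all-∏ P [] x = sym (*-identityˡ x)
    all-∏ P (y ∷ xs) x with P y
    ... | true  = trans (all-∏ P xs x) (*-congʳ (sym (*-identityˡ _)))
    ... | false = sym (trans (*-congʳ (zeroˡ _)) (zeroˡ x))

  private
    distinct inverted : ∀ {n m} → (Fin n → Fin m) → Fin n → Fin n → Bool
    distinct w i j = ⌊ i F.≟ j ⌋ ∨ not ⌊ w i F.≟ w j ⌋
    inverted w i j = (F.toℕ i <ᵇ F.toℕ j) ∧ (F.toℕ (w j) <ᵇ F.toℕ (w i))

    factor : ∀ {n m} → (Fin n → Fin m) → Fin n → Fin n → Carrier
    factor w i j = (if distinct w i j then 1# else 0#) * (if inverted w i j then - 1# else 1#)

    ≟-suc : ∀ {n} (i j : Fin n) → ⌊ F.suc i F.≟ F.suc j ⌋ ≡ ⌊ i F.≟ j ⌋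
    ≟-suc i j with i F.≟ j
    ... | yes _ = ≡.refl
    ... | no  _ = ≡.refl

    sg-factor : ∀ {m} (a b : Fin m) →
      (if not ⌊ a F.≟ b ⌋ then 1# else 0#) * (if F.toℕ b <ᵇ F.toℕ a then - 1# else 1#) ≈ sg a b
    sg-factor F.zero    F.zero    = zeroˡ _
    sg-factor F.zero    (F.suc b) = *-identityˡ _
    sg-factor (F.suc a) F.zero    = *-identityˡ _
    sg-factor (F.suc a) (F.suc b) = trans
      (*-congʳ (reflexive (cong (λ x → if not x then 1# else 0#) (≟-suc a b)))) (sg-factor a b)

    sg-distinct : ∀ {m} (a b : Fin m) → sg a b * (if not ⌊ b F.≟ a ⌋ then 1# else 0#) ≈ sg a b
    sg-distinct F.zero    F.zero    = zeroˡ _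
    sg-distinct F.zero    (F.suc b) = *-identityʳ _
    sg-distinct (F.suc a) F.zero    = *-identityʳ _
    sg-distinct (F.suc a) (F.suc b) = trans
      (*-congˡ (reflexive (cong (λ x → if not x then 1# else 0#) (≟-suc b a)))) (sg-distinct a b)

    row-tabulate : ∀ {n m} a (w : Fin n → Fin m) → ∏ (allFin n) (λ j → sg a (w j)) ≈ row a (V.tabulate w)
    row-tabulate {zero}  a w = refl
    row-tabulate {suc n} a w = trans (reflexive (∏-allFin n _)) (*-congˡ (row-tabulate a (w ∘ F.suc)))

    -- Every pair of positions occurs in both orders. The increasing order carries the sign; the
    -- other one only repeats the test for distinctness, which `sg-distinct` absorbs.
    factor-E : ∀ {n m} (w : Fin n → Fin m) → ∏∏ n (factor w) ≈ E (V.tabulate w)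
    factor-E {zero}  w = refl
    factor-E {suc n} w = begin
      ∏∏ (suc n) (factor w)
        ≈⟨ ∏∏-suc n (factor w) ⟩
      (1# * 1# * ∏ (allFin n) (λ j → factor w F.zero (F.suc j))) *
      (∏ (allFin n) (λ i → factor w (F.suc i) F.zero) * ∏∏ n (λ i j → factor w (F.suc i) (F.suc j)))
        ≈⟨ *-cong (trans (*-cong (*-identityˡ 1#) (∏-cong (allFin n) (λ j → sg-factor (w F.zero) (w (F.suc j))))) (*-identityˡ _))
             (*-cong (∏-cong (allFin n) (λ i → *-identityʳ _))
               (trans (∏∏-cong n (λ i j → *-congʳ (reflexive (cong (λ x → if x ∨ not ⌊ w (F.suc i) F.≟ w (F.suc j) ⌋ then 1# else 0#) (≟-suc i j)))))
                 (factor-E (w ∘ F.suc)))) ⟩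
      ∏ (allFin n) (λ j → sg (w F.zero) (w (F.suc j))) *
      (∏ (allFin n) (λ i → if not ⌊ w (F.suc i) F.≟ w F.zero ⌋ then 1# else 0#) * E (V.tabulate (w ∘ F.suc)))
        ≈⟨ *-assoc _ _ _ ⟨
      _ ≈⟨ *-congʳ (∏-* (allFin n) _ _) ⟨
      _ ≈⟨ *-congʳ (trans (∏-cong (allFin n) (λ j → sg-distinct (w F.zero) (w (F.suc j)))) (row-tabulate (w F.zero) (w ∘ F.suc))) ⟩
      E (V.tabulate w) ∎

  sign-E : ∀ {n} (w : Fin n → Fin n) →
    (if isPerm w then sign (inversions w) else 0#) ≈ E (V.tabulate w)
  sign-E {n} w = begin
    (if isPerm w then sign (inversions w) else 0#)
      ≈⟨ all-∏ (λ ij → distinct w (proj₁ ij) (proj₂ ij)) (pairs n) _ ⟩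
    ∏ (pairs n) (λ ij → if distinct w (proj₁ ij) (proj₂ ij) then 1# else 0#) * sign (inversions w)
      ≈⟨ *-congˡ (sign-filter (λ ij → inverted w (proj₁ ij) (proj₂ ij)) (pairs n)) ⟩
    _ ≈⟨ ∏-* (pairs n) _ _ ⟨
    ∏ (pairs n) (λ ij → factor w (proj₁ ij) (proj₂ ij))
      ≈⟨ ∏-cartesianProduct (allFin n) (allFin n) _ ⟩
    ∏∏ n (factor w)
      ≈⟨ factor-E w ⟩
    E (V.tabulate w) ∎

  ∑-allFuns : ∀ n m (φ : Vec (Fin m) n → Carrier) → ∑ (allFuns n m) (φ ∘ V.tabulate) ≈ SumV n φ
  ∑-allFuns zero    m φ = +-identityʳ _
  ∑-allFuns (suc n) m φ = trans (∑-concatMap _ (allFin m) (φ ∘ V.tabulate))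
    (∑-cong (allFin m) (λ a → trans (reflexive (∑-map _ (allFuns n m) (φ ∘ V.tabulate))) (∑-allFuns n m (λ v → φ (a ∷ v)))))

module Antisymmetrization {c ℓ : Level} (K : Field c ℓ) (q : Field.Carrier K)
  (2-cancelᴷ : RingLemmas.2-Cancellable (Field.cring K)) where
  open Field K hiding (zero)
  open Polynomials K

  2-cancel : ∀ {n} (p : Poly n) → p +ₚ p ≋ 0ₚ → p ≋ 0ₚ
  2-cancel p (mk e) = mk λ d → 2-cancelᴷ _ (trans (sym (coeff-+ p p d)) (e d))

  module _ {n : ℕ} where
    private
      module P = CommutativeRing (polyRing {n})
    open RingLemmas (polyRing {n})
    open Alternants (polyRing {n}) (constₚ q) 2-cancel public
    open PairProducts (polyRing {n}) (constₚ q) 2-cancel public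
    open LP {n} public
    open SetoidReasoning P.setoid

    𝒜 : (Vec (Poly n) n → Poly n) → Poly n
    𝒜 G = SumV n (λ v → E v *ₚ G (V.map var v))

    scaleₚ≋ : ∀ a (p : Poly n) → scaleₚ a p ≋ constₚ a *ₚ p
    scaleₚ≋ a p = mk λ e → K.trans
      (K.reflexive (KL.∑-map _ p (at e)))
      (K.sym (K.trans (LK.∑-product (constₚ a) p (at e)) (K.trans (K.+-identityʳ _)
        (KL.∑-cong p (λ t → K.reflexive (cong (λ d → at e (a K.* proj₁ t , d))
          (Vₚ.zipWith-identityˡ ℕₚ.+-identityˡ (proj₂ t))))))))
      where
      module K = CommutativeRing cring
      module KL = RingLemmas cring
      module LK = Linear cring id ring-id

    signK≋ : ∀ k → constₚ (signK k) ≋ sign k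
    signK≋ zero    = P.refl
    signK≋ (suc k) = P.trans (ι-neg (signK k)) (P.-‿cong (signK≋ k))

    -- The filter on permutations is replaced by the weight `E`, which is zero on the remaining
    -- maps.
    antisym≋𝒜 : ∀ g → antisym n g ≋ 𝒜 (λ z → ev z g)
    antisym≋𝒜 g = begin
      antisym n g
        ≈⟨ ∑-filter isPerm (allFuns n n) _ ⟩
      ∑ (allFuns n n) (λ w → if isPerm w then term w else 0ₚ)
        ≈⟨ ∑-cong (allFuns n n) summand ⟩
      ∑ (allFuns n n) ((λ v → E v *ₚ ev (V.map var v) g) ∘ V.tabulate)
        ≈⟨ ∑-allFuns n n _ ⟩
      𝒜 (λ z → ev z g) ∎
      where
      term : (Fin n → Fin n) → Poly n
      term w = scaleₚ (sgn w) (substₚ (λ i → var (w i)) g)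
      if-* : ∀ b (x y : Poly n) → (if b then x *ₚ y else 0ₚ) ≋ (if b then x else 0ₚ) *ₚ y
      if-* true  x y = P.refl
      if-* false x y = P.refl
      if-cong : ∀ b {x y : Poly n} → x ≋ y → (if b then x else 0ₚ) ≋ (if b then y else 0ₚ)
      if-cong true  e = e
      if-cong false e = P.refl
      summand : ∀ w → (if isPerm w then term w else 0ₚ) ≋ E (V.tabulate w) *ₚ ev (V.map var (V.tabulate w)) g
      summand w = begin
        (if isPerm w then term w else 0ₚ)
          ≈⟨ if-cong (isPerm w) (P.trans (scaleₚ≋ (sgn w) _) (P.*-cong (signK≋ (inversions w))
               (P.trans (substₚ≋ev (λ i → var (w i)) g) (P.reflexive (cong (λ z → ev z g) (Vₚ.tabulate-∘ var w)))))) ⟩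
        (if isPerm w then sign (inversions w) *ₚ ev (V.map var (V.tabulate w)) g else 0ₚ)
          ≈⟨ if-* (isPerm w) _ _ ⟩
        (if isPerm w then sign (inversions w) else 0ₚ) *ₚ ev (V.map var (V.tabulate w)) g
          ≈⟨ P.*-congʳ (sign-E w) ⟩
        _ ∎

    ev-stair : ∀ z → ev z (stairₚ q n) ≋ St z
    ev-stair z = P.trans (ev-prod z (filterᵇ _ (pairs n)) _) (P.trans
      (∏-cong (filterᵇ _ (pairs n)) (λ ij → P.trans (ev-minus z (constₚ q *ₚ var (proj₁ ij)) (var (proj₂ ij)))
        (P.+-cong (P.trans (ev-* z (constₚ q) (var (proj₁ ij))) (P.*-cong (ev-const z q) (ev-var z (proj₁ ij))))
                  (P.-‿cong (ev-var z (proj₂ ij))))))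
      (P.trans (∏-pairs n _ _) (St-pairs z)))

    vandermonde≋Δ : vandermonde n ≋ Δ (V.tabulate var)
    vandermonde≋Δ = P.trans (∏-pairs n _ _) (P.trans
      (∏∏-cong n (λ i j → if-cong (F.toℕ i <ᵇ F.toℕ j) (lookup≡ i j))) (Δ-pairs (V.tabulate var)))
      where
      if-cong : ∀ b {x y : Poly n} → x ≋ y → (if b then x else 1ₚ) ≋ (if b then y else 1ₚ)
      if-cong true  e = e
      if-cong false e = P.refl
      lookup≡ : ∀ i j → var i -ₚ var j ≋ V.lookup (V.tabulate var) i -ₚ V.lookup (V.tabulate var) j
      lookup≡ i j = P.reflexive (≡.sym (≡.cong₂ _-ₚ_ (Vₚ.lookup∘tabulate var i) (Vₚ.lookup∘tabulate var j)))

-- Quotient rings and naturality of evaluation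

module Quotient {c ℓ i : Level} (R : CommutativeRing c ℓ) (I : CommutativeRing.Carrier R → Set i)
  (I-resp : ∀ {x y} → CommutativeRing._≈_ R x y → I x → I y)
  (I-0 : I (CommutativeRing.0# R))
  (I-+ : ∀ {x y} → I x → I y → I (CommutativeRing._+_ R x y))
  (I-* : ∀ r {x} → I x → I (CommutativeRing._*_ R r x)) where
  open CommutativeRing R
  open RingLemmas R

  record _~_ (x y : Carrier) : Set i where
    constructor mod
    field difference : I (x - y)
  open _~_ public

  embed : ∀ {x y} → x ≈ y → x ~ y
  embed {x} {y} e = mod (I-resp (sym (trans (+-congʳ e) (-‿inverseʳ y))) I-0)

  -- Only the equality changes; carrier and operations are kept, so the projection is `id`.
  quotient : CommutativeRing c i
  quotient = record
    { Carrier = Carrier ; _≈_ = _~_ ; _+_ = _+_ ; _*_ = _*_ ; -_ = -_ ; 0# = 0# ; 1# = 1#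
    ; isCommutativeRing = record
      { isRing = record
        { +-isAbelianGroup = record
          { isGroup = record
            { isMonoid = record
              { isSemigroup = record
                { isMagma = record
                  { isEquivalence = record
                    { refl = embed refl
                    ; sym = λ { {x} {y} (mod d) → mod (I-resp
                        (solve 2 (λ x y → :- con (+ 1) :* (x :- y) := y :- x) refl x y) (I-* (- 1#) d)) }
                    ; trans = λ { {x} {y} {z} (mod d) (mod d′) → mod (I-resp
                        (solve 3 (λ x y z → (x :- y) :+ (y :- z) := x :- z) refl x y z) (I-+ d d′)) } }
                  ; ∙-cong = λ { {x} {y} {z} {w} (mod d) (mod d′) → mod (I-resp
                      (solve 4 (λ x y z w → (x :- y) :+ (z :- w) := (x :+ z) :- (y :+ w)) refl x y z w) (I-+ d d′)) } }
                ; assoc = λ x y z → embed (+-assoc x y z) }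
              ; identity = (λ x → embed (+-identityˡ x)) , (λ x → embed (+-identityʳ x)) }
            ; inverse = (λ x → embed (-‿inverseˡ x)) , (λ x → embed (-‿inverseʳ x))
            ; ⁻¹-cong = λ { {x} {y} (mod d) → mod (I-resp
                (solve 2 (λ x y → :- con (+ 1) :* (x :- y) := :- x :- :- y) refl x y) (I-* (- 1#) d)) } }
          ; comm = λ x y → embed (+-comm x y) }
        ; *-cong = λ { {x} {y} {z} {w} (mod d) (mod d′) → mod (I-resp
            (solve 4 (λ x y z w → z :* (x :- y) :+ y :* (z :- w) := x :* z :- y :* w) refl x y z w)
            (I-+ (I-* z d) (I-* y d′))) }
        ; *-assoc = λ x y z → embed (*-assoc x y z)
        ; *-identity = (λ x → embed (*-identityˡ x)) , (λ x → embed (*-identityʳ x))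
        ; distrib = (λ x y z → embed (distribˡ x y z)) , (λ x y z → embed (distribʳ x y z)) }
      ; *-comm = λ x y → embed (*-comm x y) } }

  I⇒~0 : ∀ {x} → I x → x ~ 0#
  I⇒~0 {x} d = mod (I-resp (solve 1 (λ x → x := x :- con (+ 0)) refl x) d)

  ~0⇒I : ∀ {x} → x ~ 0# → I x
  ~0⇒I {x} (mod d) = I-resp (solve 1 (λ x → x :- con (+ 0) := x) refl x) d

  quotient-hom : Hom.IsHom R quotient id
  quotient-hom = Hom.mkHom R quotient id embed (λ x y → embed refl) (λ x y → embed refl) (embed refl)

  ∘-hom : ∀ {a b} {A : CommutativeRing a b} {ι} → Hom.IsHom A R ι → Hom.IsHom A quotient ι
  ∘-hom {A = A} {ι} h = Hom.mkHom A quotient ι (λ e → embed (⟦⟧-cong e))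
    (λ x y → embed (+-homo x y)) (λ x y → embed (*-homo x y)) (embed 1#-homo)
    where open IsRingHomomorphism h

module Naturality {c ℓ : Level} (K : Field c ℓ) where
  open Field K using (Carrier; cring)
  open Polynomials K
  open QuasiSym K

  module _ {a b c′ d : Level} (A : CommutativeRing a b) (B : CommutativeRing c′ d)
    (ι : Carrier → CommutativeRing.Carrier A) (ι-hom : Hom.IsHom cring A ι)
    (φ : CommutativeRing.Carrier A → CommutativeRing.Carrier B) (φ-hom : Hom.IsHom A B φ)
    (φι-hom : Hom.IsHom cring B (φ ∘ ι)) where
    private
      module A = CommutativeRing A
      module B = CommutativeRing B
      module AL = RingLemmas A
      module BL = RingLemmas B
      module VA = Values A ι ι-hom
      module VB = Values B (φ ∘ ι) φι-hom
    open IsRingHomomorphism φ-hom renaming (⟦⟧-cong to φ-cong; +-homo to φ-+; *-homo to φ-*; 0#-homo to φ-0; 1#-homo to φ-1)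

    pow-natural : ∀ x k → φ (AL.pow x k) B.≈ BL.pow (φ x) k
    pow-natural x zero    = φ-1
    pow-natural x (suc k) = B.trans (φ-* _ _) (B.*-congˡ (pow-natural x k))

    mono-natural : ∀ {n} (z : Vec A.Carrier n) e → φ (AL.mono z e) B.≈ BL.mono (V.map φ z) e
    mono-natural []      []      = φ-1
    mono-natural (x ∷ z) (k ∷ e) = B.trans (φ-* _ _) (B.*-cong (pow-natural x k) (mono-natural z e))

    ∑-natural : ∀ {x} {X : Set x} (xs : List X) f → φ (AL.∑ xs f) B.≈ BL.∑ xs (φ ∘ f)
    ∑-natural []       f = φ-0
    ∑-natural (x ∷ xs) f = B.trans (φ-+ _ _) (B.+-congˡ (∑-natural xs f))

    value-natural : ∀ {m} F d (z : Vec A.Carrier m) → φ (VA.value F d z) B.≈ VB.value F d (V.map φ z)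
    value-natural {m} F d z = B.trans (∑-natural (vecsOfSum m d) _)
      (BL.∑-cong (vecsOfSum m d) (λ e → B.trans (φ-* _ _) (B.*-congˡ (mono-natural z e))))

module Shape {c ℓ : Level} (R : CommutativeRing c ℓ) where
  open CommutativeRing R
  open RingLemmas R

  -- With a = u_i, b = u_{i-1}, d = u_{i+1}, this is the passage between the relation of the algebra
  -- and u_i x_{i+1} = q u_i x_i.
  relation-shape : ∀ c a b d →
    - 1# * ((c + 1#) * (a * a) - c * (a * b) - a * d) ≈ a * (d - a) - c * (a * (a - b))
  relation-shape = solve 4 (λ c a b d → :- con (+ 1) :* ((c :+ con (+ 1)) :* (a :* a) :- c :* (a :* b) :- a :* d)
                       := a :* (d :- a) :- c :* (a :* (a :- b))) refl

  relation-zero : ∀ c c′ a b d → a ≈ 0# → c * (a * a) - c′ * (a * b) - a * d ≈ 0#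
  relation-zero c c′ a b d a≈0 = trans
    (solve 5 (λ c c′ a b d → c :* (a :* a) :- c′ :* (a :* b) :- a :* d := a :* (c :* a :- c′ :* b :- d)) refl c c′ a b d)
    (trans (*-congʳ a≈0) (zeroˡ _))

  split : ∀ a b → a ≈ b + (a - b)
  split = solve 2 (λ a b → a := b :+ (a :- b)) refl

-- Vanishing in the algebra generated by the u_i

module KlyachkoAlgebra {c ℓ : Level} (K : Field c ℓ) (q : Field.Carrier K) (inv : ℕ → Field.Carrier K)
  (inv-bracket : Klyachko.BracketInverse K q inv)
  (r : ℕ) where
  open Polynomials K
  open QuasiSym K
  private
    module P = CommutativeRing (polyRing {r})
    module KF = Field K
  open RingLemmas (polyRing {r})
  open LP {r} using (ι-+; ι-1; ι-cong)
  open SetoidReasoning P.setoid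

  rel : Fin r → Poly r
  rel i = relK q r (suc (F.toℕ i))

  combination : (Fin r → Poly r) → Poly r
  combination h = ∑ (allFin r) (λ i → h i *ₚ rel i)

  I : Poly r → Set _
  I p = Σ (Fin r → Poly r) λ h → p ≋ combination h

  I-resp : ∀ {p p′} → p ≋ p′ → I p → I p′
  I-resp e (h , eq) = h , P.trans (P.sym e) eq

  I-0 : I 0ₚ
  I-0 = (λ _ → 0ₚ) , P.sym (∑-0 (allFin r) (λ i → P.zeroˡ (rel i)))

  I-+ : ∀ {p p′} → I p → I p′ → I (p +ₚ p′)
  I-+ {p} {p′} (h , eq) (h′ , eq′) = (λ i → h i +ₚ h′ i) , (begin
    p +ₚ p′                             ≈⟨ P.+-cong eq eq′ ⟩
    combination h +ₚ combination h′     ≈⟨ ∑-+ (allFin r) (λ i → h i *ₚ rel i) (λ i → h′ i *ₚ rel i) ⟨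
    ∑ (allFin r) (λ i → h i *ₚ rel i +ₚ h′ i *ₚ rel i)
      ≈⟨ ∑-cong (allFin r) (λ i → P.distribʳ (rel i) (h i) (h′ i)) ⟨
    combination (λ i → h i +ₚ h′ i)     ∎)

  I-* : ∀ s {p} → I p → I (s *ₚ p)
  I-* s {p} (h , eq) = (λ i → s *ₚ h i) , (begin
    s *ₚ p               ≈⟨ P.*-congˡ {x = s} eq ⟩
    s *ₚ combination h   ≈⟨ ∑-distribˡ s (allFin r) (λ i → h i *ₚ rel i) ⟩
    ∑ (allFin r) (λ i → s *ₚ (h i *ₚ rel i))
      ≈⟨ ∑-cong (allFin r) (λ i → P.*-assoc s (h i) (rel i)) ⟨
    combination (λ i → s *ₚ h i) ∎)

  I-rel : ∀ i → I (rel i)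
  I-rel i = (λ j → δ i j) , P.sym (single r i rel)
    where
    δ : ∀ {n} → Fin n → Fin n → Poly r
    δ F.zero    F.zero    = 1ₚ
    δ F.zero    (F.suc j) = 0ₚ
    δ (F.suc i) F.zero    = 0ₚ
    δ (F.suc i) (F.suc j) = δ i j
    single : ∀ n (i : Fin n) (f : Fin n → Poly r) → ∑ (allFin n) (λ j → δ i j *ₚ f j) ≋ f i
    single (suc n) F.zero f = P.trans (P.reflexive (∑-allFin n (λ j → δ F.zero j *ₚ f j)))
      (P.trans (P.+-cong (P.*-identityˡ (f F.zero)) (∑-0 (allFin n) (λ j → P.zeroˡ (f (F.suc j))))) (P.+-identityʳ (f F.zero)))
    single (suc n) (F.suc i) f = P.trans (P.reflexive (∑-allFin n (λ j → δ (F.suc i) j *ₚ f j)))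
      (P.trans (P.+-cong (P.zeroˡ (f F.zero)) (single n i (f ∘ F.suc))) (P.+-identityˡ (f (F.suc i))))

  open Quotient (polyRing {r}) I I-resp I-0 I-+ I-*
  private module Q = CommutativeRing quotient

  u x : ℕ → Poly r
  u = uK r
  x zero    = 0ₚ
  x (suc i) = u (suc i) -ₚ u i

  u-beyond : ∀ i → suc r ≤ i → u i ≡ 0ₚ
  u-beyond (suc k) (s≤s r≤k) with k <? r
  ... | yes k<r = contradiction r≤k (ℕₚ.<⇒≱ k<r)
  ... | no  _   = ≡.refl

  relation-I : ∀ k → I (relK q r (suc k)) → I (u (suc k) *ₚ x (suc (suc k)) -ₚ constₚ q *ₚ (u (suc k) *ₚ x (suc k)))
  relation-I k rel∈I = I-resp (P.trans (P.*-congˡ {x = -ₚ 1ₚ} (P.+-congʳ (P.+-congʳ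
      (P.*-congʳ {x = u (suc k) *ₚ u (suc k)} (P.trans (ι-+ q KF.1#) (P.+-congˡ {x = constₚ q} ι-1))))))
    (Shape.relation-shape polyRing (constₚ q) (u (suc k)) (u k) (u (suc (suc k))))) (I-* (-ₚ 1ₚ) rel∈I)

  relation : ∀ i → (u i *ₚ x (suc i)) ~ (constₚ q *ₚ (u i *ₚ x i))
  relation zero = embed (P.sym (P.zeroʳ (constₚ q)))
  relation (suc k) = mod (relation-I k (rel∈I k))
    where
    rel∈I : ∀ k → I (relK q r (suc k))
    rel∈I k = by-cases (k <? r)
      where
      by-cases : Dec (k < r) → I (relK q r (suc k))
      by-cases (yes k<r) = subst (λ j → I (relK q r (suc j))) (Fₚ.toℕ-fromℕ< k<r) (I-rel (F.fromℕ< k<r))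
      by-cases (no  k≮r) = I-resp (P.sym (Shape.relation-zero polyRing (constₚ (q KF.+ KF.1#)) (constₚ q) (u (suc k)) (u k) (u (suc (suc k)))
        (P.reflexive (u-beyond (suc k) (s≤s (ℕₚ.≮⇒≥ k≮r)))))) I-0

  open Klyachko K q
  open Relations quotient constₚ (∘-hom {A = Field.cring K} const-hom) inv inv-bracket u x
    (embed P.refl) (embed P.refl)
    (λ i → embed (Shape.split polyRing (u (suc i)) (u i))) relation
  open Finite (suc r) (λ i r<i → Q.reflexive (u-beyond i r<i))

  private module N = Naturality K

  -- In the quotient the substituted polynomial is the value of f at x_1,...,x_{r+1}, which is zero
  -- because u_i = 0 for i > r. Being zero there is the same as having cofactors for the relations.
  vanishes : ∀ {F d} → Quasi F → r ≡ suc d → IsZeroInK q r (substₚ (uSubst r) (polyOf′ r F (suc r)))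
  vanishes {F} {d} F-quasi r≡ = Product.map₂ un (~0⇒I (Q.trans
    (embed (P.trans (substₚ≋ev (uSubst r) (polyOf′ r F (suc r)))
      (Values.ev-polyOf′ polyRing constₚ const-hom F r (V.tabulate (uSubst r)))))
    (Q.trans (N.value-natural polyRing quotient constₚ const-hom id quotient-hom (∘-hom {A = Field.cring K} const-hom) F r (V.tabulate (uSubst r)))
    (Q.trans (Q.reflexive (cong (Values.value quotient constₚ (∘-hom {A = Field.cring K} const-hom) F r) (Vₚ.map-id (V.tabulate (uSubst r)))))
    (subst (λ k → values F k (suc r) ~ 0ₚ) (≡.sym r≡) (values-vanish F-quasi d))))))

-- The principal specialization x_i = q^{i-1}

module Principal {c ℓ : Level} (K : Field c ℓ) (q : Field.Carrier K) (inv : ℕ → Field.Carrier K)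
  (inv-bracket : Klyachko.BracketInverse K q inv) where
  open Field K hiding (zero)
  open Polynomials K
  open RingLemmas cring
  open QuasiSym K
  open Klyachko K q
  open Triangle cring
  open Sequences cring
  open SetoidReasoning setoid
  open Linear cring id ring-id using (lin; ev; ∑-product)

  x : ℕ → Carrier
  x zero    = 0#
  x (suc i) = pow q i

  private
    x-relation : ∀ i → bracket i * x (suc i) ≈ q * (bracket i * x i)
    x-relation zero    = solve 2 (λ a q → con (+ 0) :* a := q :* (con (+ 0) :* con (+ 0))) refl 1# q
    x-relation (suc i) = solve 3 (λ b q p → b :* (q :* p) := q :* (b :* p)) refl _ _ _

  open Relations cring id ring-id inv inv-bracket bracket x refl refl (λ i → refl) x-relation

  factors : List Carrier → (ℕ → Carrier) → ℕ → Carrier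
  factors []       s = s
  factors (θ ∷ θs) s = (1- θ t) (factors θs s)

  1-t-cong : ∀ θ {s s′} → (∀ i → s i ≈ s′ i) → ∀ i → (1- θ t) s i ≈ (1- θ t) s′ i
  1-t-cong θ e i = +-cong (e i) (-‿cong (*-congˡ (sh-cong e i)))

  factors-cong : ∀ θs {s s′} → (∀ i → s i ≈ s′ i) → ∀ i → factors θs s i ≈ factors θs s′ i
  factors-cong []       e i = e i
  factors-cong (θ ∷ θs) e i = 1-t-cong θ (factors-cong θs e) i

  factors-0 : ∀ θs s → factors θs s 0 ≈ s 0
  factors-0 []       s = refl
  factors-0 (θ ∷ θs) s = trans (+-congʳ (factors-0 θs s)) (solve 2 (λ a b → a :- b :* con (+ 0) := a) refl (s 0) θ)

  factors-sh : ∀ θs s i → factors θs (sh s) i ≈ sh (factors θs s) i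
  factors-sh []       s i       = refl
  factors-sh (θ ∷ θs) s zero    = trans (1-t-cong θ (factors-sh θs s) 0) (solve 1 (λ b → con (+ 0) :- b :* con (+ 0) := con (+ 0)) refl θ)
  factors-sh (θ ∷ θs) s (suc i) = 1-t-cong θ (factors-sh θs s) (suc i)

  factors-1-t : ∀ θs θ s i → factors θs ((1- θ t) s) i ≈ (1- θ t) (factors θs s) i
  factors-1-t []       θ s i = refl
  factors-1-t (θ′ ∷ θs) θ s i = trans (1-t-cong θ′ (factors-1-t θs θ s) i) (commute i)
    where
    a = factors θs s
    commute : ∀ i → (1- θ′ t) ((1- θ t) a) i ≈ (1- θ t) ((1- θ′ t) a) i
    commute zero = solve 3 (λ a θ θ′ → a :- θ :* con (+ 0) :- θ′ :* con (+ 0) := a :- θ′ :* con (+ 0) :- θ :* con (+ 0)) refl (a 0) θ θ′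
    commute (suc i) = solve 5 (λ a b c θ θ′ → a :- θ :* b :- θ′ :* (b :- θ :* c) := a :- θ′ :* b :- θ :* (b :- θ′ :* c)) refl (a (suc i)) (a i) (sh a i) θ θ′

  factors-act : ∀ θs c s i → factors θs (act c s) i ≈ act c (factors θs s) i
  factors-act []       c s i = refl
  factors-act (θ ∷ θs) c s i = trans (1-t-cong θ (factors-act θs c s) i)
    (trans (+-congˡ (-‿cong (*-congˡ (sym (act-shʳ c (factors θs s) i)))))
      (sym (act-linearʳ c θ (factors θs s) (sh (factors θs s)) i)))

  powers : ℕ → ℕ → List Carrier
  powers j zero    = []
  powers j (suc N) = pow q j ∷ powers (suc j) N

  -- Weighting the coefficient of t^i by q^{i-1} amounts to putting qt for t, so it turns 1 - q^j t
  -- into 1 - q^{j+1}t. The weight at index 0 is 0 instead of 1/q, hence the condition on `s 0`.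
  factors-twist : ∀ N j s → s 0 ≈ 0# → ∀ i →
    factors (powers (suc j) N) (λ i → x i * s i) i ≈ x i * factors (powers j N) s i
  factors-twist zero    j s s0 i = refl
  factors-twist (suc N) j s s0 i = trans (1-t-cong (pow q (suc j)) (factors-twist N (suc j) s s0) i) (twist i)
    where
    B = factors (powers (suc j) N) s
    twist : ∀ i → (1- pow q (suc j) t) (λ i → x i * B i) i ≈ x i * (1- pow q j t) B i
    twist zero = solve 3 (λ b p p′ → con (+ 0) :* b :- p :* con (+ 0) := con (+ 0) :* (b :- p′ :* con (+ 0))) refl (B 0) (pow q (suc j)) (pow q j)
    twist (suc zero) = trans
      (solve 4 (λ b b′ p p′ → con (+ 1) :* b :- p :* (con (+ 0) :* b′) := con (+ 1) :* (b :- p′ :* con (+ 0))) refl (B 1) (B 0) (pow q (suc j)) (pow q j))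
      (*-congˡ (+-congˡ (-‿cong (*-congˡ (sym (trans (factors-0 (powers (suc j) N) s) s0))))))
    twist (suc (suc i)) =
      solve 5 (λ b b′ q p y → q :* y :* b :- q :* p :* (y :* b′) := q :* y :* (b :- p :* b′)) refl (B (suc (suc i))) (B (suc i)) q (pow q j) (pow q i)

  δ₁ : ℕ → Carrier
  δ₁ zero          = 0#
  δ₁ (suc zero)    = 1#
  δ₁ (suc (suc i)) = 0#

  -- The series of H_b is t / (t;q)_{b+1}. The factor 1 - t turns H_{b+1}(i) into x_i H_b(i), and
  -- `factors-twist` lowers the exponents in the other factors.
  factors-H : ∀ b i → factors (powers 0 (suc b)) (H b) i ≈ δ₁ i
  factors-H zero zero          = solve 0 (con (+ 0) :- con (+ 1) :* con (+ 0) := con (+ 0)) refl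
  factors-H zero (suc zero)    = solve 0 (con (+ 1) :- con (+ 1) :* con (+ 0) := con (+ 1)) refl
  factors-H zero (suc (suc i)) = solve 0 (con (+ 1) :- con (+ 1) :* con (+ 1) := con (+ 0)) refl
  factors-H (suc b) i = begin
    (1- 1# t) (factors (powers 1 (suc b)) (H (suc b))) i
      ≈⟨ factors-1-t (powers 1 (suc b)) 1# (H (suc b)) i ⟨
    factors (powers 1 (suc b)) ((1- 1# t) (H (suc b))) i
      ≈⟨ factors-cong (powers 1 (suc b)) (λ i → trans (+-congˡ (-‿cong (*-identityˡ _))) (H-difference b i)) i ⟩
    factors (powers 1 (suc b)) (λ i → x i * H b i) i
      ≈⟨ factors-twist (suc b) 0 (H b) (H-zero b) i ⟩
    x i * factors (powers 0 (suc b)) (H b) i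
      ≈⟨ *-congˡ (factors-H b i) ⟩
    x i * δ₁ i
      ≈⟨ x-δ₁ i ⟩
    δ₁ i ∎
    where
    x-δ₁ : ∀ i → x i * δ₁ i ≈ δ₁ i
    x-δ₁ zero          = zeroˡ _
    x-δ₁ (suc zero)    = *-identityˡ _
    x-δ₁ (suc (suc i)) = zeroʳ _

  -- Multiplying `values-numerator` by (t;q)_{d+1} turns the series of H_d into t, which cancels the
  -- shift on the left.
  factors-values : ∀ d {F} → Quasi F → ∀ i →
    factors (powers 0 (suc d)) (values F d) i ≈ numerator d d F i
  factors-values d {F} F-quasi i = begin
    sh (factors θs (values F d)) (suc i)       ≈⟨ factors-sh θs (values F d) (suc i) ⟨
    factors θs (sh (values F d)) (suc i)       ≈⟨ factors-cong θs (values-numerator d d F ℕₚ.≤-refl F-quasi) (suc i) ⟩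
    factors θs (act (numerator d d F) (H d)) (suc i) ≈⟨ factors-act θs (numerator d d F) (H d) (suc i) ⟩
    act (numerator d d F) (factors θs (H d)) (suc i) ≈⟨ act-cong {c = numerator d d F} (λ _ → refl) (factors-H d) (suc i) ⟩
    act (numerator d d F) δ₁ (suc i)           ≈⟨ act-single (numerator d d F) δ₁ off (suc i) ⟩
    numerator d d F i * 1#                     ≈⟨ *-identityʳ _ ⟩
    numerator d d F i                          ∎
    where
    θs = powers 0 (suc d)
    off : ∀ i → ¬ (i ≡ 1) → δ₁ i ≈ 0#
    off zero          _   = refl
    off (suc zero)    i≢1 = contradiction ≡.refl i≢1
    off (suc (suc i)) _   = refl

  shift : ℕ → (ℕ → Carrier) → ℕ → Carrier
  shift zero    s = s
  shift (suc k) s = sh (shift k s)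

  -- Each term a t^k acts as a times a k-fold shift. Summing over terms in place of coefficients
  -- makes products of polynomials easy to unfold.
  conv : Poly 1 → (ℕ → Carrier) → ℕ → Carrier
  conv p s n = lin (λ e → shift (V.head e) s n) p

  private
    at-suc : ∀ k n a → at (suc n ∷ []) (a , suc k ∷ []) ≈ at (n ∷ []) (a , k ∷ [])
    at-suc k n a with Vₚ.≡-dec ℕ._≟_ (suc k ∷ []) (suc n ∷ []) | Vₚ.≡-dec ℕ._≟_ (k ∷ []) (n ∷ [])
    ... | yes _ | yes _ = refl
    ... | no  _ | no  _ = refl
    ... | yes e | no  f = contradiction (cong (λ { (j ∷ []) → ℕ.pred j ∷ [] }) e) f
    ... | no  e | yes f = contradiction (cong (λ { (j ∷ []) → suc j ∷ [] }) f) e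

    shift-suc : ∀ k s n a →
      a * shift k s (suc n) ≈ s 0 * at (suc n ∷ []) (a , k ∷ []) + a * shift k (s ∘ suc) n
    shift-suc zero s n a = sym (trans (+-congʳ (zeroʳ (s 0))) (+-identityˡ _))
    shift-suc (suc k) s zero a = trans (unshifted k) (sym (+-cong (*-congˡ (at-suc k 0 a)) refl))
      where
      unshifted : ∀ k → a * shift k s 0 ≈ s 0 * at (0 ∷ []) (a , k ∷ []) + a * 0#
      unshifted zero    = solve 2 (λ a b → a :* b := b :* a :+ a :* con (+ 0)) refl a (s 0)
      unshifted (suc k) = solve 2 (λ a b → a :* con (+ 0) := b :* con (+ 0) :+ a :* con (+ 0)) refl a (s 0)
    shift-suc (suc k) s (suc n) a = trans (shift-suc k s n a) (+-congʳ (*-congˡ (sym (at-suc k (suc n) a))))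

    ∑-shift : ∀ n s k a → ∑< (suc n) (λ i → s i * at (n ∸ i ∷ []) (a , k ∷ [])) ≈ a * shift k s n
    ∑-shift zero s zero    a = trans (+-identityʳ _) (*-comm _ _)
    ∑-shift zero s (suc k) a = trans (+-identityʳ _) (trans (zeroʳ _) (sym (zeroʳ _)))
    ∑-shift (suc n) s k a = trans (∑<-suc (suc n) (λ i → s i * at (suc n ∸ i ∷ []) (a , k ∷ [])))
      (trans (+-congˡ (∑-shift n (s ∘ suc) k a)) (sym (shift-suc k s n a)))

  cauchy-conv : ∀ p s n → cauchy s (λ j → coeff p (j ∷ [])) n ≈ conv p s n
  cauchy-conv p s n = begin
    ∑< (suc n) (λ i → s i * coeff p (n ∸ i ∷ []))
      ≈⟨ ∑-cong (upTo (suc n)) (λ i → ∑-distribˡ (s i) p (at (n ∸ i ∷ []))) ⟩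
    ∑< (suc n) (λ i → ∑ p (λ t → s i * at (n ∸ i ∷ []) t))
      ≈⟨ ∑-swap (upTo (suc n)) p (λ i t → s i * at (n ∸ i ∷ []) t) ⟩
    ∑ p (λ t → ∑< (suc n) (λ i → s i * at (n ∸ i ∷ []) t))
      ≈⟨ ∑-cong p (λ { (a , k ∷ []) → ∑-shift n s k a }) ⟩
    conv p s n ∎

  linearFactor : Carrier → Poly 1
  linearFactor θ = 1ₚ -ₚ constₚ θ *ₚ var F.zero

  conv-1 : ∀ s n → conv 1ₚ s n ≈ s n
  conv-1 s n = trans (+-identityʳ _) (*-identityˡ _)

  conv-linearFactor : ∀ θ p s n → conv (linearFactor θ *ₚ p) s n ≈ (1- θ t) (conv p s) n
  conv-linearFactor θ p s n = trans (∑-product (linearFactor θ) p _)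
    (+-cong (∑-cong p (λ { (a , k ∷ []) → *-congʳ (*-identityˡ a) }))
      (trans (+-identityʳ _) (trans
        (∑-cong p (λ { (a , k ∷ []) → solve 3 (λ θ a y → :- (θ :* con (+ 1)) :* a :* y := :- θ :* (a :* y)) refl θ a _ }))
        (trans (sym (∑-distribˡ (- θ) p _)) (trans (*-congˡ (sh-conv n))
          (solve 2 (λ a b → :- a :* b := :- (a :* b)) refl θ _))))))
    where
    sh-conv : ∀ n → ∑ p (λ t → proj₁ t * sh (shift (V.head (proj₂ t)) s) n) ≈ sh (conv p s) n
    sh-conv zero    = ∑-0 p (λ t → zeroʳ _)
    sh-conv (suc n) = refl

  conv-prod : ∀ {a} {A : Set a} (xs : List A) (θ : A → Carrier) s n →
    conv (prodₚ (map (linearFactor ∘ θ) xs)) s n ≈ factors (map θ xs) s n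
  conv-prod []       θ s n = conv-1 s n
  conv-prod (y ∷ xs) θ s n = trans (conv-linearFactor (θ y) (prodₚ (map (linearFactor ∘ θ) xs)) s n)
    (1-t-cong (θ y) (conv-prod xs θ s) n)

  powers≡ : ∀ N → map (λ i → powK q (F.toℕ i)) (allFin N) ≡ powers 0 N
  powers≡ N = ≡.trans (Lₚ.map-tabulate id (λ i → powK q (F.toℕ i))) (≡.trans
    (Lₚ.tabulate-cong (λ i → powK≡pow q (F.toℕ i))) (go 0 N))
    where
    go : ∀ j N → tabulate {n = N} (λ i → pow q (j ℕ.+ F.toℕ i)) ≡ powers j N
    go j zero    = ≡.refl
    go j (suc N) = ≡.cong₂ _∷_ (cong (pow q) (ℕₚ.+-identityʳ j))
      (≡.trans (Lₚ.tabulate-cong (λ i → cong (pow q) (ℕₚ.+-suc j (F.toℕ i)))) (go (suc j) N))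

  cauchy-qPoch : ∀ s N n → cauchy s (qPochSeries q N) n ≈ factors (powers 0 N) s n
  cauchy-qPoch s N n = trans (cauchy-conv (qPochₚ q N) s n)
    (trans (conv-prod (allFin N) (λ i → powK q (F.toℕ i)) s n)
      (reflexive (cong (λ θs → factors θs s n) (powers≡ N))))

  principalSeries≈values : ∀ d f i → principalSeries q (suc d) f i ≈ values (coeffF f) (suc d) i
  principalSeries≈values d f zero    = refl
  principalSeries≈values d f (suc j) = begin
    evalₚ (λ i → powK q (F.toℕ i)) (polyOf (suc d) f (suc j))
      ≈⟨ evalₚ≈ev (λ i → powK q (F.toℕ i)) (polyOf (suc d) f (suc j)) ⟩
    ev (V.tabulate (λ i → powK q (F.toℕ i))) (polyOf (suc d) f (suc j))
      ≡⟨ cong (λ z → ev z (polyOf (suc d) f (suc j))) (Vₚ.tabulate-cong (λ i → powK≡pow q (F.toℕ i))) ⟩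
    ev (initial-x (suc j)) (polyOf′ (suc d) (coeffF f) (suc j))
      ≈⟨ Values.ev-polyOf′ cring id ring-id (coeffF f) (suc d) (initial-x (suc j)) ⟩
    values (coeffF f) (suc d) (suc j) ∎
    where
    initial-x : ∀ m → Vec Carrier m
    initial-x = Values.initial cring id ring-id x

  principal-numerator : ∀ d (f : QSymFun) j →
    cauchy (principalSeries q (suc d) f) (qPochSeries q (suc (suc d))) j ≈ numerator (suc d) (suc d) (coeffF f) j
  principal-numerator d f j = trans
    (∑-cong (upTo (suc j)) (λ i → *-congʳ (principalSeries≈values d f i)))
    (trans (cauchy-qPoch (values (coeffF f) (suc d)) (suc (suc d)) j)
      (factors-values (suc d) (quasisym f) j))

-- Homogeneity, and the radical of the divided symmetrization pairing

module Degrees {c ℓ : Level} (K : Field c ℓ) where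
  open Field K hiding (zero)
  open Polynomials K

  -- Stronger than homogeneity: terms that would cancel are also constrained. In return it is
  -- inherited term by term under all operations, and the empty list has every degree.
  AllDeg : ∀ {n} → ℕ → Poly n → Set c
  AllDeg d = All (λ t → V.sum (proj₂ t) ≡ d)

  module _ {n : ℕ} where

    allDeg-+ : ∀ {d} {p p′ : Poly n} → AllDeg d p → AllDeg d p′ → AllDeg d (p +ₚ p′)
    allDeg-+ = Allₚ.++⁺

    allDeg-neg : ∀ {d} {p : Poly n} → AllDeg d p → AllDeg d (-ₚ p)
    allDeg-neg D = Allₚ.map⁺ D

    allDeg-· : ∀ {a b} (s : Term n) {p : Poly n} → V.sum (proj₂ s) ≡ a → AllDeg b p → AllDeg (a ℕ.+ b) (map (s ·_) p)
    allDeg-· s s≡ D = Allₚ.map⁺ (All.map (λ {t} t≡ → ≡.trans (sum-zipWith (proj₂ s) (proj₂ t)) (≡.cong₂ ℕ._+_ s≡ t≡)) D)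

    allDeg-* : ∀ {a b} {p p′ : Poly n} → AllDeg a p → AllDeg b p′ → AllDeg (a ℕ.+ b) (p *ₚ p′)
    allDeg-* {p = []}    []       D′ = []
    allDeg-* {p = s ∷ p} (s≡ ∷ D) D′ = Allₚ.++⁺ (allDeg-· s s≡ D′) (allDeg-* D D′)

    allDeg-const : ∀ a → AllDeg {n} 0 (constₚ a)
    allDeg-const a = sum-replicate-0 n ∷ []

    allDeg-^ : ∀ {p : Poly n} → AllDeg 1 p → ∀ k → AllDeg k (p ^ₚ k)
    allDeg-^ D zero    = allDeg-const 1#
    allDeg-^ D (suc k) = allDeg-* D (allDeg-^ D k)

    allDeg-prod : ∀ {a} {A : Set a} (xs : List A) (f : A → Poly n) (d : A → ℕ) → (∀ x → AllDeg (d x) (f x)) →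
      AllDeg (sumℕ (map d xs)) (prodₚ (map f xs))
    allDeg-prod []       f d D = allDeg-const 1#
    allDeg-prod (x ∷ xs) f d D = allDeg-* (D x) (allDeg-prod xs f d D)

    allDeg-sum : ∀ {a d} {A : Set a} {xs : List A} (f : A → Poly n) → All (λ x → AllDeg d (f x)) xs →
      AllDeg d (sumₚ (map f xs))
    allDeg-sum f []       = []
    allDeg-sum f (D ∷ Ds) = Allₚ.++⁺ D (allDeg-sum f Ds)

    allDeg⇒homogeneous : ∀ {d} {p : Poly n} → AllDeg d p → IsHomogeneousₚ d p
    allDeg⇒homogeneous []                e e≢ = refl
    allDeg⇒homogeneous {p = t ∷ p} (t≡ ∷ D) e e≢ with Vₚ.≡-dec ℕ._≟_ (proj₂ t) e
    ... | yes ≡.refl = contradiction t≡ e≢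
    ... | no  _      = trans (+-identityˡ _) (allDeg⇒homogeneous D e e≢)

  sum-unitVec : ∀ {n} (i : Fin n) → V.sum (RingLemmas.unitVec cring i) ≡ 1
  sum-unitVec {suc n} F.zero = cong suc (≡.trans (cong V.sum (tabulate-0 {n})) (sum-replicate-0 n))
  sum-unitVec (F.suc i) = ≡.trans (cong V.sum (RingLemmas.unitVec-suc cring i)) (sum-unitVec i)

  allDeg-var : ∀ {n} (i : Fin n) → AllDeg 1 (var i)
  allDeg-var i = sum-unitVec i ∷ []

  sum-lookup : ∀ {n} (e : Vec ℕ n) → sumℕ (map (V.lookup e) (allFin n)) ≡ V.sum e
  sum-lookup e = ≡.trans (cong sumℕ (Lₚ.map-tabulate id (V.lookup e))) (go e)
    where
    go : ∀ {n} (e : Vec ℕ n) → sumℕ (tabulate (V.lookup e)) ≡ V.sum e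
    go []      = ≡.refl
    go (k ∷ e) = cong (k ℕ.+_) (go e)

  vecsOfSum-sum : ∀ n s → All (λ e → V.sum e ≡ s) (vecsOfSum n s)
  vecsOfSum-sum zero    zero    = ≡.refl ∷ []
  vecsOfSum-sum zero    (suc s) = []
  vecsOfSum-sum (suc n) s = Allₚ.concat⁺ (Allₚ.map⁺ (Allₚ.applyUpTo⁺₁ id (suc s) (λ {a} a≤s →
    Allₚ.map⁺ (All.map (λ e≡ → ≡.trans (cong (a ℕ.+_) e≡) (ℕₚ.m+[n∸m]≡n (s≤s⁻¹ a≤s))) (vecsOfSum-sum n (s ∸ a))))))

  allDeg-subst : ∀ {n m d} (σ : Fin n → Poly m) (p : Poly n) → (∀ i → AllDeg 1 (σ i)) → AllDeg d p → AllDeg d (substₚ σ p)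
  allDeg-subst {n} σ p σ-deg D = allDeg-sum _ (All.map (λ {t} t≡ → subst (λ d → AllDeg d _)
    (≡.trans (sum-lookup (proj₂ t)) t≡)
    (allDeg-* (allDeg-const (proj₁ t)) (allDeg-prod (allFin n) _ (V.lookup (proj₂ t)) (λ i → allDeg-^ (σ-deg i) _)))) D)

module DividedSymmetrization {c ℓ : Level} (K : Field c ℓ) (q : Field.Carrier K)
  (2-cancelᴷ : RingLemmas.2-Cancellable (Field.cring K))
  (n r : ℕ) (n≡1+r : n ≡ suc r) where
  private module KF = Field K
  open Polynomials K
  open Degrees K
  open Antisymmetrization K q 2-cancelᴷ
  private module P = CommutativeRing (polyRing {n})
  open RingLemmas (polyRing {n})

  vars : Vec (Poly n) n
  vars = V.tabulate var

  ψ ψ′ : Vec ℕ n → Poly n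
  ψ′ e = 𝒜 (λ z → mono z e *ₚ St z)
  ψ  e = if ⌊ V.sum e ℕ.≟ r ⌋ then ψ′ e else 0ₚ

  -- Λ g is the antisymmetrization of g times the staircase product when g has degree r;
  -- components of other degrees are discarded.
  Λ Λ′ : Poly n → Poly n
  Λ  = lin ψ
  Λ′ = lin ψ′

  𝒜-cong : ∀ {G G′} → (∀ z → G z ≋ G′ z) → 𝒜 G ≋ 𝒜 G′
  𝒜-cong e = SumV-cong n (λ v → P.*-congˡ {x = E v} (e (V.map var v)))

  𝒜-scale : ∀ a G → 𝒜 (λ z → a *ₚ G z) ≋ a *ₚ 𝒜 G
  𝒜-scale a G = P.trans (SumV-cong n (λ v → x∙yz≈y∙xz (E v) a (G (V.map var v)))) (SumV-* n a (λ v → E v *ₚ G (V.map var v)))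
    where open import Algebra.Properties.CommutativeSemigroup P.*-commutativeSemigroup using (x∙yz≈y∙xz)

  Λ′-𝒜 : ∀ p → 𝒜 (λ z → ev z p *ₚ St z) ≋ Λ′ p
  Λ′-𝒜 p = SumV-linear var n p (λ t → constₚ (proj₁ t)) (λ t v → mono (V.map var v) (proj₂ t)) (λ v → St (V.map var v))

  antisym-stair : ∀ g → antisym n (g *ₚ stairₚ q n) ≋ Λ′ g
  antisym-stair g = P.trans (antisym≋𝒜 (g *ₚ stairₚ q n)) (P.trans
    (𝒜-cong (λ z → P.trans (ev-* z g (stairₚ q n)) (P.*-congˡ {x = ev z g} (ev-stair z)))) (Λ′-𝒜 g))

  ψ-≡ : ∀ e → V.sum e ≡ r → ψ e ≡ ψ′ e
  ψ-≡ e e≡r with V.sum e ℕ.≟ r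
  ... | yes _   = ≡.refl
  ... | no  e≢r = contradiction e≡r e≢r

  ψ-≢ : ∀ e → ¬ (V.sum e ≡ r) → ψ e ≡ 0ₚ
  ψ-≢ e e≢r with V.sum e ℕ.≟ r
  ... | yes e≡r = contradiction e≡r e≢r
  ... | no  _   = ≡.refl

  Λ-homogeneous : ∀ p → IsHomogeneousₚ r p → Λ p ≋ Λ′ p
  Λ-homogeneous p hom = lin-agree ψ ψ′ p (λ e → agree e (V.sum e ℕ.≟ r))
    where
    agree : ∀ e → Dec (V.sum e ≡ r) → constₚ (coeff p e) *ₚ ψ e ≋ constₚ (coeff p e) *ₚ ψ′ e
    agree e (yes e≡r) = P.*-congˡ {x = constₚ (coeff p e)} (P.reflexive (ψ-≡ e e≡r))
    agree e (no  e≢r) = P.trans (zero-left (ψ e)) (P.sym (zero-left (ψ′ e)))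
      where
      zero-left : ∀ s → constₚ (coeff p e) *ₚ s ≋ 0ₚ
      zero-left s = P.trans (P.*-congʳ {x = s} (P.trans (ι-cong (hom e e≢r)) ι-0)) (P.zeroˡ s)

  Λ-deg : ∀ {p} → AllDeg r p → Λ p ≋ Λ′ p
  Λ-deg {p} D = Λ-homogeneous p (allDeg⇒homogeneous D)

  Λ-other : ∀ {d p} → ¬ (d ≡ r) → AllDeg d p → Λ p ≋ 0ₚ
  Λ-other d≢r []       = P.refl
  Λ-other {p = t ∷ p} d≢r (t≡d ∷ D) = P.trans (P.+-cong
    (P.trans (P.*-congˡ {x = constₚ (proj₁ t)} (P.reflexive (ψ-≢ (proj₂ t) (λ t≡r → d≢r (≡.trans (≡.sym t≡d) t≡r)))))
      (P.zeroʳ (constₚ (proj₁ t))))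
    (Λ-other d≢r D)) (P.+-identityˡ 0ₚ)

  -- The radical of the pairing (h , p) ↦ Λ (h p), an ideal containing the relations of 𝒦.
  I : Poly n → Set _
  I p = ∀ h → Λ (h *ₚ p) ≋ 0ₚ

  I-resp : ∀ {p p′} → p ≋ p′ → I p → I p′
  I-resp e i h = P.trans (lin-cong ψ (P.*-congˡ {x = h} (P.sym e))) (i h)

  I-0 : I 0ₚ
  I-0 h = lin-cong ψ (P.zeroʳ h)

  I-+ : ∀ {p p′} → I p → I p′ → I (p +ₚ p′)
  I-+ {p} {p′} i i′ h = P.trans (lin-cong ψ (P.distribˡ h p p′)) (P.trans (lin-+ ψ (h *ₚ p) (h *ₚ p′))
    (P.trans (P.+-cong (i h) (i′ h)) (P.+-identityˡ 0ₚ)))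

  I-* : ∀ s {p} → I p → I (s *ₚ p)
  I-* s {p} i h = P.trans (lin-cong ψ (P.sym (P.*-assoc h s p))) (i (h *ₚ s))

  -- By linearity in the cofactor only monomials need testing, and only those of complementary
  -- degree, since `Λ` discards every product of degree other than r.
  I-vanish : ∀ {d} rel (G : Vec (Poly n) n → Poly n) → AllDeg d rel → (∀ z → ev z rel ≋ G z) →
    (∀ e → V.sum e ℕ.+ d ≡ r → 𝒜 (λ z → mono z e *ₚ G z *ₚ St z) ≋ 0ₚ) → I rel
  I-vanish rel G D rel≋G kill [] = P.refl
  I-vanish {d} rel G D rel≋G kill (t ∷ h) = P.trans (lin-+ ψ (map (t ·_) rel) (h *ₚ rel))
    (P.trans (P.+-cong (first (V.sum (proj₂ t) ℕ.+ d ℕ.≟ r)) (I-vanish rel G D rel≋G kill h)) (P.+-identityˡ 0ₚ))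
    where
    b = constₚ (proj₁ t)
    e = proj₂ t
    D′ : AllDeg (V.sum e ℕ.+ d) (map (t ·_) rel)
    D′ = allDeg-· t ≡.refl D
    ev-· : ∀ z → ev z (map (t ·_) rel) ≋ b *ₚ (mono z e *ₚ G z)
    ev-· z = P.trans (P.reflexive (cong (ev z) (≡.sym (Lₚ.++-identityʳ (map (t ·_) rel)))))
      (P.trans (ev-* z (t ∷ []) rel)
      (P.trans (P.*-cong (P.+-identityʳ (b *ₚ mono z e)) (rel≋G z)) (P.*-assoc b (mono z e) (G z))))
    first : Dec (V.sum e ℕ.+ d ≡ r) → Λ (map (t ·_) rel) ≋ 0ₚ
    first (no  ≢r) = Λ-other ≢r D′
    first (yes ≡r) = P.trans (Λ-deg (subst (λ k → AllDeg k (map (t ·_) rel)) ≡r D′))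
      (P.trans (P.sym (Λ′-𝒜 (map (t ·_) rel)))
      (P.trans (𝒜-cong (λ z → P.trans (P.*-congʳ {x = St z} (ev-· z)) (P.*-assoc b (mono z e *ₚ G z) (St z))))
      (P.trans (𝒜-scale b (λ z → mono z e *ₚ G z *ₚ St z))
      (P.trans (P.*-congˡ {x = b} (kill e ≡r)) (P.zeroʳ b)))))

  x u : ℕ → Poly n
  x zero    = 0ₚ
  x (suc j) = nth vars j
  u zero    = 0ₚ
  u (suc i) = u i +ₚ x (suc i)

  ev-nth : ∀ {k} z (f : Fin k → Poly n) (w : Vec (Poly n) k) → (∀ i → ev z (f i) ≋ V.lookup w i) →
    ∀ j → ev z (nth (V.tabulate f) j) ≋ nth w j
  ev-nth {zero}  z f []      e j       = P.refl
  ev-nth {suc k} z f (a ∷ w) e zero    = e F.zero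
  ev-nth {suc k} z f (a ∷ w) e (suc j) = ev-nth z (f ∘ F.suc) w (e ∘ F.suc) j

  ev-x : ∀ z j → ev z (x (suc j)) ≋ nth z j
  ev-x z = ev-nth z var z (ev-var z)

  ev-u : ∀ z i → ev z (u i) ≋ prefix z i
  ev-u z zero    = P.refl
  ev-u z (suc i) = P.trans (lin-+ (mono z) (u i) (x (suc i))) (P.+-cong (ev-u z i) (ev-x z i))

  allDeg-nth : ∀ {k} (f : Fin k → Poly n) → (∀ i → AllDeg 1 (f i)) → ∀ j → AllDeg 1 (nth (V.tabulate f) j)
  allDeg-nth {zero}  f D j       = []
  allDeg-nth {suc k} f D zero    = D F.zero
  allDeg-nth {suc k} f D (suc j) = allDeg-nth (f ∘ F.suc) (D ∘ F.suc) j

  allDeg-x : ∀ j → AllDeg 1 (x j)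
  allDeg-x zero    = []
  allDeg-x (suc j) = allDeg-nth var allDeg-var j

  allDeg-u : ∀ i → AllDeg 1 (u i)
  allDeg-u zero    = []
  allDeg-u (suc i) = allDeg-+ (allDeg-u i) (allDeg-x (suc i))

  private
    +d≡r⇒< : ∀ s d → s ℕ.+ d ≡ r → d ℕ.+ s < n
    +d≡r⇒< s d eq = ℕₚ.≤-reflexive (≡.trans (cong suc (≡.trans (ℕₚ.+-comm d s) eq)) (≡.sym n≡1+r))

  I-u : ∀ i → n ≤ i → I (u i)
  I-u i n≤i = I-vanish (u i) (λ z → prefix z i) (allDeg-u i) (λ z → ev-u z i)
    (λ e e≡ → prefix-vanishes var i e n≤i (+d≡r⇒< (V.sum e) 1 e≡))

  I-relation : ∀ i → suc i < n → I (u (suc i) *ₚ x (suc (suc i)) -ₚ constₚ q *ₚ (u (suc i) *ₚ x (suc i)))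
  I-relation i i<n = I-vanish _
    (λ z → prefix z (suc i) *ₚ nth z (suc i) -ₚ constₚ q *ₚ (prefix z (suc i) *ₚ nth z i))
    (allDeg-+ (allDeg-* (allDeg-u (suc i)) (allDeg-x (suc (suc i))))
      (allDeg-neg (allDeg-* (allDeg-const q) (allDeg-* (allDeg-u (suc i)) (allDeg-x (suc i))))))
    (λ z → P.trans (ev-minus z (u (suc i) *ₚ x (suc (suc i))) (constₚ q *ₚ (u (suc i) *ₚ x (suc i))))
      (P.+-cong (P.trans (ev-* z (u (suc i)) (x (suc (suc i)))) (P.*-cong (ev-u z (suc i)) (ev-x z (suc i))))
        (P.-‿cong (P.trans (ev-* z (constₚ q) (u (suc i) *ₚ x (suc i)))
          (P.*-cong (ev-const z q) (P.trans (ev-* z (u (suc i)) (x (suc i))) (P.*-cong (ev-u z (suc i)) (ev-x z i))))))))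
    (λ e e≡ → cut-vanishes var i (n ∸ suc (suc i))
      (≡.trans (≡.sym (ℕₚ.m+[n∸m]≡n i<n)) (≡.sym (ℕₚ.+-suc (suc i) _))) e (+d≡r⇒< (V.sum e) 2 e≡))

-- Quasisymmetric polynomials as sums of homogeneous quasisymmetric components

compress-idempotent : ∀ e → compress (compress e) ≡ compress e
compress-idempotent []          = ≡.refl
compress-idempotent (zero  ∷ e) = compress-idempotent e
compress-idempotent (suc k ∷ e) = cong (suc k ∷_) (compress-idempotent e)

pad : (n : ℕ) → List ℕ → Vec ℕ n
pad zero    l       = []
pad (suc n) []      = 0 ∷ pad n []
pad (suc n) (a ∷ l) = a ∷ pad n l

pad-[] : ∀ n → pad n [] ≡ V.replicate n 0
pad-[] zero    = ≡.refl
pad-[] (suc n) = cong (0 ∷_) (pad-[] n)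

compress-zeros : ∀ n → compress (V.toList (pad n [])) ≡ []
compress-zeros zero    = ≡.refl
compress-zeros (suc n) = compress-zeros n

compress-pad : ∀ n l → L.length (compress l) ≤ n → compress (V.toList (pad n (compress l))) ≡ compress l
compress-pad n       []          len         = compress-zeros n
compress-pad n       (zero  ∷ l) len         = compress-pad n l len
compress-pad (suc n) (suc k ∷ l) (s≤s len) = cong (suc k ∷_) (compress-pad n l len)

length-compress : ∀ {n} (e : Vec ℕ n) → L.length (compress (V.toList e)) ≤ n
length-compress []          = z≤n
length-compress (zero  ∷ e) = ℕₚ.m≤n⇒m≤1+n (length-compress e)
length-compress (suc k ∷ e) = s≤s (length-compress e)

module QuasisymmetricPolynomials {c ℓ : Level} (K : Field c ℓ) where
  open Field K hiding (zero)
  open Polynomials K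
  open QuasiSym K
  open RingLemmas cring
  open Triangle cring

  private
    at-∷ : ∀ {n} a k a′ (e e′ : Vec ℕ n) →
      at (k ∷ e) (a , a′ ∷ e′) ≈ (if ⌊ a′ ℕ.≟ k ⌋ then at e (a , e′) else 0#)
    at-∷ a k a′ e e′ with Vₚ.≡-dec ℕ._≟_ (a′ ∷ e′) (k ∷ e) | a′ ℕ.≟ k | Vₚ.≡-dec ℕ._≟_ e′ e
    ... | yes _      | yes _ | yes _ = refl
    ... | yes ≡.refl | no  f | _     = contradiction ≡.refl f
    ... | yes ≡.refl | _     | no  f = contradiction ≡.refl f
    ... | no  f | yes ≡.refl | yes ≡.refl = contradiction ≡.refl f
    ... | no  _ | yes _ | no  _ = refl
    ... | no  _ | no  _ | _     = refl

    if-∑ : ∀ {a} {A : Set a} b (xs : List A) f → ∑ xs (λ x → if b then f x else 0#) ≈ (if b then ∑ xs f else 0#)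
    if-∑ true  xs f = refl
    if-∑ false xs f = ∑-0 xs (λ _ → refl)

    pick : ∀ m k (f : ℕ → Carrier) → k < m → ∑< m (λ a → if ⌊ a ℕ.≟ k ⌋ then f a else 0#) ≈ f k
    pick (suc m) zero f k<m = trans (∑<-suc m _) (trans (+-congˡ (∑-0 (upTo m) (λ _ → refl))) (+-identityʳ _))
    pick (suc m) (suc k) f (s≤s k<m) = trans (∑<-suc m _) (trans (+-identityˡ _) (trans
      (∑-cong (upTo m) (λ a → ≟-suc a)) (pick m k (f ∘ suc) k<m)))
      where
      ≟-suc : ∀ a → (if ⌊ suc a ℕ.≟ suc k ⌋ then f (suc a) else 0#) ≈ (if ⌊ a ℕ.≟ k ⌋ then f (suc a) else 0#)
      ≟-suc a with suc a ℕ.≟ suc k | a ℕ.≟ k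
      ... | yes _ | yes _ = refl
      ... | no  _ | no  _ = refl
      ... | yes e | no  f = contradiction (ℕₚ.suc-injective e) f
      ... | no  e | yes f = contradiction (cong suc f) e

    pick-none : ∀ m k (f : ℕ → Carrier) → m ≤ k → ∑< m (λ a → if ⌊ a ℕ.≟ k ⌋ then f a else 0#) ≈ 0#
    pick-none m k f m≤k = ∑<-0 m (λ a a<m → none a (ℕₚ.<⇒≢ (ℕₚ.<-≤-trans a<m m≤k)))
      where
      none : ∀ a → ¬ (a ≡ k) → (if ⌊ a ℕ.≟ k ⌋ then f a else 0#) ≈ 0#
      none a a≢k with a ℕ.≟ k
      ... | yes a≡k = contradiction a≡k a≢k
      ... | no  _   = refl

  -- Every exponent vector of sum s occurs exactly once in `vecsOfSum n s`.
  coeff-vecsOfSum : ∀ {n} s (φ : Vec ℕ n → Carrier) e →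
    ∑ (vecsOfSum n s) (λ v → at e (φ v , v)) ≈ (if ⌊ s ℕ.≟ V.sum e ⌋ then φ e else 0#)
  coeff-vecsOfSum {zero} zero    φ [] = +-identityʳ _
  coeff-vecsOfSum {zero} (suc s) φ [] = refl
  coeff-vecsOfSum {suc n} s φ (k ∷ e) = trans (∑-concatMap (λ a → map (a ∷_) (vecsOfSum n (s ∸ a))) (upTo (suc s)) term)
    (trans (∑-cong (upTo (suc s)) (λ a → trans (reflexive (∑-map (a ∷_) (vecsOfSum n (s ∸ a)) term))
      (trans (∑-cong (vecsOfSum n (s ∸ a)) (λ v → at-∷ (φ (a ∷ v)) k a e v)) (if-∑ ⌊ a ℕ.≟ k ⌋ (vecsOfSum n (s ∸ a)) _))))
    (choose (k ≤? s)))
    where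
    term : Vec ℕ (suc n) → Carrier
    term v = at (k ∷ e) (φ v , v)
    inner : ℕ → Carrier
    inner a = ∑ (vecsOfSum n (s ∸ a)) (λ v → at e (φ (a ∷ v) , v))
    choose : Dec (k ≤ s) → ∑< (suc s) (λ a → if ⌊ a ℕ.≟ k ⌋ then inner a else 0#) ≈
             (if ⌊ s ℕ.≟ k ℕ.+ V.sum e ⌋ then φ (k ∷ e) else 0#)
    choose (yes k≤s) = trans (pick (suc s) k inner (s≤s k≤s))
      (trans (coeff-vecsOfSum (s ∸ k) (λ v → φ (k ∷ v)) e) same)
      where
      same : (if ⌊ s ∸ k ℕ.≟ V.sum e ⌋ then φ (k ∷ e) else 0#) ≈ (if ⌊ s ℕ.≟ k ℕ.+ V.sum e ⌋ then φ (k ∷ e) else 0#)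
      same with s ∸ k ℕ.≟ V.sum e | s ℕ.≟ k ℕ.+ V.sum e
      ... | yes _ | yes _ = refl
      ... | no  _ | no  _ = refl
      ... | yes p | no  f = contradiction (≡.trans (≡.sym (ℕₚ.m+[n∸m]≡n k≤s)) (cong (k ℕ.+_) p)) f
      ... | no  f | yes p = contradiction (≡.trans (cong (_∸ k) p) (ℕₚ.m+n∸m≡n k (V.sum e))) f
    choose (no k≰s) = trans (pick-none (suc s) k inner (ℕₚ.≰⇒> k≰s)) (sym none)
      where
      none : (if ⌊ s ℕ.≟ k ℕ.+ V.sum e ⌋ then φ (k ∷ e) else 0#) ≈ 0#
      none with s ℕ.≟ k ℕ.+ V.sum e
      ... | yes p = contradiction (subst (k ℕ.≤_) (≡.sym p) (ℕₚ.m≤m+n k (V.sum e))) k≰s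
      ... | no  _ = refl

  -- A crude bound that exceeds the degree of every term.
  degreeBound : ∀ {n} → Poly n → ℕ
  degreeBound []      = 0
  degreeBound (t ∷ p) = suc (V.sum (proj₂ t)) ℕ.+ degreeBound p

  coeff-beyond : ∀ {n} (p : Poly n) e → degreeBound p ≤ V.sum e → coeff p e ≈ 0#
  coeff-beyond []      e b≤ = refl
  coeff-beyond (t ∷ p) e b≤ with Vₚ.≡-dec ℕ._≟_ (proj₂ t) e
  ... | yes ≡.refl = contradiction (ℕₚ.≤-trans (ℕₚ.m≤m+n _ (degreeBound p)) b≤) ℕₚ.1+n≰n
  ... | no  _      = trans (+-identityˡ _) (coeff-beyond p e (ℕₚ.≤-trans (ℕₚ.m≤n+m _ _) b≤))

  -- Extends the coefficients of a polynomial in n variables to all exponent lists. Compositions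
  -- with more than n parts receive an arbitrary value, but no vector of length n compresses to one.
  coeffList : ∀ {n} → Poly n → List ℕ → Carrier
  coeffList {n} f e = coeff f (pad n (compress e))

  coeffList-quasi : ∀ {n} (f : Poly n) → Quasi (coeffList f)
  coeffList-quasi {n} f e = reflexive (cong (λ l → coeff f (pad n l)) (≡.sym (compress-idempotent e)))

  components : ∀ {n} → Poly n → Poly n
  components {n} f = sumₚ (map (λ s → polyOf′ s (coeffList f) n) (upTo (degreeBound f)))

  components≋ : ∀ {n} (f : Poly n) → IsQuasisymmetricₚ f → f ≋ components f
  components≋ {n} f f-quasi = mk λ e → sym (trans (coeff-sumₚ (upTo (degreeBound f)) e)
    (trans (∑-cong (upTo (degreeBound f)) (λ s → trans (reflexive (∑-map _ (vecsOfSum n s) (at e)))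
        (coeff-vecsOfSum s (λ v → coeffList f (V.toList v)) e)))
      (choose e (V.sum e <? degreeBound f))))
    where
    coeff-sumₚ : ∀ ss e → coeff (sumₚ (map (λ s → polyOf′ s (coeffList f) n) ss)) e ≈
      ∑ ss (λ s → coeff (polyOf′ s (coeffList f) n) e)
    coeff-sumₚ []       e = refl
    coeff-sumₚ (s ∷ ss) e = trans (coeff-+ (polyOf′ s (coeffList f) n) _ e) (+-congˡ (coeff-sumₚ ss e))
    coeffList≈ : ∀ e → coeffList f (V.toList e) ≈ coeff f e
    coeffList≈ e = f-quasi _ e (compress-pad n (V.toList e) (length-compress e))
    choose : ∀ e → Dec (V.sum e < degreeBound f) →
      ∑< (degreeBound f) (λ s → if ⌊ s ℕ.≟ V.sum e ⌋ then coeffList f (V.toList e) else 0#) ≈ coeff f e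
    choose e (yes e<) = trans (pick (degreeBound f) (V.sum e) _ e<) (coeffList≈ e)
    choose e (no  e≮) = trans (pick-none (degreeBound f) (V.sum e) _ (ℕₚ.≮⇒≥ e≮)) (sym (coeff-beyond f e (ℕₚ.≮⇒≥ e≮)))

  module _ {n : ℕ} where
    private
      module P = CommutativeRing (polyRing {n})
      module PL = RingLemmas (polyRing {n})

    monomial : Vec ℕ n → Poly n
    monomial e = (1# , e) ∷ []

    -- The exponent ∑ e_i g_i of a product of powers of monomials, built one unit at a time as `pow`
    -- is.
    combine : ∀ {k} → (Fin k → Vec ℕ n) → Vec ℕ k → Vec ℕ n
    combine g []          = V.replicate n 0
    combine g (zero  ∷ e) = combine (g ∘ F.suc) e
    combine g (suc j ∷ e) = V.zipWith ℕ._+_ (g F.zero) (combine g (j ∷ e))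

    monomial-* : ∀ d e → monomial d *ₚ monomial e ≋ monomial (V.zipWith ℕ._+_ d e)
    monomial-* d e = mk λ f → +-congʳ (at-cong f (*-identityˡ 1#))

    mono-monomials : ∀ {k} (g : Fin k → Vec ℕ n) e → PL.mono (V.tabulate (monomial ∘ g)) e ≋ monomial (combine g e)
    mono-monomials g []          = P.refl
    mono-monomials g (zero  ∷ e) = P.trans (P.*-identityˡ (PL.mono (V.tabulate (monomial ∘ g ∘ F.suc)) e)) (mono-monomials (g ∘ F.suc) e)
    mono-monomials g (suc j ∷ e) = P.trans (P.*-assoc (monomial (g F.zero)) (PL.pow (monomial (g F.zero)) j) (PL.mono (V.tabulate (monomial ∘ g ∘ F.suc)) e)) (P.trans
      (P.*-congˡ {x = monomial (g F.zero)} (mono-monomials g (j ∷ e)))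
      (monomial-* (g F.zero) (combine g (j ∷ e))))

  private
    combine-suc : ∀ {n k} (g : Fin k → Vec ℕ n) e → combine (λ i → 0 ∷ g i) e ≡ 0 ∷ combine g e
    combine-suc g []          = ≡.refl
    combine-suc g (zero  ∷ e) = combine-suc (g ∘ F.suc) e
    combine-suc g (suc j ∷ e) = cong (V.zipWith ℕ._+_ (0 ∷ g F.zero)) (combine-suc g (j ∷ e))

    combine-cong : ∀ {n k} {g h : Fin k → Vec ℕ n} → (∀ i → g i ≡ h i) → ∀ e → combine g e ≡ combine h e
    combine-cong eq []          = ≡.refl
    combine-cong eq (zero  ∷ e) = combine-cong (eq ∘ F.suc) e
    combine-cong eq (suc j ∷ e) = ≡.cong₂ (V.zipWith ℕ._+_) (eq F.zero) (combine-cong eq (j ∷ e))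

    combine-unitVec : ∀ {n} (e : Vec ℕ n) → combine unitVec e ≡ e
    combine-unitVec []          = ≡.refl
    combine-unitVec (zero  ∷ e) = ≡.trans (combine-cong unitVec-suc e) (≡.trans (combine-suc unitVec e) (cong (0 ∷_) (combine-unitVec e)))
    combine-unitVec {suc n} (suc j ∷ e) = ≡.trans (cong (V.zipWith ℕ._+_ (unitVec F.zero)) (combine-unitVec (j ∷ e)))
      (cong (suc j ∷_) (≡.trans (cong (λ z → V.zipWith ℕ._+_ z e) tabulate-0) (Vₚ.zipWith-identityˡ ℕₚ.+-identityˡ e)))

  -- Results on values become results on polynomials: a polynomial is its own value at the
  -- variables.
  ev-vars : ∀ {n} (p : Poly n) → p ≋ LP.ev (V.tabulate var) p
  ev-vars {n} []      = P.refl
    where module P = CommutativeRing (polyRing {n})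
  ev-vars {n} (t ∷ p) = P.+-cong {x = t ∷ []} (P.sym (P.trans
    (P.*-congˡ {x = constₚ (proj₁ t)} (P.trans (mono-monomials unitVec (proj₂ t)) (P.reflexive (cong monomial (combine-unitVec (proj₂ t))))))
    (mk λ e → +-congʳ (trans (at-cong e (*-identityʳ (proj₁ t)))
      (reflexive (cong (λ d → at e (proj₁ t , d)) (Vₚ.zipWith-identityˡ ℕₚ.+-identityˡ (proj₂ t)))))))) (ev-vars p)
    where module P = CommutativeRing (polyRing {n})

-- Divided symmetrization of quasisymmetric polynomials

module TopDegree {c ℓ : Level} (K : Field c ℓ) (q : Field.Carrier K)
  (2-cancelᴷ : RingLemmas.2-Cancellable (Field.cring K))
  (inv : ℕ → Field.Carrier K)
  (inv-bracket : Klyachko.BracketInverse K q inv)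
  (n r d : ℕ) (n≡1+r : n ≡ suc r) (r≡1+d : r ≡ suc d) where
  private module KF = Field K
  open Polynomials K
  open Degrees K
  open QuasiSym K
  open Antisymmetrization K q 2-cancelᴷ
  open DividedSymmetrization K q 2-cancelᴷ n r n≡1+r
  open QuasisymmetricPolynomials K using (components; components≋; coeffList; coeffList-quasi; ev-vars; degreeBound)
  private
    module P = CommutativeRing (polyRing {n})
    module V′ = Values (polyRing {n}) constₚ const-hom
    module N = Naturality K
  open RingLemmas (polyRing {n}) using (≈-from-difference)
  open Quotient (polyRing {n}) I I-resp I-0 I-+ I-*
  private
    module Q = CommutativeRing quotient
    ι-hom : Hom.IsHom KF.cring quotient constₚ
    ι-hom = ∘-hom {A = KF.cring} const-hom

  relation : ∀ i → (u i *ₚ x (suc i)) ~ (constₚ q *ₚ (u i *ₚ x i))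
  relation zero    = embed (P.sym (P.zeroʳ (constₚ q)))
  relation (suc i) = by-cases (suc i <? n)
    where
    by-cases : Dec (suc i < n) → (u (suc i) *ₚ x (suc (suc i))) ~ (constₚ q *ₚ (u (suc i) *ₚ x (suc i)))
    by-cases (yes i<n) = mod (I-relation i i<n)
    by-cases (no  i≮n) = Q.trans (zero-left (x (suc (suc i)))) (Q.sym (Q.trans
      (Q.*-congˡ {x = constₚ q} (zero-left (x (suc i)))) (Q.zeroʳ (constₚ q))))
      where
      zero-left : ∀ p → (u (suc i) *ₚ p) ~ 0ₚ
      zero-left p = Q.trans (Q.*-congʳ {x = p} (I⇒~0 (I-u (suc i) (ℕₚ.≮⇒≥ i≮n)))) (Q.zeroˡ p)

  open Klyachko K q
  open Relations quotient constₚ ι-hom inv inv-bracket u x Q.refl Q.refl (λ i → Q.refl) relation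
  open Finite n (λ i n≤i → I⇒~0 (I-u i n≤i))

  value~values : ∀ F s m → V′.value F s (V′.initial x m) ~ values F s m
  value~values F s m = Q.trans
    (N.value-natural polyRing quotient constₚ const-hom id quotient-hom ι-hom F s (V′.initial x m))
    (Q.reflexive (cong (Values.value quotient constₚ ι-hom F s) (Vₚ.map-id (V′.initial x m))))

  nth-vars : ∀ {k} (f : Fin k → Poly n) i → nth (V.tabulate f) (F.toℕ i) ≡ f i
  nth-vars f F.zero    = ≡.refl
  nth-vars f (F.suc i) = nth-vars (f ∘ F.suc) i

  initial≡vars : V′.initial x n ≡ vars
  initial≡vars = Vₚ.tabulate-cong (λ i → nth-vars var i)

  polyOf′≋value : ∀ F s → polyOf′ s F n ≋ V′.value F s (V′.initial x n)
  polyOf′≋value F s = P.trans (ev-vars (polyOf′ s F n)) (P.trans (V′.ev-polyOf′ F s vars)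
    (P.reflexive (cong (V′.value F s) (≡.sym initial≡vars))))

  -- A generator of the ideal may be inhomogeneous. Its components of positive degree vanish by the
  -- relations, and the one of degree 0 is its constant term.
  I-quasisymmetric : ∀ f → IsQuasisymmetricₚ f → ZeroConstantTermₚ f → I f
  I-quasisymmetric f f-quasi f0 = I-resp (P.sym (components≋ f f-quasi)) (go (upTo (degreeBound f)))
    where
    component : ∀ s → I (polyOf′ s (coeffList f) n)
    component s = I-resp (P.sym (polyOf′≋value (coeffList f) s)) (~0⇒I (Q.trans (value~values (coeffList f) s n) (zero-values s)))
      where
      zero-values : ∀ s → values (coeffList f) s n ~ 0ₚ
      zero-values zero    = Q.trans
        (Values.value-degree-0 quotient constₚ ι-hom (coeffList-quasi f) (Values.initial quotient constₚ ι-hom x n))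
        (embed {constₚ (coeffList f [])} {0ₚ}
          (P.trans (LP.ι-cong (KF.trans (KF.reflexive (cong (coeff f) (pad-[] n))) f0)) LP.ι-0))
      zero-values (suc s) = values-vanish (coeffList-quasi f) s
    go : ∀ ss → I (sumₚ (map (λ s → polyOf′ s (coeffList f) n) ss))
    go []       = I-0
    go (s ∷ ss) = I-+ (component s) (go ss)

  -- `Λ` kills each product of a cofactor and a generator because the generator is in the radical;
  -- it agrees with the true antisymmetrization on their sum, which is homogeneous of degree r.
  DivSymEq-ideal : ∀ g → IsHomogeneousₚ r g → InQSymIdeal n g → DivSymEq q n g KF.0#
  DivSymEq-ideal g g-hom (gens , gens-quasi , g≈) = un (P.trans (antisym-stair g) (P.trans (P.sym (Λ-homogeneous g g-hom))
    (P.trans (lin-cong ψ (mk {p = g} {p′ = sumₚ (map (λ hp → proj₁ hp *ₚ proj₂ hp) gens)} g≈)) (P.trans (go gens gens-quasi)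
    (P.sym (P.trans (P.*-congʳ {x = vandermonde n} LP.ι-0) (P.zeroˡ (vandermonde n))))))))
    where
    go : ∀ gens → All (λ hp → IsQuasisymmetricₚ (proj₂ hp) × ZeroConstantTermₚ (proj₂ hp)) gens →
      Λ (sumₚ (map (λ hp → proj₁ hp *ₚ proj₂ hp) gens)) ≋ 0ₚ
    go []               []                   = P.refl
    go ((h , p) ∷ gens) ((p-quasi , p0) ∷ qs) = P.trans (lin-+ ψ (h *ₚ p) _)
      (P.trans (P.+-cong (I-quasisymmetric p p-quasi p0 h) (go gens qs)) (P.+-identityˡ 0ₚ))

  -- The sequence x_1,...,x_m,0,0,..., at which f takes the value `truncPoly`.
  truncated : ℕ → ℕ → Poly n
  truncated m zero    = 0ₚ
  truncated m (suc j) = if j <ᵇ m then nth vars j else 0ₚ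

  truncated-large : ∀ m j → m < j → truncated m j ≋ 0ₚ
  truncated-large m (suc j) (s≤s m≤j) with j <ᵇ m in eq
  ... | false = P.refl
  ... | true  = contradiction (ℕₚ.<ᵇ⇒< j m (subst T (≡.sym eq) _)) (ℕₚ.≤⇒≯ m≤j)

  truncated-small : ∀ m j → j < m → truncated m (suc j) ≡ x (suc j)
  truncated-small m j j<m with j <ᵇ m | ℕₚ.<⇒<ᵇ j<m
  ... | true | _ = ≡.refl

  truncPoly~values : ∀ f m → m ≤ n → truncPoly r f m n ~ values (coeffF f) r m
  truncPoly~values f m m≤n = Q.trans (embed (P.trans (substₚ≋ev σ (polyOf r f n))
    (P.trans (V′.ev-polyOf′ F r (V.tabulate σ)) (P.trans (P.reflexive (cong (V′.value F r) σ≡)) shrink))))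
    (value~values F r m)
    where
    F = coeffF f
    σ : Fin n → Poly n
    σ i = if F.toℕ i <ᵇ m then var i else 0ₚ
    σ≡ : V.tabulate σ ≡ V′.initial (truncated m) n
    σ≡ = Vₚ.tabulate-cong (λ i → cong (λ p → if F.toℕ i <ᵇ m then p else 0ₚ) (≡.sym (nth-vars var i)))
    shrink : V′.value F r (V′.initial (truncated m) n) ≋ V′.value F r (V′.initial x m)
    shrink = P.trans (P.reflexive (≡.cong₂ (λ s k → V′.value F s (V′.initial (truncated m) k)) r≡1+d (≡.sym (ℕₚ.m∸n+n≡m m≤n))))
      (P.trans (V′.value-truncate (truncated m) (quasisym f) d m (truncated-large m) (n ∸ m))
      (P.reflexive (≡.cong₂ (V′.value F) (≡.sym r≡1+d) (Vₚ.tabulate-cong (λ i → truncated-small m (F.toℕ i) (Fₚ.toℕ<n i))))))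

  -- (−x_2)⋯(−x_n), which represents u_1⋯u_r / [r]_q! and has divided symmetrization 1.
  W : Poly n
  W = tail-product r 1

  values~W : ∀ F → Quasi F → ∀ m → values F r m ~ (constₚ (numerator r r F m) *ₚ W)
  values~W F F-quasi m = Q.trans top (Q.*-congˡ {x = constₚ (numerator r r F m)} (Q.sym
    (tail-product-H r 0 (≡.trans (ℕₚ.+-comm r 1) (≡.sym n≡1+r)))))
    where
    top : values F r m ~ (constₚ (numerator r r F m) *ₚ H r 1)
    top = subst (λ k → values F k m ~ (constₚ (numerator k k F m) *ₚ H k 1)) (≡.sym r≡1+d)
      (values-top d (λ i 2+d≤i → I⇒~0 (I-u i (subst (_≤ i) (≡.sym (≡.trans n≡1+r (cong suc r≡1+d))) 2+d≤i))) F-quasi m)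

  allDeg-W : ∀ k i → AllDeg k (tail-product k i)
  allDeg-W zero    i = allDeg-const KF.1#
  allDeg-W (suc k) i = allDeg-* (allDeg-neg (allDeg-x (suc i))) (allDeg-W k (suc i))

  ev-W : ∀ z k i → ev z (tail-product k i) ≋ window z i k
  ev-W z zero    i = LP.ev-1 z
  ev-W z (suc k) i = P.trans (LP.ev-* z (0ₚ -ₚ x (suc i)) (tail-product k (suc i)))
    (P.*-cong (P.trans (LP.ev-minus z 0ₚ (x (suc i))) (P.+-congˡ {x = 0ₚ} (P.-‿cong (ev-x z i)))) (ev-W z k (suc i)))

  Λ′-W : Λ′ W ≋ vandermonde n
  Λ′-W = P.trans (P.sym (Λ′-𝒜 W)) (P.trans (𝒜-cong (λ z → P.*-congʳ {x = St z} (ev-W z r 1)))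
    (P.trans (window-normalization r n≡1+r var) (P.sym vandermonde≋Δ)))

  allDeg-truncPoly : ∀ f m → AllDeg r (truncPoly r f m n)
  allDeg-truncPoly f m = allDeg-subst _ (polyOf r f n) (λ i → truncated-var i (F.toℕ i <ᵇ m))
    (Allₚ.map⁺ (vecsOfSum-sum n r))
    where
    truncated-var : ∀ i b → AllDeg 1 (if b then var i else 0ₚ)
    truncated-var i true  = allDeg-var i
    truncated-var i false = []

  -- Modulo the radical the polynomial is a multiple of `W`. Pairing with 1 turns this into an
  -- equality of antisymmetrizations, and that of `W` is the Vandermonde product.
  DivSymEq-truncPoly : ∀ f m → m ≤ n → DivSymEq q n (truncPoly r f m n) (numerator r r (coeffF f) m)
  DivSymEq-truncPoly f m m≤n = un (P.trans (antisym-stair p) (P.trans (P.sym (Λ-deg (allDeg-truncPoly f m)))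
    (P.trans Λ-agree (P.trans (Λ-deg (allDeg-* (allDeg-const a) (allDeg-W r 1)))
    (P.trans (P.sym (Λ′-𝒜 (constₚ a *ₚ W))) (P.trans
      (𝒜-cong (λ z → P.trans (P.*-congʳ {x = St z} (P.trans (LP.ev-* z (constₚ a) W) (P.*-congʳ {x = ev z W} (LP.ev-const z a))))
        (P.*-assoc (constₚ a) (ev z W) (St z))))
    (P.trans (𝒜-scale (constₚ a) (λ z → ev z W *ₚ St z)) (P.*-congˡ {x = constₚ a} (P.trans (Λ′-𝒜 W) Λ′-W)))))))))
    where
    p = truncPoly r f m n
    a = numerator r r (coeffF f) m
    p~ : p ~ (constₚ a *ₚ W)
    p~ = Q.trans (truncPoly~values f m m≤n) (values~W (coeffF f) (quasisym f) m)
    Λ-agree : Λ p ≋ Λ (constₚ a *ₚ W)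
    Λ-agree = ≈-from-difference (Λ p) (Λ (constₚ a *ₚ W)) (P.trans
      (P.trans (P.+-congˡ {x = Λ p} (P.sym (lin-neg ψ (constₚ a *ₚ W)))) (P.sym (lin-+ ψ p (-ₚ (constₚ a *ₚ W)))))
      (P.trans (lin-cong ψ (P.sym (P.*-identityˡ (p -ₚ constₚ a *ₚ W)))) (difference p~ 1ₚ)))

-- Invertibility of the q-integers, and assembly of the three statements

module Brackets {c ℓ : Level} (K : Field c ℓ) (q : Field.Carrier K) where
  open Field K hiding (zero)
  open Over K using (natK; powK)
  open Polynomials K using (powK≡pow)
  open RingLemmas cring
  open SetoidReasoning setoid

  open Klyachko K q using (bracket)

  bracket-geometric : ∀ n → pow q n ≈ 1# + (q - 1#) * bracket n
  bracket-geometric zero    = solve 1 (λ q → con (+ 1) := con (+ 1) :+ (q :- con (+ 1)) :* con (+ 0)) refl q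
  bracket-geometric (suc n) = begin
    q * pow q n
      ≈⟨ solve 2 (λ q p → q :* p := p :+ (q :- con (+ 1)) :* p) refl q (pow q n) ⟩
    pow q n + (q - 1#) * pow q n
      ≈⟨ +-congʳ (bracket-geometric n) ⟩
    1# + (q - 1#) * bracket n + (q - 1#) * pow q n
      ≈⟨ solve 3 (λ q b p → con (+ 1) :+ (q :- con (+ 1)) :* b :+ (q :- con (+ 1)) :* p := con (+ 1) :+ (q :- con (+ 1)) :* (b :+ p)) refl q (bracket n) (pow q n) ⟩
    1# + (q - 1#) * bracket (suc n) ∎

  bracket-1 : q ≈ 1# → ∀ n → bracket n ≈ natK n
  bracket-1 q≈1 zero    = refl
  bracket-1 q≈1 (suc n) = trans (+-cong (bracket-1 q≈1 n) (trans (pow-cong n q≈1) (pow-1 n))) (+-comm _ _)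
    where
    pow-1 : ∀ n → pow 1# n ≈ 1#
    pow-1 zero    = refl
    pow-1 (suc n) = trans (*-identityˡ _) (pow-1 n)

  -- If [n]_q = 0 with n > 0, then q^n = 1 + (q-1)[n]_q = 1, so q = 1 and [n]_q is the integer n,
  -- which is nonzero in characteristic zero.
  bracket≉0 : (∀ n → ¬ (natK (suc n) ≈ 0#)) → (∀ n → powK q (suc n) ≈ 1# → q ≈ 1#) → ∀ n → ¬ (bracket (suc n) ≈ 0#)
  bracket≉0 char-0 no-root n b≈0 = char-0 n (trans (sym (bracket-1 q≈1 (suc n))) b≈0)
    where
    q≈1 : q ≈ 1#
    q≈1 = no-root n (trans (reflexive (powK≡pow q (suc n))) (trans (bracket-geometric (suc n))
      (trans (+-congˡ (trans (*-congˡ b≈0) (zeroʳ _))) (+-identityʳ 1#))))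

theorem1p3 : ∀ {c ℓ} (K : Field c ℓ) → let open Field K in let open Over K in
    (∀ n → ¬ (natK (suc n) ≈ 0#)) →
    ∀ (q : Carrier) →
    (∀ n → powK q (suc n) ≈ 1# → q ≈ 1#) →
    ∀ (r : ℕ) → 0 < r →
    ((f : QSymFun) → IsHomogeneousF r f →
    (Σ (Fin (suc r) → Carrier) λ a →
    (∀ m → DivSymEq q (suc r) (truncPoly r f (suc (toℕ m)) (suc r)) (a m))
    × (∀ j → cauchy (principalSeries q r f) (qPochSeries q (suc r)) j
    ≈ numeratorSeries a j))
    × IsZeroInK q r (substₚ (uSubst r) (polyOf r f (suc r))))
    × ((g : Poly (suc r)) → IsHomogeneousₚ r g → InQSymIdeal (suc r) g →
    DivSymEq q (suc r) g 0#)
theorem1p3 K char-0 q no-root (suc d) 0<r =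
  (λ f _ → (coefficients f , (λ m → DivSymEq-truncPoly f (suc (toℕ m)) (Fₚ.toℕ<n m)) , series f)
         , KlyachkoAlgebra.vanishes K q inv inv-bracket (suc d) (quasisym f) ≡.refl)
  , DivSymEq-ideal
  where
  open Field K hiding (zero)
  open Over K
  open RingLemmas cring
  open Klyachko K q using (bracket)

  inv : ℕ → Carrier
  inv b = proj₁ (inverse (bracket (suc b)) (Brackets.bracket≉0 K q char-0 no-root b))

  inv-bracket : ∀ b → inv b * bracket (suc b) ≈ 1#
  inv-bracket b = trans (*-comm _ _) (proj₂ (inverse (bracket (suc b)) (Brackets.bracket≉0 K q char-0 no-root b)))

  2-cancel : ∀ x → x + x ≈ 0# → x ≈ 0#
  2-cancel x x+x≈0 = trans (sym (*-identityʳ x)) (trans (*-congˡ (sym half-2))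
    (trans (solve 2 (λ x h → x :* ((con (+ 1) :+ (con (+ 1) :+ con (+ 0))) :* h) := (x :+ x) :* h) refl x half)
      (trans (*-congʳ x+x≈0) (zeroˡ half))))
    where
    half = proj₁ (inverse (natK 2) (char-0 1))
    half-2 = proj₂ (inverse (natK 2) (char-0 1))

  open TopDegree K q 2-cancel inv inv-bracket (suc (suc d)) (suc d) d ≡.refl ≡.refl

  -- The position m in `Fin` stands for the power t^{m+1}, and for a truncation to m + 1 variables.
  coefficients : QSymFun → Fin (suc (suc d)) → Carrier
  coefficients f m = Klyachko.numerator K q (suc d) (suc d) (coeffF f) (suc (toℕ m))

  series : ∀ f j → cauchy (principalSeries q (suc d) f) (qPochSeries q (suc (suc d))) j ≈ numeratorSeries (coefficients f) j
  series f j = trans (Principal.principal-numerator K q inv inv-bracket d f j) (sym (collect j))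
    where
    pick : ∀ N (g : ℕ → Carrier) j → j < N → ∑ (allFin N) (λ i → if toℕ i ≡ᵇ j then g (toℕ i) else 0#) ≈ g j
    pick (suc N) g zero    j<N         = trans (reflexive (∑-allFin N _)) (trans (+-congˡ (∑-0 (allFin N) (λ _ → refl))) (+-identityʳ _))
    pick (suc N) g (suc j) (s≤s j<N) = trans (reflexive (∑-allFin N _)) (trans (+-identityˡ _) (pick N (g ∘ suc) j j<N))
    pick-none : ∀ N (g : ℕ → Carrier) j → N ≤ j → ∑ (allFin N) (λ i → if toℕ i ≡ᵇ j then g (toℕ i) else 0#) ≈ 0#
    pick-none zero    g j       N≤j         = refl
    pick-none (suc N) g (suc j) (s≤s N≤j) = trans (reflexive (∑-allFin N _)) (trans (+-identityˡ _) (pick-none N (g ∘ suc) j N≤j))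
    c = Klyachko.numerator K q (suc d) (suc d) (coeffF f)
    collect : ∀ j → numeratorSeries (coefficients f) j ≈ c j
    -- In positive degree the numerator begins with a shift, so its constant coefficient is 0.
    collect zero    = ∑-0 (allFin (suc (suc d))) (λ _ → refl)
    collect (suc j) = by-cases (j <? suc (suc d))
      where
      by-cases : Dec (j < suc (suc d)) → numeratorSeries (coefficients f) (suc j) ≈ c (suc j)
      by-cases (yes j<) = pick (suc (suc d)) (c ∘ suc) j j<
      -- Here j ≥ d + 2, so j + 1 exceeds the degree bound d + 1 of the numerator.
      by-cases (no  j≮) = trans (pick-none (suc (suc d)) (c ∘ suc) j (ℕₚ.≮⇒≥ j≮))
        (sym (Klyachko.numerator-degree K q (suc d) (suc d) (coeffF f) ℕₚ.≤-refl (suc j)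
          (ℕₚ.≤-trans (ℕₚ.≮⇒≥ j≮) (ℕₚ.n≤1+n j))))
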